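{- Let $r,p,s,n$ be positive integers such that $p\mid r$, $s\mid r$ and $ps\mid rn$. Let $\epsilon\in\{1,-1\}$ and $k\in\{0,1,\ldots,\frac{r}{p}-1\}$ with $s\mid kn$, let $\zeta=\zeta_r=e^{2\pi i/r}$, and let $\chi_{\epsilon,k}$ be the one-dimensional character of $G(r,p,s,n)$ given by $\chi_{\epsilon,k}(g)=\epsilon^{\mathrm{inv}(|g|)}\zeta_r^{k\cdot c(g)}$. Then, with $m=\lfloor n/2\rfloor$, $$\sum_{g\in G(r,p,s,n)}\chi_{\epsilon,k}(g)\,q^{\mathrm{fmaj}(g)}=\left[\frac{r}{p}\right]_{(\zeta^{k}q)^p}\left[\frac{2r}{p}\right]_{(\epsilon\zeta^{k}q)^p}\cdots\left[\frac{(n-1)r}{p}\right]_{(\epsilon^{n-2}\zeta^{k}q)^p}\left[\frac{nr}{ps}\right]_{(\epsilon^{n-1}\zeta^{k}q)^{p}}\left\{[p]_{\zeta^{k}q}^{\,n-m}\,[p]_{\epsilon\zeta^{k}q}^{\,m}\right\}_{q^p}.$$ (The product runs over the factors $\left[\frac{ir}{p}\right]_{(\epsilon^{i-1}\zeta^k q)^p}$ for $1\le i\le n-1$, followed by the factor $\left[\frac{nr}{ps}\right]_{(\epsilon^{n-1}\zeta^k q)^p}$.)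
   Context: Notation. For a positive integer $m$, $R_m(i)\in\{0,\ldots,m-1\}$ denotes the residue of $i\in\mathbb Z$ modulo $m$. $[m]_x=1+x+\cdots+x^{m-1}$. For a polynomial $F$ in $q$, $\{F\}_{q^p}$ is the polynomial obtained from $F$ by discarding all terms whose degree in $q$ is not divisible by $p$. Groups. $G(r,n)$ is the group of pairs $(c_1,\ldots,c_n;\sigma)$ with $c_i\in\{0,\ldots,r-1\}$ (the colors) and $\sigma\in S_n$, with product $(d_1,\ldots,d_n;\tau)(c_1,\ldots,c_n;\sigma)=(R_r(c_1+d_{\sigma(1)}),\ldots,R_r(c_n+d_{\sigma(n)});\tau\sigma)$. For $p\mid r$, $G(r,p,n)$ is the subgroup of elements with $c_1+\cdots+c_n\equiv 0 \bmod p$. For $s\mid r$ with $ps\mid rn$, $C_s\subseteq G(r,p,n)$ is the cyclic subgroup of order $s$ generated by $(r/s,\ldots,r/s;\mathrm{id})$, and $G(r,p,s,n)=G(r,p,n)/C_s$. For $g\in G(r,p,s,n)$ the class of $(c_1,\ldots,c_n;\sigma)$, $|g|=\sigma$, and $c(g)=c_1+\cdots+c_n$ is the sum of the colors of any representative of $g$ in $G(r,p,n)$ (the value $\zeta_r^{k c(g)}$ does not depend on the representative when $s\mid kn$). $\mathrm{inv}(\sigma)$ is the number of pairs $i<j$ with $\sigma(i)>\sigma(j)$. Flag major index. For $g\in G(r,p,s,n)$ represented by $(c_1,\ldots,c_n;\sigma)$ let $\mathrm{HDes}(g)=\{i\in\{1,\ldots,n-1\}: c_i=c_{i+1},\ \sigma(i)>\sigma(i+1)\}$,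 $h_i(g)=\#\{j\ge i: j\in\mathrm{HDes}(g)\}$, $k_n(g)=R_{r/s}(c_n)$, $k_i(g)=k_{i+1}(g)+R_r(c_i-c_{i+1})$ for $1\le i\le n-1$, $\lambda_i(g)=r\,h_i(g)+k_i(g)$, and $\mathrm{fmaj}(g)=\sum_{i=1}^n\lambda_i(g)$. These do not depend on the representative chosen. -}

module Defs where

open import Algebra.Bundles using (CommutativeRing; Group)
open import Algebra.Bundles.Raw using (RawSemiring)
import Algebra.Definitions.RawSemiring as RawSemiringDefinitions
import Algebra.Properties.CommutativeMonoid.Sum as Sum
import Algebra.Properties.Monoid.Mult as Mult
import Algebra.Properties.Semiring.Exp as Exp
open import Data.Bool.Base using (if_then_else_)
open import Data.Fin.Base as Fin using (Fin; zero; suc; toℕ; inject₁)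
open import Data.Fin.Permutation as Perm using (Permutation′; _⟨$⟩ʳ_; _⟨$⟩ˡ_; _∘ₚ_)
import Data.Fin.Properties as Fin
open import Data.Integer.Base as ℤ using (ℤ; +_; _%ℕ_)
open import Data.List.Base as List
  using (List; []; _∷_; _++_; length; map; filter; foldr; replicate; allFin; cartesianProduct; cartesianProductWith; deduplicate)
open import Data.List.Membership.Propositional using (_∈_)
open import Data.List.Membership.Propositional.Properties using (∈-allFin; ∈-cartesianProductWith⁺)
open import Data.List.Relation.Unary.Any as Any using (Any; here; there)
open import Data.List.Relation.Unary.Enumerates.Setoid using (IsEnumeration)
open import Data.List.Relation.Unary.Enumerates.Setoid.Properties using (deduplicate⁺)
open import Data.List.Relation.Unary.Unique.DecSetoid.Properties using (deduplicate-!)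
open import Data.List.Relation.Unary.Unique.Setoid using (Unique)
open import Data.Nat.Base using (ℕ; zero; suc; _+_; _*_; _∸_; _/_; _%_; NonZero; _<_; >-nonZero)
open import Data.Nat.DivMod
open import Data.Nat.Divisibility using (_∣_; _∣?_; ∣⇒≤)
import Data.Nat.Properties as ℕ
open import Data.Product.Base using (_×_; _,_; ∃)
import Data.Vec.Functional as Vector
open import Function.Base using (_∘_; _on_)
open import Level using (_⊔_; 0ℓ)
open import Relation.Binary.Bundles using (Setoid; DecSetoid)
open import Relation.Binary.Core using (Rel)
open import Relation.Binary.PropositionalEquality
open import Relation.Nullary using (¬_; Dec; yes; no; does; contradiction)
open import Relation.Nullary.Decidable using (_×-dec_; map′)

module ℕΣ = Sum ℕ.+-0-commutativeMonoid

R : (m : ℕ) .{{_ : NonZero m}} → ℤ → ℕ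
R m i = i %ℕ m

/-nonZero : ∀ {r s} .{{_ : NonZero r}} .{{_ : NonZero s}} → s ∣ r → NonZero (r / s)
/-nonZero {r} {s} s∣r = >-nonZero (m≥n⇒m/n>0 (∣⇒≤ s∣r))

record ColouredPerm (r n : ℕ) : Set where
  constructor _⨾_
  field
    colour : Fin n → Fin r
    perm   : Permutation′ n

open ColouredPerm public

c : ∀ {r n} → ColouredPerm r n → ℕ
c g = ℕΣ.sum (toℕ ∘ colour g)

module _ {r n : ℕ} where

  infix 4 _≋_
  record _≋_ (g h : ColouredPerm r n) : Set where
    constructor _⨾_
    field
      colour-≡ : ∀ i → colour g i ≡ colour h i
      perm-≈   : perm g Perm.≈ perm h

  open _≋_ public

module _ {r n : ℕ} .{{_ : NonZero r}} where

  -- `π ∘ₚ ρ` applies π first, so `perm h ∘ₚ perm g` is the product τσ.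
  infixl 7 _∙_
  _∙_ : ColouredPerm r n → ColouredPerm r n → ColouredPerm r n
  g ∙ h = (λ i → (toℕ (colour h i) + toℕ (colour g (perm h ⟨$⟩ʳ i))) mod r)
        ⨾ (perm h ∘ₚ perm g)

  identity : ColouredPerm r n
  identity = (λ _ → 0 mod r) ⨾ Perm.id

  infix 8 _⁻¹
  _⁻¹ : ColouredPerm r n → ColouredPerm r n
  g ⁻¹ = (λ i → (r ∸ toℕ (colour g (perm g ⟨$⟩ˡ i))) mod r) ⨾ Perm.flip (perm g)

module _ {r : ℕ} .{{_ : NonZero r}} where
  toℕ-mod : ∀ m → toℕ (m mod r) ≡ m % r
  toℕ-mod m = Fin.toℕ-fromℕ< (m%n<n m r)

  mod-cong : ∀ {a b} → a % r ≡ b % r → a mod r ≡ b mod r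
  mod-cong {a} {b} eq = Fin.toℕ-injective (trans (toℕ-mod a) (trans eq (sym (toℕ-mod b))))

  mod-toℕ : ∀ (x : Fin r) → toℕ x mod r ≡ x
  mod-toℕ x = Fin.toℕ-injective (trans (toℕ-mod _) (m<n⇒m%n≡m (Fin.toℕ<n x)))

  %-absorbˡ : ∀ a b → (a % r + b) % r ≡ (a + b) % r
  %-absorbˡ a b = begin
    (a % r + b) % r          ≡⟨ %-distribˡ-+ (a % r) b r ⟩
    (a % r % r + b % r) % r  ≡⟨ cong (λ x → (x + b % r) % r) (m%n%n≡m%n a r) ⟩
    (a % r + b % r) % r      ≡⟨ %-distribˡ-+ a b r ⟨
    (a + b) % r              ∎ where open ≡-Reasoning

  %-absorbʳ : ∀ a b → (a + b % r) % r ≡ (a + b) % r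
  %-absorbʳ a b = begin
    (a + b % r) % r  ≡⟨ cong (_% r) (ℕ.+-comm a (b % r)) ⟩
    (b % r + a) % r  ≡⟨ %-absorbˡ b a ⟩
    (b + a) % r      ≡⟨ cong (_% r) (ℕ.+-comm b a) ⟩
    (a + b) % r      ∎ where open ≡-Reasoning

  mod-+0 : ∀ (x : Fin r) → (toℕ x + toℕ (0 mod r)) mod r ≡ x
  mod-+0 x = trans (mod-cong (begin
    (toℕ x + toℕ (0 mod r)) % r  ≡⟨ cong (λ y → (toℕ x + y) % r) (toℕ-mod 0) ⟩
    (toℕ x + 0 % r) % r          ≡⟨ %-absorbʳ (toℕ x) 0 ⟩
    (toℕ x + 0) % r              ≡⟨ cong (_% r) (ℕ.+-identityʳ _) ⟩
    toℕ x % r                    ∎)) (mod-toℕ x)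
    where open ≡-Reasoning

  mod-0+ : ∀ (x : Fin r) → (toℕ (0 mod r) + toℕ x) mod r ≡ x
  mod-0+ x = trans (cong (_mod r) (ℕ.+-comm (toℕ (0 mod r)) (toℕ x))) (mod-+0 x)

  mod-inv : ∀ (x : Fin r) → (toℕ x + toℕ ((r ∸ toℕ x) mod r)) mod r ≡ 0 mod r
  mod-inv x = mod-cong (begin
    (toℕ x + toℕ ((r ∸ toℕ x) mod r)) % r  ≡⟨ cong (λ y → (toℕ x + y) % r) (toℕ-mod (r ∸ toℕ x)) ⟩
    (toℕ x + (r ∸ toℕ x) % r) % r          ≡⟨ %-absorbʳ (toℕ x) (r ∸ toℕ x) ⟩
    (toℕ x + (r ∸ toℕ x)) % r              ≡⟨ cong (_% r) (ℕ.m+[n∸m]≡n (ℕ.<⇒≤ (Fin.toℕ<n x))) ⟩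
    r % r                                  ≡⟨ n%n≡0 r ⟩
    0                                      ≡⟨ m*n%n≡0 0 r ⟨
    0 % r                                  ∎)
    where open ≡-Reasoning

  mod-assoc : ∀ x y z → (z + toℕ ((y + x) mod r)) mod r ≡ (toℕ ((z + y) mod r) + x) mod r
  mod-assoc x y z = mod-cong (begin
    (z + toℕ ((y + x) mod r)) % r  ≡⟨ cong (λ a → (z + a) % r) (toℕ-mod (y + x)) ⟩
    (z + (y + x) % r) % r          ≡⟨ %-absorbʳ z (y + x) ⟩
    (z + (y + x)) % r              ≡⟨ cong (_% r) (ℕ.+-assoc z y x) ⟨
    (z + y + x) % r                ≡⟨ %-absorbˡ (z + y) x ⟨
    ((z + y) % r + x) % r          ≡⟨ cong (λ a → (a + x) % r) (toℕ-mod (z + y)) ⟨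
    (toℕ ((z + y) mod r) + x) % r  ∎)
    where open ≡-Reasoning

-- G(r,n), the colours being added modulo r.
colouredPermGroup : (r n : ℕ) .{{_ : NonZero r}} → Group 0ℓ 0ℓ
colouredPermGroup r n = record
  { Carrier = ColouredPerm r n
  ; _≈_ = _≋_
  ; _∙_ = _∙_
  ; ε   = identity
  ; _⁻¹ = _⁻¹
  ; isGroup = record
    { isMonoid = record
      { isSemigroup = record
        { isMagma = record
          { isEquivalence = record
            { refl  = (λ _ → refl) ⨾ (λ _ → refl)
            ; sym   = λ e → (sym ∘ colour-≡ e) ⨾ (sym ∘ perm-≈ e)
            ; trans = λ e f → (λ i → trans (colour-≡ e i) (colour-≡ f i))
                            ⨾ (λ i → trans (perm-≈ e i) (perm-≈ f i))
            }
          ; ∙-cong = ∙-cong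
          }
        ; assoc = λ g h k → (λ i → mod-assoc (toℕ (colour g _)) (toℕ (colour h _)) (toℕ (colour k i)))
                          ⨾ (λ _ → refl)
        }
      ; identity = (λ g → (mod-+0 ∘ colour g) ⨾ (λ _ → refl))
                 , (λ g → (mod-0+ ∘ colour g) ⨾ (λ _ → refl))
      }
    ; inverse = inverseˡ , inverseʳ
    ; ⁻¹-cong = ⁻¹-cong
    }
  }
  where
  ∙-cong : ∀ {g g′ h h′} → g ≋ g′ → h ≋ h′ → g ∙ h ≋ g′ ∙ h′
  ∙-cong {g} {g′} {h} {h′} e f =
    (λ i → cong₂ (λ x y → (toℕ x + toℕ y) mod r) (colour-≡ f i)
             (trans (cong (colour g) (perm-≈ f i)) (colour-≡ e _)))
    ⨾ (λ i → trans (cong (perm g ⟨$⟩ʳ_) (perm-≈ f i)) (perm-≈ e _))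

  inverseˡ : ∀ g → g ⁻¹ ∙ g ≋ identity
  inverseˡ g =
    (λ i → trans
      (cong (λ j → (toℕ (colour g i) + toℕ ((r ∸ toℕ (colour g j)) mod r)) mod r) (Perm.inverseˡ (perm g)))
      (mod-inv (colour g i)))
    ⨾ (λ i → Perm.inverseˡ (perm g))

  inverseʳ : ∀ g → g ∙ g ⁻¹ ≋ identity
  inverseʳ g =
    (λ i → trans (cong (_mod r) (ℕ.+-comm (toℕ ((r ∸ toℕ (colour g (perm g ⟨$⟩ˡ i))) mod r)) _)) (mod-inv _))
    ⨾ (λ i → Perm.inverseʳ (perm g))

  ⁻¹-cong : ∀ {g h} → g ≋ h → g ⁻¹ ≋ h ⁻¹
  ⁻¹-cong {g} {h} e =
    (λ i → cong (λ x → (r ∸ toℕ x) mod r) (trans (cong (colour g) (inv i)) (colour-≡ e _)))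
    ⨾ inv
    where
    inv : ∀ i → perm g ⟨$⟩ˡ i ≡ perm h ⟨$⟩ˡ i
    inv i = begin
      perm g ⟨$⟩ˡ i                                ≡⟨ cong (perm g ⟨$⟩ˡ_) (Perm.inverseʳ (perm h)) ⟨
      perm g ⟨$⟩ˡ (perm h ⟨$⟩ʳ (perm h ⟨$⟩ˡ i))    ≡⟨ cong (perm g ⟨$⟩ˡ_) (perm-≈ e _) ⟨
      perm g ⟨$⟩ˡ (perm g ⟨$⟩ʳ (perm h ⟨$⟩ˡ i))    ≡⟨ Perm.inverseˡ (perm g) ⟩
      perm h ⟨$⟩ˡ i                                ∎ where open ≡-Reasoning

record G (r p n : ℕ) : Set where
  constructor coloured
  field
    element : ColouredPerm r n
    p∣c     : p ∣ c element

open G public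

module _ (r s n : ℕ) .{{_ : NonZero r}} .{{_ : NonZero s}} where

  private
    module Γ = Group (colouredPermGroup r n)
    open Mult Γ.monoid using (×-homo-+) renaming (_×_ to _times_)

  -- For s = 1 the colour r / s = r is read modulo r, giving the identity.
  generator : ColouredPerm r n
  generator = (λ _ → (r / s) mod r) ⨾ Perm.id

  infixr 8 generator^_
  generator^_ : ℕ → ColouredPerm r n
  generator^ j = j times generator

  infix 4 _∼_
  _∼_ : Rel (ColouredPerm r n) 0ℓ
  g ∼ h = ∃ λ j → g ≋ generator^ j ∙ h

  perm-generator^ : ∀ j i → perm (generator^ j) ⟨$⟩ʳ i ≡ i
  perm-generator^ zero    i = refl
  perm-generator^ (suc j) i = perm-generator^ j i

  colour-generator^ : ∀ j i → colour (generator^ j) i ≡ (j * (r / s)) mod r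
  colour-generator^ zero    i = refl
  colour-generator^ (suc j) i = begin
    (toℕ (colour (generator^ j) i) + toℕ ((r / s) mod r)) mod r
      ≡⟨ cong₂ (λ a b → (toℕ a + b) mod r) (colour-generator^ j i) (toℕ-mod (r / s)) ⟩
    (toℕ ((j * (r / s)) mod r) + (r / s) % r) mod r
      ≡⟨ cong (λ a → (a + (r / s) % r) mod r) (toℕ-mod (j * (r / s))) ⟩
    ((j * (r / s)) % r + (r / s) % r) mod r
      ≡⟨ mod-cong (trans (sym (%-distribˡ-+ (j * (r / s)) (r / s) r)) (cong (_% r) (ℕ.+-comm (j * (r / s)) (r / s)))) ⟩
    (suc j * (r / s)) mod r ∎ where open ≡-Reasoning

  generator^-cong : ∀ {j k} → (j * (r / s)) % r ≡ (k * (r / s)) % r → generator^ j ≋ generator^ k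
  generator^-cong {j} {k} e =
    (λ i → trans (colour-generator^ j i) (trans (mod-cong e) (sym (colour-generator^ k i))))
    ⨾ (λ i → trans (perm-generator^ j i) (sym (perm-generator^ k i)))

  generator^-multiple : ∀ j → generator^ (j * r) ≋ identity
  generator^-multiple j = generator^-cong {j * r} {0} (begin
    (j * r * (r / s)) % r  ≡⟨ cong (_% r) (trans (ℕ.*-assoc j r _) (trans (cong (j *_) (ℕ.*-comm r _)) (sym (ℕ.*-assoc j _ r)))) ⟩
    (j * (r / s) * r) % r  ≡⟨ m*n%n≡0 (j * (r / s)) r ⟩
    0                      ≡⟨ m*n%n≡0 0 r ⟨
    0 % r                  ∎) where open ≡-Reasoning

  generator^-% : ∀ j → generator^ j ≋ generator^ (j % r)
  generator^-% j = begin
    generator^ j                                   ≡⟨ cong generator^_ (m≡m%n+[m/n]*n j r) ⟩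
    generator^ (j % r + j / r * r)                 ≈⟨ ×-homo-+ generator (j % r) (j / r * r) ⟩
    generator^ (j % r) ∙ generator^ (j / r * r)    ≈⟨ Γ.∙-congˡ {generator^ (j % r)} (generator^-multiple (j / r)) ⟩
    generator^ (j % r) ∙ identity                  ≈⟨ Γ.identityʳ _ ⟩
    generator^ (j % r)                             ∎
    where open import Relation.Binary.Reasoning.Setoid Γ.setoid

  ∼-refl : ∀ {g} → g ∼ g
  ∼-refl {g} = 0 , Γ.sym (Γ.identityˡ g)

  ∼-trans : ∀ {g h k} → g ∼ h → h ∼ k → g ∼ k
  ∼-trans {g} {h} {k} (i , e) (j , f) = i + j , (begin
    g                                   ≈⟨ e ⟩
    generator^ i ∙ h                    ≈⟨ Γ.∙-congˡ {generator^ i} f ⟩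
    generator^ i ∙ (generator^ j ∙ k)   ≈⟨ Γ.assoc (generator^ i) (generator^ j) k ⟨
    generator^ i ∙ generator^ j ∙ k     ≈⟨ Γ.∙-congʳ {k} (×-homo-+ generator i j) ⟨
    generator^ (i + j) ∙ k              ∎)
    where open import Relation.Binary.Reasoning.Setoid Γ.setoid

  ∼-sym : ∀ {g h} → g ∼ h → h ∼ g
  ∼-sym {g} {h} (j , e) = j * r ∸ j , (begin
    h                                            ≈⟨ Γ.identityˡ h ⟨
    identity ∙ h                                 ≈⟨ Γ.∙-congʳ {h} (generator^-multiple j) ⟨
    generator^ (j * r) ∙ h                       ≡⟨ cong (λ k → generator^ k ∙ h) (ℕ.m∸n+n≡m (ℕ.m≤m*n j r)) ⟨
    generator^ (j * r ∸ j + j) ∙ h               ≈⟨ Γ.∙-congʳ {h} (×-homo-+ generator (j * r ∸ j) j) ⟩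
    generator^ (j * r ∸ j) ∙ generator^ j ∙ h    ≈⟨ Γ.assoc (generator^ (j * r ∸ j)) (generator^ j) h ⟩
    generator^ (j * r ∸ j) ∙ (generator^ j ∙ h)  ≈⟨ Γ.∙-congˡ {generator^ (j * r ∸ j)} e ⟨
    generator^ (j * r ∸ j) ∙ g                   ∎)
    where open import Relation.Binary.Reasoning.Setoid Γ.setoid

  _≋?_ : (g h : ColouredPerm r n) → Dec (g ≋ h)
  g ≋? h = map′ (λ (x , y) → x ⨾ y) (λ e → colour-≡ e , perm-≈ e)
    (Fin.all? (λ i → colour g i Fin.≟ colour h i) ×-dec
     Fin.all? (λ i → (perm g ⟨$⟩ʳ i) Fin.≟ (perm h ⟨$⟩ʳ i)))

  _∼?_ : (g h : ColouredPerm r n) → Dec (g ∼ h)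
  g ∼? h = map′ (λ (j , e) → toℕ j , e)
    (λ (j , e) → j mod r ,
      Γ.trans e (Γ.∙-congʳ {h} (Γ.trans (generator^-% j) (Γ.reflexive (cong generator^_ (sym (toℕ-mod j)))))))
    (Fin.any? λ j → g ≋? (generator^ toℕ j ∙ h))

  -- The setoid of G(r,p,s,n): elements are represented by elements of G(r,p,n), and
  -- equality is being in the same coset of C_s.
  quotientDecSetoid : (p : ℕ) → DecSetoid 0ℓ 0ℓ
  quotientDecSetoid p = record
    { Carrier = G r p n
    ; _≈_ = _∼_ on element
    ; isDecEquivalence = record
      { isEquivalence = record
        { refl  = λ {g} → ∼-refl {element g}
        ; sym   = λ {g} {h} → ∼-sym {element g} {element h}
        ; trans = λ {g} {h} {k} → ∼-trans {element g} {element h} {element k}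
        }
      ; _≟_ = λ g h → element g ∼? element h
      }
    }

module _ (r p s n : ℕ) .{{_ : NonZero r}} .{{_ : NonZero s}} where

  quotient : Setoid 0ℓ 0ℓ
  quotient = DecSetoid.setoid (quotientDecSetoid r s n p)

  permutations : ∀ n → List (Permutation′ n)
  permutations zero    = Perm.id ∷ []
  permutations (suc n) = cartesianProductWith (Perm.insert zero) (allFin (suc n)) (permutations n)

  insert-cong : ∀ {n} j {π ρ : Permutation′ n} → π Perm.≈ ρ →
                Perm.insert zero j π Perm.≈ Perm.insert zero j ρ
  insert-cong j e zero    = refl
  insert-cong j e (suc i) = cong (Fin.punchIn j) (e i)

  permutations-complete : ∀ {n} (π : Permutation′ n) → ∃ λ ρ → ρ ∈ permutations n × π Perm.≈ ρ
  permutations-complete {zero}  π = Perm.id , here refl , λ ()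
  permutations-complete {suc n} π with permutations-complete (Perm.remove zero π)
  ... | ρ , ρ∈ , e = Perm.insert zero (π ⟨$⟩ʳ zero) ρ , ∈-cartesianProductWith⁺ (Perm.insert zero) (∈-allFin _) ρ∈ ,
    λ i → trans (sym (Perm.insert-remove zero π i)) (insert-cong (π ⟨$⟩ʳ zero) {Perm.remove zero π} {ρ} e i)

  colourings : ∀ n → List (Fin n → Fin r)
  colourings zero    = (λ ()) ∷ []
  colourings (suc n) = cartesianProductWith Vector._∷_ (allFin r) (colourings n)

  colourings-complete : ∀ {n} (f : Fin n → Fin r) → ∃ λ f′ → f′ ∈ colourings n × (∀ i → f i ≡ f′ i)
  colourings-complete {zero}  f = (λ ()) , here refl , λ ()
  colourings-complete {suc n} f with colourings-complete (f ∘ suc)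
  ... | f′ , f′∈ , e = f zero Vector.∷ f′ , ∈-cartesianProductWith⁺ Vector._∷_ (∈-allFin _) f′∈ ,
    λ { zero → refl ; (suc i) → e i }

  restrict : List (ColouredPerm r n) → List (G r p n)
  restrict []       = []
  restrict (g ∷ gs) with p ∣? c g
  ... | yes p∣c = coloured g p∣c ∷ restrict gs
  ... | no  _   = restrict gs

  restrict-∈ : ∀ {g gs} → p ∣ c g → g ∈ gs → Any (λ h → g ≡ element h) (restrict gs)
  restrict-∈ {g} p∣c (here refl) with p ∣? c g
  ... | yes _   = here refl
  ... | no  p∤c = contradiction p∣c p∤c
  restrict-∈ {gs = h ∷ _} p∣c (there g∈) with p ∣? c h
  ... | yes _ = there (restrict-∈ p∣c g∈)
  ... | no  _ = restrict-∈ p∣c g∈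

  representatives : List (G r p n)
  representatives = restrict (cartesianProductWith _⨾_ (colourings n) (permutations n))

  representatives-complete : IsEnumeration quotient representatives
  representatives-complete g with colourings-complete (colour (element g)) | permutations-complete (perm (element g))
  ... | f , f∈ , e | π , π∈ , e′ =
    Any.map (λ { refl → 0 , Γ.trans (e ⨾ e′) (Γ.sym (Γ.identityˡ (f ⨾ π))) })
      (restrict-∈ (subst (p ∣_) (ℕΣ.sum-cong-≗ (cong toℕ ∘ e)) (p∣c g)) (∈-cartesianProductWith⁺ _⨾_ f∈ π∈))
    where module Γ = Group (colouredPermGroup r n)

  -- A sum over G(r,p,s,n) is a sum over a list meeting every coset exactly
  -- once; such a list always exists.
  quotient-finite : ∃ λ gs → IsEnumeration quotient gs × Unique quotient gs
  quotient-finite = _ , deduplicate⁺ D representatives-complete , deduplicate-! D representatives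
    where D = quotientDecSetoid r s n p

inv : ∀ {n} → Permutation′ n → ℕ
inv {n} σ = length (filter
  (λ (i , j) → i Fin.<? j ×-dec (σ ⟨$⟩ʳ j) Fin.<? (σ ⟨$⟩ʳ i))
  (cartesianProduct (allFin n) (allFin n)))

-- Statistics of elements of the quotient are evaluated on a representative.
-- Positions are 0-based: n = suc n-1, the position i ∈ {1,…,n} is the element
-- i - 1 of Fin n, and the descent position i ∈ {1,…,n-1} is i - 1 : Fin n-1.
module _ {r n-1 : ℕ} where

  HDes : ColouredPerm r (suc n-1) → Fin n-1 → Set
  HDes g i = colour g (inject₁ i) ≡ colour g (suc i)
           × (perm g ⟨$⟩ʳ suc i) Fin.< (perm g ⟨$⟩ʳ inject₁ i)

  HDes? : ∀ g i → Dec (HDes g i)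
  HDes? g i = colour g (inject₁ i) Fin.≟ colour g (suc i)
        ×-dec (perm g ⟨$⟩ʳ suc i) Fin.<? (perm g ⟨$⟩ʳ inject₁ i)

  h-part : ColouredPerm r (suc n-1) → Fin (suc n-1) → ℕ
  h-part g i = length (filter (λ j → toℕ i ℕ.≤? toℕ j ×-dec HDes? g j) (allFin n-1))

module _ {r : ℕ} (s : ℕ) .{{_ : NonZero r}} .{{_ : NonZero s}} (s∣r : s ∣ r) where

  k-part : ∀ {n-1} → (Fin (suc n-1) → Fin r) → Fin (suc n-1) → ℕ
  k-part {zero}  col zero    = R (r / s) {{/-nonZero s∣r}} (+ toℕ (col zero))
  k-part {suc _} col zero    = k-part (col ∘ suc) zero + R r (+ toℕ (col zero) ℤ.- + toℕ (col (suc zero)))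
  k-part {suc _} col (suc i) = k-part (col ∘ suc) i

  λ-part : ∀ {n-1} → ColouredPerm r (suc n-1) → Fin (suc n-1) → ℕ
  λ-part g i = r * h-part g i + k-part (colour g) i

  fmaj : ∀ {p n-1} → G r p (suc n-1) → ℕ
  fmaj g = ℕΣ.sum (λ-part (element g))

module OverRing {a ℓ} (K : CommutativeRing a ℓ) where

  open CommutativeRing K public
    using (Carrier; _≈_; 0#; 1#; -_)
    renaming (_+_ to _+ᴷ_; _*_ to _*ᴷ_)

  open Exp (CommutativeRing.semiring K) public using ()
    renaming (_^_ to infixr 8 _^ᴷ_)

  -- Plays the role of ζ_r = e^{2πi/r}, with K in place of ℂ.
  PrimitiveRoot : ℕ → Carrier → Set ℓ
  PrimitiveRoot r ζ = ζ ^ᴷ r ≈ 1# × (∀ j → 0 < j → j < r → ¬ ζ ^ᴷ j ≈ 1#)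

  -- Coefficients in order of increasing degree; trailing zeros are allowed.
  Poly : Set a
  Poly = List Carrier

  coeff : Poly → ℕ → Carrier
  coeff []      _       = 0#
  coeff (x ∷ F) zero    = x
  coeff (x ∷ F) (suc d) = coeff F d

  infix  4 _≈ᴾ_
  infixl 6 _+ᴾ_
  infixl 7 _*ᴾ_

  _≈ᴾ_ : Rel Poly ℓ
  F ≈ᴾ H = ∀ d → coeff F d ≈ coeff H d

  _+ᴾ_ : Poly → Poly → Poly
  []      +ᴾ H       = H
  (x ∷ F) +ᴾ []      = x ∷ F
  (x ∷ F) +ᴾ (y ∷ H) = (x +ᴷ y) ∷ (F +ᴾ H)

  _*ᴾ_ : Poly → Poly → Poly
  []      *ᴾ H = []
  (x ∷ F) *ᴾ H = map (x *ᴷ_) H +ᴾ (0# ∷ (F *ᴾ H))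

  polyRawSemiring : RawSemiring a ℓ
  polyRawSemiring = record
    { Carrier = Poly
    ; _≈_ = _≈ᴾ_
    ; _+_ = _+ᴾ_
    ; _*_ = _*ᴾ_
    ; 0#  = []
    ; 1#  = 1# ∷ []
    }

  open RawSemiringDefinitions polyRawSemiring public using ()
    renaming (_^_ to infixr 8 _^ᴾ_; sum to sumᴾ; product to productᴾ)

  -- The monomial x qᵈ.
  infix 9 _q^_
  _q^_ : Carrier → ℕ → Poly
  x q^ d = replicate d 0# ++ (x ∷ [])

  [_]at_ : ℕ → Poly → Poly
  [ m ]at F = sumᴾ {m} (λ i → F ^ᴾ toℕ i)

  keepFrom : ℕ → ℕ → Poly → Poly
  keepFrom p d []      = []
  keepFrom p d (x ∷ F) = (if does (p ∣? d) then x else 0#) ∷ keepFrom p (suc d) F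

  -- {F}_{qᵖ}: the coefficient of qᵈ is kept when p ∣ d and set to 0 otherwise.
  ⟨_⟩q^_ : Poly → ℕ → Poly
  ⟨ F ⟩q^ p = keepFrom p 0 F

  sumOver : ∀ {b} {B : Set b} → List B → (B → Poly) → Poly
  sumOver gs f = foldr _+ᴾ_ [] (map f gs)

  -- For g ∈ G(r,p,s,n), evaluated on a representative.
  χ : Carrier → ℕ → Carrier → ∀ {r p n} → G r p n → Carrier
  χ ε k ζ g = ε ^ᴷ inv (perm (element g)) *ᴷ ζ ^ᴷ (k * c (element g))

{-# OPTIONS --safe #-}
module Submission where

-- A coset has exactly one representative whose last colour is below r/s. For such g,
-- fmaj(g) = Σ_{i<n} i·dᵢ + n·cₙ with dᵢ = λᵢ - λᵢ₊₁, and fmaj(g) ≡ c(g) mod r; hence ζᵏ is absorbed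
-- into q, and p ∣ c(g) is the condition p ∣ fmaj(g) selected by { }_{qᵖ}.
-- Build g by appending letters, and put xₙ = εⁿ⁻¹ζᵏq. Over all g with a given last colour and a last
-- value exceeded by t others, the sum of ε^inv (ζᵏq)^(Σ_{i<n} i·dᵢ) is xₙᵗ·Π_{i<n} [ir]_{xᵢ}: in the
-- induction step the exponents of xₙ form a rotated interval, and xₙⁿ = (ζᵏq)ⁿ because n(n-1) is even.
-- Summing over t and cₙ < r/s gives Π_{i<n} [ir]_{xᵢ}·[nr/s]_{xₙ}. Finally [mp]_x = [p]_x [m]_{xᵖ}; the
-- factors in xᵖ commute with { }_{qᵖ}, and the factors [p]_{xᵢ} alternate between two values.

open import Algebra.Bundles using (CommutativeMonoid; CommutativeRing; CommutativeSemiring; Group)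
import Algebra.Properties.CommutativeMonoid.Sum as MonoidSum
import Algebra.Properties.CommutativeSemigroup as CommutativeSemigroupProperties
import Algebra.Properties.CommutativeSemiring.Exp as Exp
import Algebra.Properties.Ring as RingProperties
import Algebra.Properties.Semiring.Sum as SemiringSum
open import Algebra.Structures.Biased using (isCommutativeSemiringˡ)
open import Data.Bool.Base using (if_then_else_; true; false)
open import Data.Fin.Base as Fin using (Fin; zero; suc; toℕ; fromℕ; fromℕ<; inject₁; inject≤; opposite; punchIn)
open import Data.Fin.Permutation as Perm using (Permutation′; permutation; _⟨$⟩ʳ_)
import Data.Fin.Properties as Fin
open import Data.Fin.Relation.Unary.Top using (view; ‵fromℕ; ‵inject₁)
open import Data.Integer.Base as ℤ using (ℤ)
import Data.Integer.Properties as ℤ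
open import Data.List.Base using (List; []; _∷_; _++_; map; filter; length; foldr; tabulate; allFin; cartesianProduct; cartesianProductWith)
open import Data.List.Membership.Propositional using (_∈_)
open import Data.List.Membership.Propositional.Properties using (∈-allFin; ∈-cartesianProduct⁺; ∈-cartesianProductWith⁺)
import Data.List.Membership.Setoid as Membership
import Data.List.Properties as List
open import Data.List.Relation.Unary.All using (All; []; _∷_)
import Data.List.Relation.Unary.All.Properties as All
open import Data.List.Relation.Unary.AllPairs using (AllPairs; []; _∷_)
open import Data.List.Relation.Unary.Any as Any using (here; there; _─_)
open import Data.List.Relation.Unary.Enumerates.Setoid using (IsEnumeration)
import Data.List.Relation.Unary.Unique.Propositional.Properties as Unique
open import Data.List.Relation.Unary.Unique.Setoid using (Unique)
open import Data.List.Relation.Unary.Unique.Setoid.Properties using (cartesianProductWith⁺)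
open import Data.Nat.Base using (ℕ; zero; suc; _+_; _*_; _∸_; _/_; _%_; _≤_; _<_; z≤n; s≤s; s≤s⁻¹; ⌊_/2⌋; ⌈_/2⌉; NonZero; >-nonZero⁻¹)
open import Data.Nat.DivMod
open import Data.Nat.Divisibility using (_∣_; _∣?_; ∣-refl; ∣-trans; ∣m+n∣m⇒∣n; ∣m∣n⇒∣m+n; ∣m⇒∣m*n; ∣n⇒∣m*n; ∣n∣m%n⇒∣m; %-presˡ-∣; m/n∣m; *-monoˡ-∣; *-cancelʳ-∣)
import Data.Nat.Properties as ℕ
open import Data.Nat.Properties using (m*n≢0)
open import Data.Product.Base using (_×_; _,_; ∃; uncurry)
open import Data.Sum.Base using (_⊎_; inj₁; inj₂)
open import Data.Vec.Functional using (insertAt; removeAt)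
open import Data.Vec.Functional.Properties using (insertAt-lookup; insertAt-punchIn)
open import Function.Base using (_∘_; id)
open import Function.Bundles using (_⇔_; mk⇔; Equivalence)
open import Level using (_⊔_)
open import Relation.Binary.Bundles using (Setoid)
open import Relation.Binary.Core using (Rel)
open import Relation.Binary.PropositionalEquality as ≡ using (_≡_; cong; cong₂; subst; subst₂)
open import Relation.Binary.Structures using (IsEquivalence)
open import Relation.Nullary using (Dec; does; yes; no; ¬_; contradiction)
open import Relation.Nullary.Decidable using (_×-dec_; does-⇔; dec-false)
open import Relation.Unary using (Pred; Decidable)
open import Defs

-- A drop compares two neighbouring letters, whereas an inversion may involve any two. Recording for
-- the last letter its colour x and the number t of larger values before it makes both local:
-- appending a letter multiplies the weight by a factor that depends on the last two letters only.
-- The induction closes because the sum over everything earlier does not depend on x at all, and on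
-- t only through xₙᵗ.
--
-- The rotation arises as follows. While the penultimate colour x′ varies, x′ - x runs through 0,
-- ..., r-1, and the 0 is replaced by r exactly when the last two values descend. The sum over x′ is
-- therefore [r]_u or u·[r]_u with u = (ζᵏq)ⁿ = xₙⁿ. The extra u raises the exponent t′ of xₙ by n
-- precisely for t′ < t, and the sign εᵗ of the new letter turns the resulting xₙᵗ into xₙ₊₁ᵗ.
--
-- The congruence fmaj ≡ c mod r is guaranteed only when the last colour is below r/s. Hence these
-- representatives are listed in G(r,n) without regard to p, and p ∣ c is imposed afterwards as a
-- condition on degrees. The summation itself uses no subtraction of weights, so it is done in any
-- commutative semiring and then specialised to polynomials.

indicator : ∀ {p} {P : Set p} → Dec P → ℕ
indicator P? = if does P? then 1 else 0

-- Geometric sums [m]_x in a commutative semiring.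

module GeometricSum {a ℓ} (A : CommutativeSemiring a ℓ) where

  open CommutativeSemiring A hiding (zero) renaming (_+_ to _⊕_; _*_ to _⊛_)
  open Exp A
  open SemiringSum semiring
  open CommutativeSemigroupProperties *-commutativeSemigroup using (x∙yz≈y∙xz)
  open import Relation.Binary.Reasoning.Setoid setoid

  geometric : Carrier → ℕ → Carrier
  geometric x m = sum {m} (λ i → x ^ toℕ i)

  geometric-cong : ∀ {x y} m → x ≈ y → geometric x m ≈ geometric y m
  geometric-cong m x≈y = sum-cong-≋ {m} (λ i → ^-congˡ (toℕ i) x≈y)

  geometric-suc : ∀ x m → geometric x (suc m) ≈ 1# ⊕ x ⊛ geometric x m
  geometric-suc x m = +-congˡ (sym (*-distribˡ-sum x (λ i → x ^ toℕ {m} i)))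

  geometric-+ : ∀ x m n → geometric x (m + n) ≈ geometric x m ⊕ x ^ m ⊛ geometric x n
  geometric-+ x zero    n = sym (trans (+-identityˡ _) (*-identityˡ _))
  geometric-+ x (suc m) n = begin
    geometric x (suc m + n)                                  ≈⟨ geometric-suc x (m + n) ⟩
    1# ⊕ x ⊛ geometric x (m + n)                             ≈⟨ +-congˡ (*-congˡ (geometric-+ x m n)) ⟩
    1# ⊕ x ⊛ (geometric x m ⊕ x ^ m ⊛ geometric x n)         ≈⟨ +-congˡ (distribˡ x _ _) ⟩
    1# ⊕ (x ⊛ geometric x m ⊕ x ⊛ (x ^ m ⊛ geometric x n))   ≈⟨ +-assoc _ _ _ ⟨
    (1# ⊕ x ⊛ geometric x m) ⊕ x ⊛ (x ^ m ⊛ geometric x n)   ≈⟨ +-cong (geometric-suc x m) (*-assoc _ _ _) ⟨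
    geometric x (suc m) ⊕ x ^ suc m ⊛ geometric x n          ∎

  -- Division with remainder on the exponents, peeled off in blocks of length n. It is used in both
  -- directions: to merge the sums over values and colours into one bracket, and to split [p]_x off
  -- a bracket whose length is a multiple of p.
  geometric-* : ∀ x m n → geometric x (m * n) ≈ geometric x n ⊛ geometric (x ^ n) m
  geometric-* x zero    n = sym (zeroʳ _)
  geometric-* x (suc m) n = begin
    geometric x (n + m * n)                                          ≈⟨ geometric-+ x n (m * n) ⟩
    geometric x n ⊕ x ^ n ⊛ geometric x (m * n)                      ≈⟨ +-congˡ (*-congˡ (geometric-* x m n)) ⟩
    geometric x n ⊕ x ^ n ⊛ (geometric x n ⊛ geometric (x ^ n) m)    ≈⟨ +-cong (*-identityʳ _) (x∙yz≈y∙xz _ _ _) ⟨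
    geometric x n ⊛ 1# ⊕ geometric x n ⊛ (x ^ n ⊛ geometric (x ^ n) m) ≈⟨ distribˡ _ _ _ ⟨
    geometric x n ⊛ (1# ⊕ x ^ n ⊛ geometric (x ^ n) m)               ≈⟨ *-congˡ (geometric-suc (x ^ n) m) ⟨
    geometric x n ⊛ geometric (x ^ n) (suc m)                        ∎

  -- The shift N is kept apart from the number of terms, because the induction on t shortens the sum
  -- while the shift must stay fixed. The case of interest is N = t + u.
  shifted-geometric : ∀ x N {m} t u → m ≡ t + u →
    sum {m} (λ i → x ^ (toℕ i + N * indicator (toℕ i ℕ.<? t)))
      ≈ x ^ N ⊛ geometric x t ⊕ x ^ t ⊛ geometric x u
  shifted-geometric x N zero    u ≡.refl = begin
    sum {u} (λ i → x ^ (toℕ i + N * 0))        ≡⟨ sum-cong-≗ {u} (λ i → ≡.cong (λ d → x ^ (toℕ i + d)) (ℕ.*-zeroʳ N)) ⟩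
    sum {u} (λ i → x ^ (toℕ i + 0))            ≡⟨ sum-cong-≗ {u} (λ i → ≡.cong (x ^_) (ℕ.+-identityʳ (toℕ i))) ⟩
    geometric x u                              ≈⟨ *-identityˡ _ ⟨
    1# ⊛ geometric x u                         ≈⟨ +-identityˡ _ ⟨
    0# ⊕ 1# ⊛ geometric x u                    ≈⟨ +-congʳ (zeroʳ _) ⟨
    x ^ N ⊛ 0# ⊕ 1# ⊛ geometric x u            ∎
  shifted-geometric x N (suc t) u ≡.refl = begin
    x ^ (N * 1) ⊕ sum {t + u} (λ i → x ⊛ x ^ (toℕ i + N * indicator (toℕ i ℕ.<? t)))
      ≈⟨ +-congʳ (^-congʳ x (ℕ.*-identityʳ N)) ⟩
    x ^ N ⊕ sum {t + u} (λ i → x ⊛ x ^ (toℕ i + N * indicator (toℕ i ℕ.<? t)))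
      ≈⟨ +-congˡ (*-distribˡ-sum {t + u} x _) ⟨
    x ^ N ⊕ x ⊛ sum {t + u} (λ i → x ^ (toℕ i + N * indicator (toℕ i ℕ.<? t)))
      ≈⟨ +-congˡ (*-congˡ (shifted-geometric x N t u ≡.refl)) ⟩
    x ^ N ⊕ x ⊛ (x ^ N ⊛ geometric x t ⊕ x ^ t ⊛ geometric x u)
      ≈⟨ +-congˡ (distribˡ x _ _) ⟩
    x ^ N ⊕ (x ⊛ (x ^ N ⊛ geometric x t) ⊕ x ⊛ (x ^ t ⊛ geometric x u))
      ≈⟨ +-assoc _ _ _ ⟨
    (x ^ N ⊕ x ⊛ (x ^ N ⊛ geometric x t)) ⊕ x ⊛ (x ^ t ⊛ geometric x u)
      ≈⟨ +-cong (+-cong (sym (*-identityʳ _)) (x∙yz≈y∙xz _ _ _)) (sym (*-assoc _ _ _)) ⟩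
    (x ^ N ⊛ 1# ⊕ x ^ N ⊛ (x ⊛ geometric x t)) ⊕ x ^ suc t ⊛ geometric x u
      ≈⟨ +-congʳ (distribˡ _ _ _) ⟨
    x ^ N ⊛ (1# ⊕ x ⊛ geometric x t) ⊕ x ^ suc t ⊛ geometric x u
      ≈⟨ +-congʳ (*-congˡ (geometric-suc x t)) ⟨
    x ^ N ⊛ geometric x (suc t) ⊕ x ^ suc t ⊛ geometric x u ∎

  -- The exponents i + n·[i < t] are t, …, t + n - 1 in another order.
  rotated-geometric : ∀ x n {t} → t ≤ n →
    sum {n} (λ i → x ^ (toℕ i + n * indicator (toℕ i ℕ.<? t))) ≈ x ^ t ⊛ geometric x n
  rotated-geometric x n {t} t≤n = begin
    sum {n} (λ i → x ^ (toℕ i + n * indicator (toℕ i ℕ.<? t))) ≈⟨ shifted-geometric x n t u n≡t+u ⟩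
    x ^ n ⊛ geometric x t ⊕ x ^ t ⊛ geometric x u
      ≡⟨ ≡.cong (λ d → x ^ d ⊛ geometric x t ⊕ x ^ t ⊛ geometric x u) n≡t+u ⟩
    x ^ (t + u) ⊛ geometric x t ⊕ x ^ t ⊛ geometric x u
      ≈⟨ +-congʳ (trans (*-congʳ (^-homo-* x t u)) (*-assoc _ _ _)) ⟩
    x ^ t ⊛ (x ^ u ⊛ geometric x t) ⊕ x ^ t ⊛ geometric x u   ≈⟨ distribˡ _ _ _ ⟨
    x ^ t ⊛ (x ^ u ⊛ geometric x t ⊕ geometric x u)           ≈⟨ *-congˡ (+-comm _ _) ⟩
    x ^ t ⊛ (geometric x u ⊕ x ^ u ⊛ geometric x t)           ≈⟨ *-congˡ (geometric-+ x u t) ⟨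
    x ^ t ⊛ geometric x (u + t)                               ≡⟨ ≡.cong (λ d → x ^ t ⊛ geometric x d) (ℕ.m∸n+n≡m t≤n) ⟩
    x ^ t ⊛ geometric x n                                     ∎
    where
    u = n ∸ t
    n≡t+u : n ≡ t + u
    n≡t+u = ≡.sym (ℕ.m+[n∸m]≡n t≤n)

-- Powers of an element whose r-th power is 1.

module RootOfUnity {a ℓ} (A : CommutativeSemiring a ℓ) where

  open CommutativeSemiring A hiding (zero) renaming (_+_ to _⊕_; _*_ to _⊛_)
  open Exp A
  open import Relation.Binary.Reasoning.Setoid setoid

  1^ : ∀ m → 1# ^ m ≈ 1#
  1^ zero    = refl
  1^ (suc m) = trans (*-identityˡ _) (1^ m)

  module _ {r} .{{_ : NonZero r}} {ζ} (ζ^r≈1 : ζ ^ r ≈ 1#) where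

    ^-% : ∀ m → ζ ^ m ≈ ζ ^ (m % r)
    ^-% m = begin
      ζ ^ m                                ≡⟨ ≡.cong (ζ ^_) (≡.trans (m≡m%n+[m/n]*n m r) (≡.cong (m % r +_) (ℕ.*-comm (m / r) r))) ⟩
      ζ ^ (m % r + r * (m / r))            ≈⟨ ^-homo-* ζ (m % r) (r * (m / r)) ⟩
      ζ ^ (m % r) ⊛ ζ ^ (r * (m / r))      ≈⟨ *-congˡ (^-assocʳ ζ r (m / r)) ⟨
      ζ ^ (m % r) ⊛ (ζ ^ r) ^ (m / r)      ≈⟨ *-congˡ (trans (^-congˡ (m / r) ζ^r≈1) (1^ (m / r))) ⟩
      ζ ^ (m % r) ⊛ 1#                     ≈⟨ *-identityʳ _ ⟩
      ζ ^ (m % r)                          ∎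

    ^-cong-% : ∀ {l m} → l % r ≡ m % r → ζ ^ l ≈ ζ ^ m
    ^-cong-% {l} {m} l≡m = trans (^-% l) (trans (reflexive (≡.cong (ζ ^_) l≡m)) (sym (^-% m)))

-- Inversions and descents as sums of indicators.

module Statistics where

  open ≡
  open CommutativeSemigroupProperties ℕ.*-commutativeSemigroup using (x∙yz≈y∙xz)
  open SemiringSum ℕ.+-*-semiring using (*-distribˡ-sum; *-distribʳ-sum)

  sum-const : ∀ n x → ℕΣ.sum {n} (λ _ → x) ≡ n * x
  sum-const zero    x = refl
  sum-const (suc n) x = cong (x +_) (sum-const n x)

  indicator-⇔ : ∀ {p q} {P : Set p} {Q : Set q} → P ⇔ Q → (P? : Dec P) (Q? : Dec Q) →
                indicator P? ≡ indicator Q?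
  indicator-⇔ P⇔Q P? Q? = cong (if_then 1 else 0) (does-⇔ P⇔Q P? Q?)

  indicator-no : ∀ {p} {P : Set p} → ¬ P → (P? : Dec P) → indicator P? ≡ 0
  indicator-no ¬P P? = cong (if_then 1 else 0) (dec-false P? ¬P)

  indicator-× : ∀ {p q} {P : Set p} {Q : Set q} (P? : Dec P) (Q? : Dec Q) →
                indicator (P? ×-dec Q?) ≡ indicator P? * indicator Q?
  indicator-× P? Q? with does P? | does Q?
  ... | true  | true  = refl
  ... | true  | false = refl
  ... | false | _     = refl

  count-≥ : ∀ n a → ℕΣ.sum {n} (λ i → indicator (a ℕ.≤? toℕ i)) ≡ n ∸ a
  count-≥ zero    a       = sym (ℕ.0∸n≡0 a)
  count-≥ (suc n) zero    = cong suc (count-≥ n 0)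
  count-≥ (suc n) (suc a) = trans (ℕΣ.sum-cong-≗ {n} λ i → indicator-⇔ (mk⇔ s≤s⁻¹ s≤s) (suc a ℕ.≤? suc (toℕ i)) (a ℕ.≤? toℕ i)) (count-≥ n a)

  count-≤ : ∀ {n} (j : Fin n) → ℕΣ.sum {suc n} (λ i → indicator (toℕ i ℕ.≤? toℕ j)) ≡ suc (toℕ j)
  count-≤ {suc n} zero    = cong suc (ℕΣ.sum-replicate-zero (suc n))
  count-≤ {suc n} (suc j) = cong suc (trans
    (ℕΣ.sum-cong-≗ {suc n} λ i → indicator-⇔ (mk⇔ s≤s⁻¹ s≤s) (suc (toℕ i) ℕ.≤? suc (toℕ j)) (toℕ i ℕ.≤? toℕ j))
    (count-≤ j))

  length-filter-tabulate : ∀ {a p} {A : Set a} {P : Pred A p} (P? : Decidable P) {n} (f : Fin n → A) →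
    length (filter P? (tabulate f)) ≡ ℕΣ.sum (λ i → indicator (P? (f i)))
  length-filter-tabulate P? {zero}  f = refl
  length-filter-tabulate P? {suc n} f with does (P? (f zero))
  ... | true  = cong suc (length-filter-tabulate P? (f ∘ suc))
  ... | false = length-filter-tabulate P? (f ∘ suc)

  length-filter-cartesianProduct : ∀ {a b p} {A : Set a} {B : Set b} {P : Pred (A × B) p} (P? : Decidable P)
    {m n} (f : Fin m → A) (g : Fin n → B) →
    length (filter P? (cartesianProduct (tabulate f) (tabulate g)))
      ≡ ℕΣ.sum (λ i → ℕΣ.sum (λ j → indicator (P? (f i , g j))))
  length-filter-cartesianProduct P? {zero}  f g = refl
  length-filter-cartesianProduct P? {suc m} f g = begin
    length (filter P? (row ++ rows))                  ≡⟨ cong length (List.filter-++ P? row rows) ⟩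
    length (filter P? row ++ filter P? rows)          ≡⟨ List.length-++ (filter P? row) ⟩
    length (filter P? row) + length (filter P? rows)
      ≡⟨ cong₂ _+_ (trans (cong (length ∘ filter P?) (List.map-tabulate g (f zero ,_)))
                          (length-filter-tabulate P? (λ j → f zero , g j)))
                   (length-filter-cartesianProduct P? (f ∘ suc) g) ⟩
    _ ∎
    where
    open ≡-Reasoning
    row  = map (f zero ,_) (tabulate g)
    rows = cartesianProduct (tabulate (f ∘ suc)) (tabulate g)

  inversion? : ∀ {n} (σ : Permutation′ n) (i j : Fin n) → Dec (i Fin.< j × (σ ⟨$⟩ʳ j) Fin.< (σ ⟨$⟩ʳ i))
  inversion? σ i j = i Fin.<? j ×-dec (σ ⟨$⟩ʳ j) Fin.<? (σ ⟨$⟩ʳ i)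

  inv-sum : ∀ {n} (σ : Permutation′ n) → inv σ ≡ ℕΣ.sum (λ i → ℕΣ.sum (λ j → indicator (inversion? σ i j)))
  inv-sum σ = length-filter-cartesianProduct (λ (i , j) → inversion? σ i j) id id

  inv-cong : ∀ {n} {σ τ : Permutation′ n} → σ Perm.≈ τ → inv σ ≡ inv τ
  inv-cong {σ = σ} {τ} σ≈τ = trans (inv-sum σ) (trans
    (ℕΣ.sum-cong-≗ λ i → ℕΣ.sum-cong-≗ λ j → indicator-⇔
      (mk⇔ (λ (p , q) → p , subst₂ Fin._<_ (σ≈τ j) (σ≈τ i) q) (λ (p , q) → p , subst₂ Fin._<_ (sym (σ≈τ j)) (sym (σ≈τ i)) q))
      (inversion? σ i j) (inversion? τ i j))
    (sym (inv-sum τ)))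

  -- The difference of colours

  module _ {r : ℕ} .{{_ : NonZero r}} where

    %-+-cancelʳ : ∀ {v a b} → v < r → b ≤ r → a ≡ (v + b) % r → v ≡ (a + (r ∸ b)) % r
    %-+-cancelʳ {v} {a} {b} v<r b≤r refl = sym (begin
      ((v + b) % r + (r ∸ b)) % r  ≡⟨ %-absorbˡ (v + b) (r ∸ b) ⟩
      (v + b + (r ∸ b)) % r        ≡⟨ cong (_% r) (ℕ.+-assoc v b (r ∸ b)) ⟩
      (v + (b + (r ∸ b))) % r      ≡⟨ cong (λ w → (v + w) % r) (ℕ.m+[n∸m]≡n b≤r) ⟩
      (v + r) % r                  ≡⟨ [m+n]%n≡m%n v r ⟩
      v % r                        ≡⟨ m<n⇒m%n≡m v<r ⟩
      v                            ∎)
      where open ≡-Reasoning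

    -- The remainder of a negative integer is defined by cases on the remainder of its absolute
    -- value. For 0 < d < r the latter is d, hence nonzero, and the branch subtracting from r
    -- applies.
    negative-%ℕ : ∀ {d} → 0 < d → d < r → (ℤ.- ℤ.+ d) ℤ.%ℕ r ≡ r ∸ d
    negative-%ℕ {suc d} _ d<r with suc d % r | m<n⇒m%n≡m d<r
    ... | _ | refl = refl

    -- Eliminates integers: r ∸ b serves as the additive inverse of b modulo r.
    R-difference : ∀ {a b} → a < r → b < r → R r (ℤ.+ a ℤ.- ℤ.+ b) ≡ (a + (r ∸ b)) % r
    R-difference {a} {b} a<r b<r with ℕ.≤-<-connex b a
    ... | inj₁ b≤a = begin
      R r (ℤ.+ a ℤ.- ℤ.+ b)  ≡⟨ cong (R r) (trans (ℤ.[+m]-[+n]≡m⊖n a b) (ℤ.⊖-≥ b≤a)) ⟩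
      (a ∸ b) % r            ≡⟨ [m+n]%n≡m%n (a ∸ b) r ⟨
      (a ∸ b + r) % r        ≡⟨ cong (λ w → (a ∸ b + w) % r) (ℕ.m+[n∸m]≡n (ℕ.<⇒≤ b<r)) ⟨
      (a ∸ b + (b + (r ∸ b))) % r ≡⟨ cong (_% r) (ℕ.+-assoc (a ∸ b) b (r ∸ b)) ⟨
      (a ∸ b + b + (r ∸ b)) % r ≡⟨ cong (λ w → (w + (r ∸ b)) % r) (ℕ.m∸n+n≡m b≤a) ⟩
      (a + (r ∸ b)) % r      ∎
      where open ≡-Reasoning
    ... | inj₂ a<b = begin
      R r (ℤ.+ a ℤ.- ℤ.+ b)  ≡⟨ cong (R r) (trans (ℤ.[+m]-[+n]≡m⊖n a b) (ℤ.⊖-< a<b)) ⟩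
      R r (ℤ.- ℤ.+ (b ∸ a))  ≡⟨ negative-%ℕ (ℕ.m<n⇒0<n∸m a<b) b∸a<r ⟩
      r ∸ (b ∸ a)            ≡⟨ cong (_∸ (b ∸ a)) r≡ ⟩
      b ∸ a + (a + (r ∸ b)) ∸ (b ∸ a) ≡⟨ ℕ.m+n∸m≡n (b ∸ a) _ ⟩
      a + (r ∸ b)            ≡⟨ m<n⇒m%n≡m a+r∸b<r ⟨
      (a + (r ∸ b)) % r      ∎
      where
      open ≡-Reasoning
      b∸a<r : b ∸ a < r
      b∸a<r = ℕ.≤-<-trans (ℕ.m∸n≤m b a) b<r
      r≡ : r ≡ b ∸ a + (a + (r ∸ b))
      r≡ = sym (trans (sym (ℕ.+-assoc (b ∸ a) a (r ∸ b)))
        (trans (cong (_+ (r ∸ b)) (ℕ.m∸n+n≡m (ℕ.<⇒≤ a<b))) (ℕ.m+[n∸m]≡n (ℕ.<⇒≤ b<r))))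
      a+r∸b<r : a + (r ∸ b) < r
      a+r∸b<r = subst (a + (r ∸ b) <_) (ℕ.m+[n∸m]≡n (ℕ.<⇒≤ b<r)) (ℕ.+-monoˡ-< (r ∸ b) a<b)

    difference : Fin r → Fin r → ℕ
    difference x y = R r (ℤ.+ toℕ x ℤ.- ℤ.+ toℕ y)

    -- The working characterisation of `difference`: a residue that leads from y to x must be the
    -- difference. Values of `difference` are found by exhibiting such a residue.
    difference-unique : ∀ {x y v} → v < r → toℕ x ≡ (v + toℕ y) % r → difference x y ≡ v
    difference-unique {x} {y} v<r eq = trans (R-difference (Fin.toℕ<n x) (Fin.toℕ<n y))
      (sym (%-+-cancelʳ v<r (ℕ.<⇒≤ (Fin.toℕ<n y)) eq))

    difference<r : ∀ x y → difference x y < r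
    difference<r x y = subst (_< r) (sym (R-difference (Fin.toℕ<n x) (Fin.toℕ<n y))) (m%n<n _ r)

    difference-+ : ∀ x y → (difference x y + toℕ y) % r ≡ toℕ x
    difference-+ x y = begin
      (difference x y + toℕ y) % r                 ≡⟨ cong (λ d → (d + toℕ y) % r) (R-difference (Fin.toℕ<n x) (Fin.toℕ<n y)) ⟩
      ((toℕ x + (r ∸ toℕ y)) % r + toℕ y) % r      ≡⟨ %-absorbˡ (toℕ x + (r ∸ toℕ y)) (toℕ y) ⟩
      (toℕ x + (r ∸ toℕ y) + toℕ y) % r            ≡⟨ cong (_% r) (ℕ.+-assoc (toℕ x) _ _) ⟩
      (toℕ x + (r ∸ toℕ y + toℕ y)) % r            ≡⟨ cong (λ w → (toℕ x + w) % r) (ℕ.m∸n+n≡m (ℕ.<⇒≤ (Fin.toℕ<n y))) ⟩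
      (toℕ x + r) % r                              ≡⟨ [m+n]%n≡m%n (toℕ x) r ⟩
      toℕ x % r                                    ≡⟨ m<n⇒m%n≡m (Fin.toℕ<n x) ⟩
      toℕ x                                        ∎
      where open ≡-Reasoning

    mod-difference : ∀ v y → difference ((toℕ v + toℕ y) mod r) y ≡ toℕ {r} v
    mod-difference v y = difference-unique {_} {y} (Fin.toℕ<n v) (toℕ-mod _)

    -- The change of variable x′ = v + y. It lets a sum over the penultimate colour be taken over
    -- its difference v from the last colour.
    translate : Fin r → Permutation′ r
    translate y = permutation (λ v → (toℕ v + toℕ y) mod r) (λ x → difference x y mod r)
      (λ x → Fin.toℕ-injective (begin
        toℕ ((toℕ (difference x y mod r) + toℕ y) mod r)  ≡⟨ toℕ-mod _ ⟩
        (toℕ (difference x y mod r) + toℕ y) % r          ≡⟨ cong (λ d → (d + toℕ y) % r) (trans (toℕ-mod _) (m<n⇒m%n≡m (difference<r x y))) ⟩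
        (difference x y + toℕ y) % r                      ≡⟨ difference-+ x y ⟩
        toℕ x                                             ∎))
      (λ v → trans (cong (_mod r) (mod-difference v y)) (mod-toℕ v))
      where open ≡-Reasoning

    translate≡⇔ : ∀ v y → (translate y ⟨$⟩ʳ v ≡ y) ⇔ (toℕ v ≡ 0)
    translate≡⇔ v y = mk⇔
      (λ eq → trans (sym (mod-difference v y)) (trans (cong (λ x → difference x y) eq)
        (difference-unique {y} {y} {0} (ℕ.≤-<-trans z≤n (Fin.toℕ<n y)) (sym (m<n⇒m%n≡m (Fin.toℕ<n y))))))
      (λ eq → trans (cong (λ d → (d + toℕ y) mod r) eq) (mod-toℕ y))

  -- Appending a letter

  punchIn-fromℕ : ∀ {n} (i : Fin n) → punchIn (fromℕ n) i ≡ inject₁ i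
  punchIn-fromℕ zero    = refl
  punchIn-fromℕ (suc i) = cong suc (punchIn-fromℕ i)

  insert-at : ∀ {n} i j (π : Permutation′ n) → Perm.insert i j π ⟨$⟩ʳ i ≡ j
  insert-at i j π with i Fin.≟ i
  ... | yes _   = refl
  ... | no  i≢i = contradiction refl i≢i

  punchIn-<-pivot : ∀ {n} (j : Fin (suc n)) (i : Fin n) → (j Fin.< punchIn j i) ⇔ (toℕ j ≤ toℕ i)
  punchIn-<-pivot zero    i       = mk⇔ (λ _ → z≤n) (λ _ → s≤s z≤n)
  punchIn-<-pivot (suc j) zero    = mk⇔ (λ ()) (λ ())
  punchIn-<-pivot (suc j) (suc i) = mk⇔ (s≤s ∘ to ∘ s≤s⁻¹) (s≤s ∘ from ∘ s≤s⁻¹)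
    where open Equivalence (punchIn-<-pivot j i)

  punchIn-<-⇔ : ∀ {n} k (i j : Fin n) → (punchIn k i Fin.< punchIn k j) ⇔ (i Fin.< j)
  punchIn-<-⇔ k i j = mk⇔
    (λ p → ℕ.≰⇒> (λ j≤i → ℕ.<⇒≱ p (Fin.punchIn-mono-≤ k j i j≤i)))
    (λ p → ℕ.≰⇒> (λ j≤i → ℕ.<⇒≱ p (Fin.punchIn-cancel-≤ k j i j≤i)))

  opposite-injective : ∀ {n} {i j : Fin n} → opposite i ≡ opposite j → i ≡ j
  opposite-injective {i = i} {j} eq =
    trans (sym (Fin.opposite-involutive i)) (trans (cong opposite eq) (Fin.opposite-involutive j))

  -- The two opposites are taken in ranges of different size, n - t against n - 1 - t′, which turns
  -- the weak inequality into a strict one. With `punchIn-<-pivot` it says that the last two values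
  -- descend exactly when t′ < t.
  opposite-≤-⇔ : ∀ {n} (t : Fin (suc n)) (t′ : Fin n) →
                 (toℕ (opposite t) ≤ toℕ (opposite t′)) ⇔ (toℕ t′ < toℕ t)
  opposite-≤-⇔ {n} t t′ = mk⇔
    (λ p → ℕ.≮⇒≥ (λ q → ℕ.<⇒≱ (ℕ.∸-monoʳ-< q (Fin.toℕ<n t′)) (subst₂ _≤_ (Fin.opposite-prop t) (Fin.opposite-prop t′) p)))
    (λ q → subst₂ _≤_ (sym (Fin.opposite-prop t)) (sym (Fin.opposite-prop t′)) (ℕ.∸-monoʳ-≤ n q))

  module _ {r n : ℕ} where

    -- The last value is opposite t = n - t, so that t is the number of inversions it creates.
    extend : Fin r → Fin (suc n) → ColouredPerm r n → ColouredPerm r (suc n)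
    extend x t g = insertAt (colour g) (fromℕ n) x ⨾ Perm.insert (fromℕ n) (opposite t) (perm g)

    colour-extend-last : ∀ x t g → colour (extend x t g) (fromℕ n) ≡ x
    colour-extend-last x t g = insertAt-lookup (colour g) (fromℕ n) x

    colour-extend-inject₁ : ∀ x t g i → colour (extend x t g) (inject₁ i) ≡ colour g i
    colour-extend-inject₁ x t g i = trans (cong (colour (extend x t g)) (sym (punchIn-fromℕ i)))
      (insertAt-punchIn (colour g) (fromℕ n) x i)

    perm-extend-last : ∀ x t g → perm (extend x t g) ⟨$⟩ʳ fromℕ n ≡ opposite t
    perm-extend-last x t g = insert-at (fromℕ n) (opposite t) (perm g)

    perm-extend-inject₁ : ∀ x t g i →
      perm (extend x t g) ⟨$⟩ʳ inject₁ i ≡ punchIn (opposite t) (perm g ⟨$⟩ʳ i)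
    perm-extend-inject₁ x t g i = trans (cong (perm (extend x t g) ⟨$⟩ʳ_) (sym (punchIn-fromℕ i)))
      (Perm.insert-punchIn (fromℕ n) (opposite t) (perm g) i)

    -- Pairs of old positions keep their order because `punchIn` is strictly monotone, and no pair
    -- starts at the last position. The pairs ending there count the old values that are at least n
    -- - t, since these are pushed above the new value.
    inv-extend : ∀ x t g → inv (perm (extend x t g)) ≡ inv (perm g) + toℕ t
    inv-extend x t g = begin
      inv σ
        ≡⟨ inv-sum σ ⟩
      ℕΣ.sum (λ i → ℕΣ.sum (I i))
        ≡⟨ ℕΣ.sum-init-last (λ i → ℕΣ.sum (I i)) ⟩
      ℕΣ.sum (λ i → ℕΣ.sum (I (inject₁ i))) + ℕΣ.sum (I (fromℕ n))
        ≡⟨ cong₂ _+_ (ℕΣ.sum-cong-≗ λ i → ℕΣ.sum-init-last (I (inject₁ i)))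
                     (trans (ℕΣ.sum-cong-≗ none-after-last) (ℕΣ.sum-replicate-zero (suc n))) ⟩
      ℕΣ.sum (λ i → ℕΣ.sum (λ j → I (inject₁ i) (inject₁ j)) + I (inject₁ i) (fromℕ n)) + 0
        ≡⟨ ℕ.+-identityʳ _ ⟩
      ℕΣ.sum (λ i → ℕΣ.sum (λ j → I (inject₁ i) (inject₁ j)) + I (inject₁ i) (fromℕ n))
        ≡⟨ ℕΣ.∑-distrib-+ (λ i → ℕΣ.sum (λ j → I (inject₁ i) (inject₁ j))) (λ i → I (inject₁ i) (fromℕ n)) ⟩
      ℕΣ.sum (λ i → ℕΣ.sum (λ j → I (inject₁ i) (inject₁ j))) + ℕΣ.sum (λ i → I (inject₁ i) (fromℕ n))
        ≡⟨ cong₂ _+_ (trans (ℕΣ.sum-cong-≗ λ i → ℕΣ.sum-cong-≗ (inner i)) (sym (inv-sum π))) last-inversions ⟩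
      inv π + toℕ t ∎
      where
      open ≡-Reasoning
      π = perm g
      σ = perm (extend x t g)
      I : Fin (suc n) → Fin (suc n) → ℕ
      I i j = indicator (inversion? σ i j)

      none-after-last : ∀ j → I (fromℕ n) j ≡ 0
      none-after-last j = indicator-no
        (λ (n<j , _) → ℕ.<⇒≱ (subst (_< toℕ j) (Fin.toℕ-fromℕ n) n<j) (s≤s⁻¹ (Fin.toℕ<n j)))
        (inversion? σ (fromℕ n) j)

      inner : ∀ i j → I (inject₁ i) (inject₁ j) ≡ indicator (inversion? π i j)
      inner i j = indicator-⇔
        (mk⇔ (λ (p , q) → subst₂ _<_ (Fin.toℕ-inject₁ i) (Fin.toℕ-inject₁ j) p
                        , to (subst₂ Fin._<_ (perm-extend-inject₁ x t g j) (perm-extend-inject₁ x t g i) q))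
             (λ (p , q) → subst₂ _<_ (sym (Fin.toℕ-inject₁ i)) (sym (Fin.toℕ-inject₁ j)) p
                        , subst₂ Fin._<_ (sym (perm-extend-inject₁ x t g j)) (sym (perm-extend-inject₁ x t g i)) (from q)))
        (inversion? σ (inject₁ i) (inject₁ j)) (inversion? π i j)
        where open Equivalence (punchIn-<-⇔ (opposite t) (π ⟨$⟩ʳ j) (π ⟨$⟩ʳ i))

      before-last : ∀ i → I (inject₁ i) (fromℕ n) ≡ indicator (toℕ (opposite t) ℕ.≤? toℕ (π ⟨$⟩ʳ i))
      before-last i = indicator-⇔
        (mk⇔ (λ (_ , q) → to (subst₂ Fin._<_ (perm-extend-last x t g) (perm-extend-inject₁ x t g i) q))
             (λ q → subst₂ _<_ (sym (Fin.toℕ-inject₁ i)) (sym (Fin.toℕ-fromℕ n)) (Fin.toℕ<n i)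
                  , subst₂ Fin._<_ (sym (perm-extend-last x t g)) (sym (perm-extend-inject₁ x t g i)) (from q)))
        (inversion? σ (inject₁ i) (fromℕ n)) (toℕ (opposite t) ℕ.≤? toℕ (π ⟨$⟩ʳ i))
        where open Equivalence (punchIn-<-pivot (opposite t) (π ⟨$⟩ʳ i))

      last-inversions : ℕΣ.sum (λ i → I (inject₁ i) (fromℕ n)) ≡ toℕ t
      last-inversions = begin
        ℕΣ.sum (λ i → I (inject₁ i) (fromℕ n))                            ≡⟨ ℕΣ.sum-cong-≗ before-last ⟩
        ℕΣ.sum (λ i → indicator (toℕ (opposite t) ℕ.≤? toℕ (π ⟨$⟩ʳ i)))
          -- The old values run through all of `Fin n`, so the count does not depend on g.
          ≡⟨ ℕΣ.sum-permute (λ (i : Fin n) → indicator (toℕ (opposite t) ℕ.≤? toℕ i)) π ⟨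
        ℕΣ.sum {n} (λ i → indicator (toℕ (opposite t) ℕ.≤? toℕ i))            ≡⟨ count-≥ n (toℕ (opposite t)) ⟩
        n ∸ toℕ (opposite t)                                              ≡⟨ cong (n ∸_) (Fin.opposite-prop t) ⟩
        n ∸ (n ∸ toℕ t)                                                   ≡⟨ ℕ.m∸[m∸n]≡n (s≤s⁻¹ (Fin.toℕ<n t)) ⟩
        toℕ t                                                             ∎

  -- The flag major index

  module _ {r : ℕ} .{{_ : NonZero r}} where

    -- λᵢ - λᵢ₊₁
    drop : ∀ {n} → ColouredPerm r (suc n) → Fin n → ℕ
    drop g i = r * indicator (HDes? g i) + difference (colour g (inject₁ i)) (colour g (suc i))

    -- The part of fmaj that does not involve s. Leaving out the residue of the last colour makes it
    -- grow by a single term when a letter is appended.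
    weight : ∀ {n} → ColouredPerm r (suc n) → ℕ
    weight g = ℕΣ.sum (λ i → suc (toℕ i) * drop g i)

    -- Earlier drops see only colours and relative order, both untouched by the new letter. The one
    -- new drop sits at the penultimate position, which is why the last two letters have to be
    -- exposed.
    weight-extend : ∀ {n} x t x′ t′ (g : ColouredPerm r n) →
      weight (extend x t (extend x′ t′ g)) ≡
      weight (extend x′ t′ g) + suc n * (r * indicator (x′ Fin.≟ x ×-dec toℕ t′ ℕ.<? toℕ t) + difference x′ x)
    weight-extend {n} x t x′ t′ g = begin
      weight h
        ≡⟨ ℕΣ.sum-init-last (λ i → suc (toℕ i) * drop h i) ⟩
      ℕΣ.sum (λ i → suc (toℕ (inject₁ i)) * drop h (inject₁ i)) + suc (toℕ (fromℕ n)) * drop h (fromℕ n)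
        ≡⟨ cong₂ _+_ (ℕΣ.sum-cong-≗ λ i → cong₂ (λ a b → suc a * b) (Fin.toℕ-inject₁ i) (drop-init i))
                     (cong₂ (λ a b → suc a * b) (Fin.toℕ-fromℕ n) drop-last) ⟩
      _ ∎
      where
      open ≡-Reasoning
      g′ = extend x′ t′ g
      h  = extend x t g′

      colour-init : ∀ i → colour h (inject₁ i) ≡ colour g′ i
      colour-init = colour-extend-inject₁ x t g′

      perm-init : ∀ i → perm h ⟨$⟩ʳ inject₁ i ≡ punchIn (opposite t) (perm g′ ⟨$⟩ʳ i)
      perm-init = perm-extend-inject₁ x t g′

      drop-init : ∀ i → drop h (inject₁ i) ≡ drop g′ i
      drop-init i = cong₂ (λ a b → r * a + b)
        (indicator-⇔
          (mk⇔ (λ (p , q) → trans (sym (colour-init (inject₁ i))) (trans p (colour-init (suc i)))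
                          , to (subst₂ Fin._<_ (perm-init (suc i)) (perm-init (inject₁ i)) q))
               (λ (p , q) → trans (colour-init (inject₁ i)) (trans p (sym (colour-init (suc i))))
                          , subst₂ Fin._<_ (sym (perm-init (suc i))) (sym (perm-init (inject₁ i))) (from q)))
          (HDes? h (inject₁ i)) (HDes? g′ i))
        (cong₂ difference (colour-init (inject₁ i)) (colour-init (suc i)))
        where open Equivalence (punchIn-<-⇔ (opposite t) (perm g′ ⟨$⟩ʳ suc i) (perm g′ ⟨$⟩ʳ inject₁ i))

      colour-penultimate : colour h (inject₁ (fromℕ n)) ≡ x′
      colour-penultimate = trans (colour-init (fromℕ n)) (colour-extend-last x′ t′ g)

      colour-last : colour h (suc (fromℕ n)) ≡ x
      colour-last = colour-extend-last x t g′

      perm-penultimate : perm h ⟨$⟩ʳ inject₁ (fromℕ n) ≡ punchIn (opposite t) (opposite t′)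
      perm-penultimate = trans (perm-init (fromℕ n)) (cong (punchIn (opposite t)) (perm-extend-last x′ t′ g))

      perm-last : perm h ⟨$⟩ʳ suc (fromℕ n) ≡ opposite t
      perm-last = perm-extend-last x t g′

      drop-last : drop h (fromℕ n) ≡ r * indicator (x′ Fin.≟ x ×-dec toℕ t′ ℕ.<? toℕ t) + difference x′ x
      drop-last = cong₂ (λ a b → r * a + b)
        (indicator-⇔
          (mk⇔ (λ (p , q) → trans (sym colour-penultimate) (trans p colour-last)
                          , O.to (P.to (subst₂ Fin._<_ perm-last perm-penultimate q)))
               (λ (p , q) → trans colour-penultimate (trans p (sym colour-last))
                          , subst₂ Fin._<_ (sym perm-last) (sym perm-penultimate) (P.from (O.from q))))
          (HDes? h (fromℕ n)) (x′ Fin.≟ x ×-dec toℕ t′ ℕ.<? toℕ t))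
        (cong₂ difference colour-penultimate colour-last)
        where
        module P = Equivalence (punchIn-<-pivot (opposite t) (opposite t′))
        module O = Equivalence (opposite-≤-⇔ t t′)

    h-part-sum : ∀ {n} (g : ColouredPerm r (suc n)) i →
      h-part g i ≡ ℕΣ.sum (λ j → indicator (toℕ i ℕ.≤? toℕ j) * indicator (HDes? g j))
    h-part-sum g i = trans (length-filter-tabulate (λ j → toℕ i ℕ.≤? toℕ j ×-dec HDes? g j) id)
      (ℕΣ.sum-cong-≗ λ j → indicator-× (toℕ i ℕ.≤? toℕ j) (HDes? g j))

    module _ (s : ℕ) .{{_ : NonZero s}} (s∣r : s ∣ r) where

      private instance
        r/s≢0 : NonZero (r / s)
        r/s≢0 = /-nonZero s∣r

      k-part-sum : ∀ {n} (col : Fin (suc n) → Fin r) i →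
        k-part s s∣r col i ≡
        ℕΣ.sum (λ j → indicator (toℕ i ℕ.≤? toℕ j) * difference (col (inject₁ j)) (col (suc j))) + toℕ (col (fromℕ n)) % (r / s)
      k-part-sum {zero}  col zero = refl
      k-part-sum {suc n} col zero = begin
        k-part s s∣r (col ∘ suc) zero + δ zero
          ≡⟨ cong (_+ δ zero) (k-part-sum (col ∘ suc) zero) ⟩
        Δ + last-residue + δ zero
          ≡⟨ ℕ.+-comm _ (δ zero) ⟩
        δ zero + (Δ + last-residue)
          ≡⟨ ℕ.+-assoc (δ zero) Δ last-residue ⟨
        δ zero + Δ + last-residue
          ≡⟨ cong (λ d → d + Δ + last-residue) (ℕ.*-identityˡ (δ zero)) ⟨
        1 * δ zero + Δ + last-residue ∎
        where
        open ≡-Reasoning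
        δ : Fin (suc n) → ℕ
        δ j = difference (col (inject₁ j)) (col (suc j))
        Δ = ℕΣ.sum (λ j → 1 * δ (suc j))
        last-residue = toℕ (col (fromℕ (suc n))) % (r / s)
      k-part-sum {suc n} col (suc i) = trans (k-part-sum (col ∘ suc) i)
        (cong (_+ toℕ (col (fromℕ (suc n))) % (r / s)) (ℕΣ.sum-cong-≗ λ j →
          cong (_* difference (col (suc (inject₁ j))) (col (suc (suc j))))
            (indicator-⇔ (mk⇔ s≤s s≤s⁻¹) (toℕ i ℕ.≤? toℕ j) (suc (toℕ i) ℕ.≤? suc (toℕ j)))))

      λ-part-sum : ∀ {n} (g : ColouredPerm r (suc n)) i →
        λ-part s s∣r g i ≡
        ℕΣ.sum (λ j → indicator (toℕ i ℕ.≤? toℕ j) * drop g j) + toℕ (colour g (fromℕ n)) % (r / s)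
      λ-part-sum {n} g i = begin
        r * h-part g i + k-part s s∣r (colour g) i
          ≡⟨ cong₂ _+_ (cong (r *_) (h-part-sum g i)) (k-part-sum (colour g) i) ⟩
        r * ℕΣ.sum (λ j → a j * h j) + (ℕΣ.sum (λ j → a j * d j) + last-residue)
          ≡⟨ ℕ.+-assoc (r * ℕΣ.sum (λ j → a j * h j)) _ last-residue ⟨
        r * ℕΣ.sum (λ j → a j * h j) + ℕΣ.sum (λ j → a j * d j) + last-residue
          ≡⟨ cong (λ S → S + ℕΣ.sum (λ j → a j * d j) + last-residue) (*-distribˡ-sum r (λ j → a j * h j)) ⟩
        ℕΣ.sum (λ j → r * (a j * h j)) + ℕΣ.sum (λ j → a j * d j) + last-residue
          ≡⟨ cong (_+ last-residue) (ℕΣ.∑-distrib-+ (λ j → r * (a j * h j)) (λ j → a j * d j)) ⟨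
        ℕΣ.sum (λ j → r * (a j * h j) + a j * d j) + last-residue
          ≡⟨ cong (_+ last-residue) (ℕΣ.sum-cong-≗ λ j → trans (cong (_+ a j * d j) (x∙yz≈y∙xz r (a j) (h j)))
                                                              (sym (ℕ.*-distribˡ-+ (a j) (r * h j) (d j)))) ⟩
        ℕΣ.sum (λ j → a j * drop g j) + last-residue ∎
        where
        open ≡-Reasoning
        a h d : Fin n → ℕ
        a j = indicator (toℕ i ℕ.≤? toℕ j)
        h j = indicator (HDes? g j)
        d j = difference (colour g (inject₁ j)) (colour g (suc j))
        last-residue = toℕ (colour g (fromℕ n)) % (r / s)

      -- Summation by parts: the drop at the 0-based position j occurs in λᵢ for each of the j + 1
      -- positions i ≤ j, while the residue of the last colour occurs in all n + 1 of them.
      fmaj-weight : ∀ {n} (g : ColouredPerm r (suc n)) →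
        ℕΣ.sum (λ-part s s∣r g) ≡ weight g + suc n * (toℕ (colour g (fromℕ n)) % (r / s))
      fmaj-weight {n} g = begin
        ℕΣ.sum (λ-part s s∣r g)
          ≡⟨ ℕΣ.sum-cong-≗ (λ-part-sum g) ⟩
        ℕΣ.sum (λ i → ℕΣ.sum (a i) + last-residue)
          ≡⟨ ℕΣ.∑-distrib-+ (λ i → ℕΣ.sum (a i)) (λ _ → last-residue) ⟩
        ℕΣ.sum (λ i → ℕΣ.sum (a i)) + ℕΣ.sum {suc n} (λ _ → last-residue)
          ≡⟨ cong₂ _+_ (ℕΣ.∑-comm a) (sum-const (suc n) last-residue) ⟩
        ℕΣ.sum (λ j → ℕΣ.sum (λ i → a i j)) + suc n * last-residue
          ≡⟨ cong (_+ suc n * last-residue) (ℕΣ.sum-cong-≗ λ j →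
               trans (sym (*-distribʳ-sum (drop g j) (λ (i : Fin (suc n)) → indicator (toℕ i ℕ.≤? toℕ j))))
                     (cong (_* drop g j) (count-≤ j))) ⟩
        weight g + suc n * last-residue ∎
        where
        open ≡-Reasoning
        a : Fin (suc n) → Fin n → ℕ
        a i j = indicator (toℕ i ℕ.≤? toℕ j) * drop g j
        last-residue = toℕ (colour g (fromℕ n)) % (r / s)

open Statistics

-- The generating function

module _ {r : ℕ} where
  mutual
    all : ∀ n → List (ColouredPerm r n)
    all zero    = ((λ ()) ⨾ Perm.id) ∷ []
    all (suc n) = allEndingIn id n

    -- The map f selects the admissible last colours. With `id` it gives the whole group, and with
    -- the inclusion of the colours below r/s it gives the coset representatives; earlier letters
    -- are always unrestricted.
    allEndingIn : ∀ {M} → (Fin M → Fin r) → ∀ n → List (ColouredPerm r (suc n))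
    allEndingIn {M} f n = cartesianProductWith (uncurry (extend ∘ f)) (cartesianProduct (allFin M) (allFin (suc n))) (all n)

module ListSum {a ℓ} (A : CommutativeSemiring a ℓ) where
  open CommutativeSemiring A hiding (zero) renaming (_+_ to _⊕_; _*_ to _⊛_)
  open SemiringSum semiring

  -- Folded in the same way as `sumOver`, so that over polynomials the two coincide by definition.
  ∑ : ∀ {b} {B : Set b} → List B → (B → Carrier) → Carrier
  ∑ xs f = foldr _⊕_ 0# (map f xs)

  ∑-cong : ∀ {b} {B : Set b} (xs : List B) {f g : B → Carrier} → (∀ x → f x ≈ g x) → ∑ xs f ≈ ∑ xs g
  ∑-cong []       f≈g = refl
  ∑-cong (x ∷ xs) f≈g = +-cong (f≈g x) (∑-cong xs f≈g)

  ∑-++ : ∀ {b} {B : Set b} (xs ys : List B) f → ∑ (xs ++ ys) f ≈ ∑ xs f ⊕ ∑ ys f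
  ∑-++ []       ys f = sym (+-identityˡ _)
  ∑-++ (x ∷ xs) ys f = trans (+-congˡ (∑-++ xs ys f)) (sym (+-assoc _ _ _))

  ∑-map : ∀ {b c} {B : Set b} {C : Set c} (h : B → C) xs f → ∑ (map h xs) f ≈ ∑ xs (f ∘ h)
  ∑-map h []       f = refl
  ∑-map h (x ∷ xs) f = +-congˡ (∑-map h xs f)

  ∑-cartesianProductWith : ∀ {b c d} {B : Set b} {C : Set c} {D : Set d} (h : B → C → D) xs ys f →
    ∑ (cartesianProductWith h xs ys) f ≈ ∑ xs (λ x → ∑ ys (λ y → f (h x y)))
  ∑-cartesianProductWith h []       ys f = refl
  ∑-cartesianProductWith h (x ∷ xs) ys f = trans (∑-++ (map (h x) ys) _ f)
    (+-cong (∑-map (h x) ys f) (∑-cartesianProductWith h xs ys f))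

  ∑-tabulate : ∀ {b} {B : Set b} {n} (h : Fin n → B) f → ∑ (tabulate h) f ≈ sum (f ∘ h)
  ∑-tabulate {n = zero}  h f = refl
  ∑-tabulate {n = suc n} h f = +-congˡ (∑-tabulate (h ∘ suc) f)

  *-distribˡ-∑ : ∀ {b} {B : Set b} z (xs : List B) f → z ⊛ ∑ xs f ≈ ∑ xs (λ x → z ⊛ f x)
  *-distribˡ-∑ z []       f = zeroʳ z
  *-distribˡ-∑ z (x ∷ xs) f = trans (distribˡ z _ _) (+-congˡ (*-distribˡ-∑ z xs f))

  ∑-allEndingIn : ∀ {r M} (f : Fin M → Fin r) n w →
    ∑ (allEndingIn f n) w ≈ sum (λ x → sum (λ t → ∑ (all n) (λ g → w (extend (f x) t g))))
  ∑-allEndingIn {M = M} f n w = trans (∑-cartesianProductWith (uncurry (extend ∘ f)) (cartesianProduct (allFin M) (allFin (suc n))) (all n) w)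
    (trans (∑-cartesianProductWith _,_ (allFin M) (allFin (suc n)) _)
      (trans (∑-tabulate {n = M} id _) (sum-cong-≋ {M} λ x → ∑-tabulate {n = suc n} id (λ t → ∑ (all n) (λ g → w (extend (f x) t g))))))

module WeightedCount {a ℓ} (A : CommutativeSemiring a ℓ) (r : ℕ) .{{_ : NonZero r}} where

  open CommutativeSemiring A hiding (zero) renaming (_+_ to _⊕_; _*_ to _⊛_)
  open Exp A
  open SemiringSum semiring
  open MonoidSum *-commutativeMonoid using () renaming (sum to product; sum-init-last to product-init-last; sum-cong-≗ to product-cong-≗)
  open CommutativeSemigroupProperties *-commutativeSemigroup using (interchange; x∙yz≈y∙xz; x∙yz≈xz∙y; xy∙z≈xz∙y)
  open GeometricSum A
  open ListSum A
  open RootOfUnity A using (1^)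
  open import Relation.Binary.Reasoning.Setoid setoid

  -- In terms of v = x′ - x the exponent is v, except that v = 0 becomes r when Q holds: the
  -- exponents are 0, ..., r-1 or 1, ..., r. The exceptional case is written v < `indicator Q?`,
  -- which makes this a rotated geometric sum with threshold 0 or 1.
  sum-over-penultimate-colour : ∀ u (x : Fin r) {q} {Q : Set q} (Q? : Dec Q) →
    sum (λ x′ → u ^ (r * indicator (x′ Fin.≟ x ×-dec Q?) + difference x′ x)) ≈ u ^ indicator Q? ⊛ geometric u r
  sum-over-penultimate-colour u x Q? = begin
    sum (λ x′ → u ^ (r * indicator (x′ Fin.≟ x ×-dec Q?) + difference x′ x))
      ≈⟨ sum-permute (λ x′ → u ^ (r * indicator (x′ Fin.≟ x ×-dec Q?) + difference x′ x)) (translate x) ⟩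
    sum (λ v → u ^ (r * indicator ((translate x ⟨$⟩ʳ v) Fin.≟ x ×-dec Q?) + difference (translate x ⟨$⟩ʳ v) x))
      ≡⟨ sum-cong-≗ (λ v → ≡.cong (u ^_) (≡.trans (ℕ.+-comm (r * indicator ((translate x ⟨$⟩ʳ v) Fin.≟ x ×-dec Q?)) _)
           (≡.cong₂ (λ d b → d + r * b) (mod-difference v x) (indicator-wrap Q? v)))) ⟩
    sum {r} (λ v → u ^ (toℕ v + r * indicator (toℕ v ℕ.<? indicator Q?)))
      ≈⟨ rotated-geometric u r (indicator≤r Q?) ⟩
    u ^ indicator Q? ⊛ geometric u r ∎
    where
    indicator-wrap : ∀ {q} {Q : Set q} (Q? : Dec Q) v →
      indicator ((translate x ⟨$⟩ʳ v) Fin.≟ x ×-dec Q?) ≡ indicator (toℕ v ℕ.<? indicator Q?)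
    indicator-wrap Q?@(yes q) v = indicator-⇔
      (mk⇔ (λ (p , _) → ℕ.≤-reflexive (≡.cong suc (to p))) (λ p → from (ℕ.n≤0⇒n≡0 (s≤s⁻¹ p)) , q))
      ((translate x ⟨$⟩ʳ v) Fin.≟ x ×-dec Q?) (toℕ v ℕ.<? 1)
      where open Equivalence (translate≡⇔ v x)
    indicator-wrap Q?@(no ¬q) v = indicator-⇔
      (mk⇔ (λ (_ , q) → contradiction q ¬q) (λ ()))
      ((translate x ⟨$⟩ʳ v) Fin.≟ x ×-dec Q?) (toℕ v ℕ.<? 0)

    indicator≤r : ∀ {q} {Q : Set q} (Q? : Dec Q) → indicator Q? ≤ r
    indicator≤r (yes _) = >-nonZero⁻¹ r
    indicator≤r (no _)  = z≤n

  module _ (e y : Carrier) (e² : e ⊛ e ≈ 1#) where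

    signedWeight : ∀ {n} → ColouredPerm r (suc n) → Carrier
    signedWeight g = e ^ inv (perm g) ⊛ y ^ weight g

    -- This is xₙ₊₁ of the overview, as n counts the letters before the last one.
    signedVariable : ℕ → Carrier
    signedVariable n = e ^ n ⊛ y

    e^-square : ∀ m → e ^ m ⊛ e ^ m ≈ 1#
    e^-square m = trans (sym (^-distrib-* e e m)) (trans (^-congˡ m e²) (1^ m))

    -- The parity of n(n+1) enters through the recursion (n+1)(n+2) = 2(n+1) + n(n+1), so that no
    -- halving is necessary.
    e^-pronic : ∀ n → e ^ (n * suc n) ≈ 1#
    e^-pronic zero    = refl
    e^-pronic (suc n) = begin
      e ^ (suc n * suc (suc n))                      ≡⟨ ≡.cong (e ^_) (ℕ.*-comm (suc n) (suc (suc n))) ⟩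
      e ^ (suc n + (suc n + n * suc n))              ≈⟨ ^-homo-* e (suc n) _ ⟩
      e ^ suc n ⊛ e ^ (suc n + n * suc n)            ≈⟨ *-congˡ (^-homo-* e (suc n) (n * suc n)) ⟩
      e ^ suc n ⊛ (e ^ suc n ⊛ e ^ (n * suc n))      ≈⟨ *-assoc _ _ _ ⟨
      (e ^ suc n ⊛ e ^ suc n) ⊛ e ^ (n * suc n)      ≈⟨ *-cong (e^-square (suc n)) (e^-pronic n) ⟩
      1# ⊛ 1#                                        ≈⟨ *-identityˡ 1# ⟩
      1#                                             ∎

    -- This power does not see the sign. It allows powers of yⁿ⁺¹, produced by drops and last
    -- colours, to be merged with powers of the signed variable, produced by inversions.
    signedVariable-^ : ∀ n → signedVariable n ^ suc n ≈ y ^ suc n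
    signedVariable-^ n = begin
      (e ^ n ⊛ y) ^ suc n                ≈⟨ ^-distrib-* (e ^ n) y (suc n) ⟩
      (e ^ n) ^ suc n ⊛ y ^ suc n        ≈⟨ *-congʳ (trans (^-assocʳ e n (suc n)) (e^-pronic n)) ⟩
      1# ⊛ y ^ suc n                     ≈⟨ *-identityˡ _ ⟩
      y ^ suc n                          ∎

    factor : ℕ → Carrier
    factor i = geometric (signedVariable i) (suc i * r)

    -- The multiplier is independent of g and hence leaves the sum over g, to which the induction
    -- hypothesis then applies.
    signedWeight-extend : ∀ {n} x t x′ t′ (g : ColouredPerm r n) →
      signedWeight (extend x t (extend x′ t′ g)) ≈
      (e ^ toℕ t ⊛ (y ^ suc n) ^ (r * indicator (x′ Fin.≟ x ×-dec toℕ t′ ℕ.<? toℕ t) + difference x′ x))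
        ⊛ signedWeight (extend x′ t′ g)
    signedWeight-extend {n} x t x′ t′ g = begin
      e ^ inv (perm (extend x t g′)) ⊛ y ^ weight (extend x t g′)
        ≡⟨ ≡.cong₂ (λ i w → e ^ i ⊛ y ^ w) (inv-extend x t g′) (weight-extend x t x′ t′ g) ⟩
      e ^ (inv (perm g′) + toℕ t) ⊛ y ^ (weight g′ + suc n * d)
        ≈⟨ *-cong (^-homo-* e (inv (perm g′)) (toℕ t)) (^-homo-* y (weight g′) (suc n * d)) ⟩
      (e ^ inv (perm g′) ⊛ e ^ toℕ t) ⊛ (y ^ weight g′ ⊛ y ^ (suc n * d))
        ≈⟨ interchange _ _ _ _ ⟩
      signedWeight g′ ⊛ (e ^ toℕ t ⊛ y ^ (suc n * d))
        ≈⟨ *-comm _ _ ⟩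
      (e ^ toℕ t ⊛ y ^ (suc n * d)) ⊛ signedWeight g′
        ≈⟨ *-congʳ (*-congˡ (^-assocʳ y (suc n) d)) ⟨
      (e ^ toℕ t ⊛ (y ^ suc n) ^ d) ⊛ signedWeight g′ ∎
      where
      g′ = extend x′ t′ g
      d  = r * indicator (x′ Fin.≟ x ×-dec toℕ t′ ℕ.<? toℕ t) + difference x′ x

    -- Fixing the last value refines the signed Mahonian identity so that it can be proved term by term.
    sum-with-last : ∀ n x (t : Fin (suc n)) →
      ∑ (all n) (λ g → signedWeight (extend x t g)) ≈ signedVariable n ^ toℕ t ⊛ product (λ (i : Fin n) → factor (toℕ i))
    sum-with-last zero x zero = begin
      e ^ inv (perm (extend x zero g₀)) ⊛ 1# ⊕ 0#   ≈⟨ +-identityʳ _ ⟩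
      e ^ inv (perm (extend x zero g₀)) ⊛ 1#        ≡⟨ ≡.cong (λ i → e ^ i ⊛ 1#) (inv-extend x zero g₀) ⟩
      1# ⊛ 1#                                       ∎
      where
      g₀ : ColouredPerm r 0
      g₀ = (λ ()) ⨾ Perm.id
    sum-with-last (suc n) x t = begin
      ∑ (all (suc n)) (λ g → signedWeight (extend x t g))
        ≈⟨ ∑-allEndingIn id n (λ g → signedWeight (extend x t g)) ⟩
      sum (λ x′ → sum (λ t′ → ∑ (all n) (λ g → signedWeight (extend x t (extend x′ t′ g)))))
        ≈⟨ sum-cong-≋ (λ x′ → sum-cong-≋ (λ t′ → inner x′ t′)) ⟩
      sum (λ x′ → sum (λ t′ → (E ⊛ (v ^ toℕ t′ ⊛ P)) ⊛ u ^ d x′ t′))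
        -- The colour must be summed first: only that sum turns the last descent into the shift that
        -- rotates the exponents of v.
        ≈⟨ ∑-comm (λ x′ t′ → (E ⊛ (v ^ toℕ t′ ⊛ P)) ⊛ u ^ d x′ t′) ⟩
      sum (λ t′ → sum (λ x′ → (E ⊛ (v ^ toℕ t′ ⊛ P)) ⊛ u ^ d x′ t′))
        ≈⟨ sum-cong-≋ over-colours ⟩
      sum {suc n} (λ t′ → (E ⊛ (Γ ⊛ P)) ⊛ v ^ (toℕ t′ + suc n * indicator (toℕ t′ ℕ.<? toℕ t)))
        ≈⟨ *-distribˡ-sum {suc n} (E ⊛ (Γ ⊛ P)) (λ t′ → v ^ (toℕ t′ + suc n * indicator (toℕ t′ ℕ.<? toℕ t))) ⟨
      (E ⊛ (Γ ⊛ P)) ⊛ sum {suc n} (λ t′ → v ^ (toℕ t′ + suc n * indicator (toℕ t′ ℕ.<? toℕ t)))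
        -- Here t may be as large as n + 1, in which case every exponent is shifted.
        ≈⟨ *-congˡ (rotated-geometric v (suc n) (s≤s⁻¹ (Fin.toℕ<n t))) ⟩
      (E ⊛ (Γ ⊛ P)) ⊛ (v ^ toℕ t ⊛ geometric v (suc n))
        ≈⟨ interchange _ _ _ _ ⟩
      (E ⊛ v ^ toℕ t) ⊛ ((Γ ⊛ P) ⊛ geometric v (suc n))
        ≈⟨ *-cong collect-sign collect-factor ⟩
      signedVariable (suc n) ^ toℕ t ⊛ product (λ (i : Fin (suc n)) → factor (toℕ i)) ∎
      where
      E = e ^ toℕ t
      v = signedVariable n
      u = y ^ suc n
      P = product (λ (i : Fin n) → factor (toℕ i))
      Γ = geometric u r
      d : Fin r → Fin (suc n) → ℕ
      d x′ t′ = r * indicator (x′ Fin.≟ x ×-dec toℕ t′ ℕ.<? toℕ t) + difference x′ x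

      inner : ∀ x′ t′ → ∑ (all n) (λ g → signedWeight (extend x t (extend x′ t′ g))) ≈
                        (E ⊛ (v ^ toℕ t′ ⊛ P)) ⊛ u ^ d x′ t′
      inner x′ t′ = begin
        ∑ (all n) (λ g → signedWeight (extend x t (extend x′ t′ g)))
          ≈⟨ ∑-cong (all n) (signedWeight-extend x t x′ t′) ⟩
        ∑ (all n) (λ g → (E ⊛ u ^ d x′ t′) ⊛ signedWeight (extend x′ t′ g))
          ≈⟨ *-distribˡ-∑ (E ⊛ u ^ d x′ t′) (all n) _ ⟨
        (E ⊛ u ^ d x′ t′) ⊛ ∑ (all n) (λ g → signedWeight (extend x′ t′ g))
          ≈⟨ *-congˡ (sum-with-last n x′ t′) ⟩
        (E ⊛ u ^ d x′ t′) ⊛ (v ^ toℕ t′ ⊛ P)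
          ≈⟨ xy∙z≈xz∙y _ _ _ ⟩
        (E ⊛ (v ^ toℕ t′ ⊛ P)) ⊛ u ^ d x′ t′ ∎

      over-colours : ∀ t′ → sum (λ x′ → (E ⊛ (v ^ toℕ t′ ⊛ P)) ⊛ u ^ d x′ t′) ≈
                            (E ⊛ (Γ ⊛ P)) ⊛ v ^ (toℕ t′ + suc n * indicator (toℕ t′ ℕ.<? toℕ t))
      over-colours t′ = begin
        sum (λ x′ → (E ⊛ (v ^ toℕ t′ ⊛ P)) ⊛ u ^ d x′ t′)
          ≈⟨ *-distribˡ-sum (E ⊛ (v ^ toℕ t′ ⊛ P)) (λ x′ → u ^ d x′ t′) ⟨
        (E ⊛ (v ^ toℕ t′ ⊛ P)) ⊛ sum (λ x′ → u ^ d x′ t′)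
          ≈⟨ *-congˡ (sum-over-penultimate-colour u x (toℕ t′ ℕ.<? toℕ t)) ⟩
        (E ⊛ (v ^ toℕ t′ ⊛ P)) ⊛ (u ^ b ⊛ Γ)
          -- The descent factor u = yⁿ⁺¹ is rewritten as vⁿ⁺¹, so that it joins the power of v
          -- carried by t′.
          ≈⟨ *-congˡ (*-congʳ (trans (^-congˡ b (sym (signedVariable-^ n))) (^-assocʳ v (suc n) b))) ⟩
        (E ⊛ (v ^ toℕ t′ ⊛ P)) ⊛ (v ^ (suc n * b) ⊛ Γ)
          ≈⟨ *-assoc _ _ _ ⟩
        E ⊛ ((v ^ toℕ t′ ⊛ P) ⊛ (v ^ (suc n * b) ⊛ Γ))
          ≈⟨ *-congˡ (trans (interchange _ _ _ _) (*-comm _ _)) ⟩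
        E ⊛ ((P ⊛ Γ) ⊛ (v ^ toℕ t′ ⊛ v ^ (suc n * b)))
          ≈⟨ *-congˡ (*-cong (*-comm P Γ) (sym (^-homo-* v (toℕ t′) (suc n * b)))) ⟩
        E ⊛ ((Γ ⊛ P) ⊛ v ^ (toℕ t′ + suc n * b))
          ≈⟨ *-assoc _ _ _ ⟨
        (E ⊛ (Γ ⊛ P)) ⊛ v ^ (toℕ t′ + suc n * b) ∎
        where b = indicator (toℕ t′ ℕ.<? toℕ t)

      -- The t inversions made by the new letter supply one more sign for each factor of vᵗ.
      collect-sign : E ⊛ v ^ toℕ t ≈ signedVariable (suc n) ^ toℕ t
      collect-sign = trans (sym (^-distrib-* e v (toℕ t))) (^-congˡ (toℕ t) (sym (*-assoc e (e ^ n) y)))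

      -- The bracket [r] from the colours is taken at vⁿ⁺¹ and the bracket [n+1] from the values at
      -- v, so together they form [(n+1)r]_v.
      collect-factor : (Γ ⊛ P) ⊛ geometric v (suc n) ≈ product (λ (i : Fin (suc n)) → factor (toℕ i))
      collect-factor = begin
        (Γ ⊛ P) ⊛ geometric v (suc n)         ≈⟨ *-congʳ (*-comm Γ P) ⟩
        (P ⊛ Γ) ⊛ geometric v (suc n)         ≈⟨ *-assoc P Γ _ ⟩
        P ⊛ (Γ ⊛ geometric v (suc n))         ≈⟨ *-congˡ (trans (*-comm _ _) (*-congˡ (geometric-cong r (sym (signedVariable-^ n))))) ⟩
        P ⊛ (geometric v (suc n) ⊛ geometric (v ^ suc n) r)   ≈⟨ *-congˡ (geometric-* v r (suc n)) ⟨
        P ⊛ geometric v (r * suc n)           ≡⟨ ≡.cong (λ m → P ⊛ geometric v m) (ℕ.*-comm r (suc n)) ⟩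
        P ⊛ factor n                          ≡⟨ ≡.cong₂ _⊛_ (product-cong-≗ {n} (λ i → ≡.cong factor (Fin.toℕ-inject₁ i))) (≡.cong factor (Fin.toℕ-fromℕ n)) ⟨
        product (λ (i : Fin n) → factor (toℕ (inject₁ i))) ⊛ factor (toℕ (fromℕ n))
          ≈⟨ product-init-last (λ (i : Fin (suc n)) → factor (toℕ i)) ⟨
        product (λ (i : Fin (suc n)) → factor (toℕ i)) ∎

    -- The sum with a prescribed last letter does not depend on its colour, so f is immaterial. The
    -- remaining sums over t and over the index x of the colour give [n+1]_v and [M] at vⁿ⁺¹, which
    -- merge into one bracket.
    sum-allEndingIn : ∀ {M} (f : Fin M → Fin r) n →
      sum (λ x → sum (λ t → ∑ (all n) (λ g → signedWeight (extend (f x) t g) ⊛ y ^ (suc n * toℕ x)))) ≈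
      product (λ (i : Fin n) → factor (toℕ i)) ⊛ geometric (signedVariable n) (suc n * M)
    sum-allEndingIn {M} f n = begin
      sum (λ x → sum (λ t → ∑ (all n) (λ g → signedWeight (extend (f x) t g) ⊛ y ^ (suc n * toℕ x))))
        ≈⟨ sum-cong-≋ (λ x → sum-cong-≋ (λ t → inner x t)) ⟩
      sum {M} (λ x → sum {suc n} (λ t → ((v ^ suc n) ^ toℕ x ⊛ P) ⊛ v ^ toℕ t))
        ≈⟨ sum-cong-≋ {M} (λ x → *-distribˡ-sum {suc n} ((v ^ suc n) ^ toℕ x ⊛ P) (λ t → v ^ toℕ t)) ⟨
      sum {M} (λ x → ((v ^ suc n) ^ toℕ x ⊛ P) ⊛ geometric v (suc n))
        ≈⟨ sum-cong-≋ {M} (λ x → *-assoc _ _ _) ⟩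
      sum {M} (λ x → (v ^ suc n) ^ toℕ x ⊛ (P ⊛ geometric v (suc n)))
        ≈⟨ *-distribʳ-sum {M} (P ⊛ geometric v (suc n)) (λ x → (v ^ suc n) ^ toℕ x) ⟨
      geometric (v ^ suc n) M ⊛ (P ⊛ geometric v (suc n))
        ≈⟨ x∙yz≈y∙xz _ _ _ ⟩
      P ⊛ (geometric (v ^ suc n) M ⊛ geometric v (suc n))
        ≈⟨ *-congˡ (trans (*-comm _ _) (sym (geometric-* v M (suc n)))) ⟩
      P ⊛ geometric v (M * suc n)
        ≡⟨ ≡.cong (λ m → P ⊛ geometric v m) (ℕ.*-comm M (suc n)) ⟩
      P ⊛ geometric v (suc n * M) ∎
      where
      v = signedVariable n
      P = product (λ (i : Fin n) → factor (toℕ i))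

      inner : ∀ x t → ∑ (all n) (λ g → signedWeight (extend (f x) t g) ⊛ y ^ (suc n * toℕ x)) ≈
                      ((v ^ suc n) ^ toℕ x ⊛ P) ⊛ v ^ toℕ t
      inner x t = begin
        ∑ (all n) (λ g → signedWeight (extend (f x) t g) ⊛ y ^ (suc n * toℕ x))
          ≈⟨ ∑-cong (all n) (λ g → *-comm _ _) ⟩
        ∑ (all n) (λ g → y ^ (suc n * toℕ x) ⊛ signedWeight (extend (f x) t g))
          ≈⟨ *-distribˡ-∑ (y ^ (suc n * toℕ x)) (all n) _ ⟨
        y ^ (suc n * toℕ x) ⊛ ∑ (all n) (λ g → signedWeight (extend (f x) t g))
          ≈⟨ *-cong (trans (sym (^-assocʳ y (suc n) (toℕ x))) (^-congˡ (toℕ x) (sym (signedVariable-^ n)))) (sum-with-last n (f x) t) ⟩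
        (v ^ suc n) ^ toℕ x ⊛ (v ^ toℕ t ⊛ P)
          ≈⟨ x∙yz≈xz∙y _ _ _ ⟩
        ((v ^ suc n) ^ toℕ x ⊛ P) ⊛ v ^ toℕ t ∎

-- Polynomials

module PolynomialSemiring {a ℓ} (K : CommutativeRing a ℓ) where

  open OverRing K
  private module K = CommutativeRing K

  -- A record, so that the two polynomials can be inferred from an equation between them.
  infix 4 _≋ᴾ_
  record _≋ᴾ_ (F H : Poly) : Set ℓ where
    constructor coeffwise
    field coeff-≈ : F ≈ᴾ H

  open _≋ᴾ_ public

  scale : Carrier → Poly → Poly
  scale x = map (x *ᴷ_)

  coeff-+ : ∀ F H d → coeff (F +ᴾ H) d ≈ coeff F d +ᴷ coeff H d
  coeff-+ []      H       d       = K.sym (K.+-identityˡ _)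
  coeff-+ (x ∷ F) []      d       = K.sym (K.+-identityʳ _)
  coeff-+ (x ∷ F) (y ∷ H) zero    = K.refl
  coeff-+ (x ∷ F) (y ∷ H) (suc d) = coeff-+ F H d

  coeff-scale : ∀ x F d → coeff (scale x F) d ≈ x *ᴷ coeff F d
  coeff-scale x []      d       = K.sym (K.zeroʳ x)
  coeff-scale x (y ∷ F) zero    = K.refl
  coeff-scale x (y ∷ F) (suc d) = coeff-scale x F d

  ∷-cong : ∀ {x y F H} → x ≈ y → F ≋ᴾ H → (x ∷ F) ≋ᴾ (y ∷ H)
  ∷-cong x≈y F≋H .coeff-≈ zero    = x≈y
  ∷-cong x≈y F≋H .coeff-≈ (suc d) = F≋H .coeff-≈ d

  private
    ≋-refl : ∀ {F} → F ≋ᴾ F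
    ≋-refl .coeff-≈ d = K.refl

    ≋-sym : ∀ {F H} → F ≋ᴾ H → H ≋ᴾ F
    ≋-sym F≋H .coeff-≈ d = K.sym (F≋H .coeff-≈ d)

    ≋-trans : ∀ {F G H} → F ≋ᴾ G → G ≋ᴾ H → F ≋ᴾ H
    ≋-trans F≋G G≋H .coeff-≈ d = K.trans (F≋G .coeff-≈ d) (G≋H .coeff-≈ d)

    +-cong : ∀ {F F′ H H′} → F ≋ᴾ F′ → H ≋ᴾ H′ → F +ᴾ H ≋ᴾ F′ +ᴾ H′
    +-cong {F} {F′} {H} {H′} F≋F′ H≋H′ .coeff-≈ d =
      K.trans (coeff-+ F H d)
        (K.trans (K.+-cong (F≋F′ .coeff-≈ d) (H≋H′ .coeff-≈ d)) (K.sym (coeff-+ F′ H′ d)))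

    +-assoc : ∀ F G H → F +ᴾ G +ᴾ H ≋ᴾ F +ᴾ (G +ᴾ H)
    +-assoc F G H .coeff-≈ d = begin
      coeff (F +ᴾ G +ᴾ H) d                    ≈⟨ coeff-+ (F +ᴾ G) H d ⟩
      coeff (F +ᴾ G) d +ᴷ coeff H d            ≈⟨ K.+-congʳ (coeff-+ F G d) ⟩
      coeff F d +ᴷ coeff G d +ᴷ coeff H d      ≈⟨ K.+-assoc _ _ _ ⟩
      coeff F d +ᴷ (coeff G d +ᴷ coeff H d)    ≈⟨ K.+-congˡ (coeff-+ G H d) ⟨
      coeff F d +ᴷ coeff (G +ᴾ H) d            ≈⟨ coeff-+ F (G +ᴾ H) d ⟨
      coeff (F +ᴾ (G +ᴾ H)) d                  ∎
      where open import Relation.Binary.Reasoning.Setoid K.setoid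

    +-comm : ∀ F H → F +ᴾ H ≋ᴾ H +ᴾ F
    +-comm F H .coeff-≈ d =
      K.trans (coeff-+ F H d) (K.trans (K.+-comm _ _) (K.sym (coeff-+ H F d)))

    +-identityʳ : ∀ F → F +ᴾ [] ≋ᴾ F
    +-identityʳ F = +-comm F []

  +-commutativeMonoid : CommutativeMonoid a ℓ
  +-commutativeMonoid = record
    { Carrier = Poly
    ; _≈_ = _≋ᴾ_
    ; _∙_ = _+ᴾ_
    ; ε = []
    ; isCommutativeMonoid = record
      { isMonoid = record
        { isSemigroup = record
          { isMagma = record
            { isEquivalence = record { refl = ≋-refl ; sym = ≋-sym ; trans = ≋-trans }
            ; ∙-cong = +-cong
            }
          ; assoc = +-assoc
          }
        ; identity = (λ _ → ≋-refl) , +-identityʳ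
        }
      ; comm = +-comm
      }
    }

  private
    module + = CommutativeMonoid +-commutativeMonoid

  open CommutativeSemigroupProperties +.commutativeSemigroup using (interchange; x∙yz≈y∙xz)
  open import Relation.Binary.Reasoning.Setoid +.setoid

  scale-cong : ∀ {x y F H} → x ≈ y → F ≋ᴾ H → scale x F ≋ᴾ scale y H
  scale-cong {x} {y} {F} {H} x≈y F≋H .coeff-≈ d =
    K.trans (coeff-scale x F d)
      (K.trans (K.*-cong x≈y (F≋H .coeff-≈ d)) (K.sym (coeff-scale y H d)))

  scale-distribˡ : ∀ x F H → scale x (F +ᴾ H) ≋ᴾ scale x F +ᴾ scale x H
  scale-distribˡ x []      H       = ≋-refl
  scale-distribˡ x (y ∷ F) []      = ≋-refl
  scale-distribˡ x (y ∷ F) (z ∷ H) = ∷-cong (K.distribˡ x y z) (scale-distribˡ x F H)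

  scale-distribʳ : ∀ x y F → scale (x +ᴷ y) F ≋ᴾ scale x F +ᴾ scale y F
  scale-distribʳ x y []      = ≋-refl
  scale-distribʳ x y (z ∷ F) = ∷-cong (K.distribʳ z x y) (scale-distribʳ x y F)

  scale-scale : ∀ x y F → scale (x *ᴷ y) F ≋ᴾ scale x (scale y F)
  scale-scale x y []      = ≋-refl
  scale-scale x y (z ∷ F) = ∷-cong (K.*-assoc x y z) (scale-scale x y F)

  scale-1 : ∀ F → scale 1# F ≋ᴾ F
  scale-1 []      = ≋-refl
  scale-1 (x ∷ F) = ∷-cong (K.*-identityˡ x) (scale-1 F)

  0∷[] : 0# ∷ [] ≋ᴾ []
  0∷[] .coeff-≈ zero    = K.refl
  0∷[] .coeff-≈ (suc d) = K.refl

  scale-0 : ∀ F → scale 0# F ≋ᴾ []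
  scale-0 []      = ≋-refl
  scale-0 (x ∷ F) = ≋-trans (∷-cong (K.zeroˡ x) (scale-0 F)) 0∷[]

  0∷-+ : ∀ F H → 0# ∷ (F +ᴾ H) ≋ᴾ (0# ∷ F) +ᴾ (0# ∷ H)
  0∷-+ F H = ∷-cong (K.sym (K.+-identityˡ 0#)) ≋-refl

  0∷-* : ∀ F H → (0# ∷ F) *ᴾ H ≋ᴾ 0# ∷ (F *ᴾ H)
  0∷-* F H = +.∙-congʳ (scale-0 H)

  private
    *-zeroʳ : ∀ F → F *ᴾ [] ≋ᴾ []
    *-zeroʳ []      = ≋-refl
    *-zeroʳ (x ∷ F) = ≋-trans (∷-cong K.refl (*-zeroʳ F)) 0∷[]

    -- The defining recursion of the product mirrored into its second factor, as the induction for
    -- commutativity requires.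
    *-∷ : ∀ F y H → F *ᴾ (y ∷ H) ≋ᴾ scale y F +ᴾ (0# ∷ (F *ᴾ H))
    *-∷ []      y H = ≋-sym 0∷[]
    *-∷ (x ∷ F) y H = ∷-cong (K.+-congʳ (K.*-comm x y)) (begin
      scale x H +ᴾ F *ᴾ (y ∷ H)                    ≈⟨ +.∙-congˡ (*-∷ F y H) ⟩
      scale x H +ᴾ (scale y F +ᴾ (0# ∷ (F *ᴾ H)))  ≈⟨ x∙yz≈y∙xz (scale x H) (scale y F) _ ⟩
      scale y F +ᴾ (scale x H +ᴾ (0# ∷ (F *ᴾ H)))  ∎)

    *-congˡ : ∀ F {H H′} → H ≋ᴾ H′ → F *ᴾ H ≋ᴾ F *ᴾ H′
    *-congˡ []      H≋H′ = ≋-refl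
    *-congˡ (x ∷ F) H≋H′ = +-cong (scale-cong K.refl H≋H′) (∷-cong K.refl (*-congˡ F H≋H′))

    *-comm : ∀ F H → F *ᴾ H ≋ᴾ H *ᴾ F
    *-comm []      H = ≋-sym (*-zeroʳ H)
    *-comm (x ∷ F) H = begin
      scale x H +ᴾ (0# ∷ (F *ᴾ H))  ≈⟨ +.∙-congˡ (∷-cong K.refl (*-comm F H)) ⟩
      scale x H +ᴾ (0# ∷ (H *ᴾ F))  ≈⟨ *-∷ H x F ⟨
      H *ᴾ (x ∷ F)                  ∎

    -- Equal polynomials may be lists of different lengths, so congruence in the first factor does
    -- not follow the recursion; commutativity moves it to the second.
    *-cong : ∀ {F F′ H H′} → F ≋ᴾ F′ → H ≋ᴾ H′ → F *ᴾ H ≋ᴾ F′ *ᴾ H′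
    *-cong {F} {F′} {H} {H′} F≋F′ H≋H′ = begin
      F *ᴾ H    ≈⟨ *-congˡ F H≋H′ ⟩
      F *ᴾ H′   ≈⟨ *-comm F H′ ⟩
      H′ *ᴾ F   ≈⟨ *-congˡ H′ F≋F′ ⟩
      H′ *ᴾ F′  ≈⟨ *-comm H′ F′ ⟩
      F′ *ᴾ H′  ∎

    *-distribʳ : ∀ H F G → (F +ᴾ G) *ᴾ H ≋ᴾ F *ᴾ H +ᴾ G *ᴾ H
    *-distribʳ H []      G       = ≋-refl
    *-distribʳ H (x ∷ F) []      = ≋-sym (+-identityʳ _)
    *-distribʳ H (x ∷ F) (y ∷ G) = begin
      scale (x +ᴷ y) H +ᴾ (0# ∷ ((F +ᴾ G) *ᴾ H))
        ≈⟨ +-cong (scale-distribʳ x y H) (≋-trans (∷-cong K.refl (*-distribʳ H F G)) (0∷-+ (F *ᴾ H) (G *ᴾ H))) ⟩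
      (scale x H +ᴾ scale y H) +ᴾ ((0# ∷ (F *ᴾ H)) +ᴾ (0# ∷ (G *ᴾ H)))
        ≈⟨ interchange (scale x H) _ _ _ ⟩
      (x ∷ F) *ᴾ H +ᴾ (y ∷ G) *ᴾ H ∎

    scale-* : ∀ x G H → scale x G *ᴾ H ≋ᴾ scale x (G *ᴾ H)
    scale-* x []      H = ≋-refl
    scale-* x (y ∷ G) H = begin
      scale (x *ᴷ y) H +ᴾ (0# ∷ (scale x G *ᴾ H))
        ≈⟨ +-cong (scale-scale x y H) (∷-cong (K.sym (K.zeroʳ x)) (scale-* x G H)) ⟩
      scale x (scale y H) +ᴾ scale x (0# ∷ (G *ᴾ H))
        ≈⟨ scale-distribˡ x (scale y H) _ ⟨
      scale x ((y ∷ G) *ᴾ H) ∎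

    *-assoc : ∀ F G H → F *ᴾ G *ᴾ H ≋ᴾ F *ᴾ (G *ᴾ H)
    *-assoc []      G H = ≋-refl
    *-assoc (x ∷ F) G H = begin
      (scale x G +ᴾ (0# ∷ (F *ᴾ G))) *ᴾ H          ≈⟨ *-distribʳ H (scale x G) _ ⟩
      scale x G *ᴾ H +ᴾ (0# ∷ (F *ᴾ G)) *ᴾ H       ≈⟨ +-cong (scale-* x G H) (0∷-* (F *ᴾ G) H) ⟩
      scale x (G *ᴾ H) +ᴾ (0# ∷ (F *ᴾ G *ᴾ H))     ≈⟨ +.∙-congˡ (∷-cong K.refl (*-assoc F G H)) ⟩
      scale x (G *ᴾ H) +ᴾ (0# ∷ (F *ᴾ (G *ᴾ H)))   ∎

    *-identityˡ : ∀ H → (1# ∷ []) *ᴾ H ≋ᴾ H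
    *-identityˡ H = ≋-trans (+-cong (scale-1 H) 0∷[]) (+-identityʳ H)

  commutativeSemiring : CommutativeSemiring a ℓ
  commutativeSemiring = record
    { Carrier = Poly
    ; _≈_ = _≋ᴾ_
    ; _+_ = _+ᴾ_
    ; _*_ = _*ᴾ_
    ; 0# = []
    ; 1# = 1# ∷ []
    ; isCommutativeSemiring = isCommutativeSemiringˡ record
      { +-isCommutativeMonoid = +.isCommutativeMonoid
      ; *-isCommutativeMonoid = record
        { isMonoid = record
          { isSemigroup = record
            { isMagma = record { isEquivalence = +.isEquivalence ; ∙-cong = *-cong }
            ; assoc = *-assoc
            }
          ; identity = *-identityˡ , λ H → ≋-trans (*-comm H _) (*-identityˡ H)
          }
        ; comm = *-comm
        }
      ; distribʳ = *-distribʳ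
      ; zeroˡ = λ _ → ≋-refl
      }
    }

  open GeometricSum commutativeSemiring using (geometric)
  open Exp commutativeSemiring using (_^_)
  open MonoidSum +-commutativeMonoid using (sum; sum-cong-≗)
  open MonoidSum (CommutativeSemiring.*-commutativeMonoid commutativeSemiring) using ()
    renaming (sum to product)

  -- The operations of polyRawSemiring carry its relation _≈ᴾ_, so they agree with those of
  -- commutativeSemiring only propositionally.
  ^ᴾ≡^ : ∀ F m → F ^ᴾ m ≡ F ^ m
  ^ᴾ≡^ F zero    = ≡.refl
  ^ᴾ≡^ F (suc m) = ≡.cong (F *ᴾ_) (^ᴾ≡^ F m)

  sumᴾ≡sum : ∀ {m} (F : Fin m → Poly) → sumᴾ F ≡ sum F
  sumᴾ≡sum {zero}  F = ≡.refl
  sumᴾ≡sum {suc m} F = ≡.cong (F zero +ᴾ_) (sumᴾ≡sum (F ∘ suc))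

  productᴾ≡product : ∀ {m} (F : Fin m → Poly) → productᴾ F ≡ product F
  productᴾ≡product {zero}  F = ≡.refl
  productᴾ≡product {suc m} F = ≡.cong (F zero *ᴾ_) (productᴾ≡product (F ∘ suc))

  []at≡geometric : ∀ m F → [ m ]at F ≡ geometric F m
  []at≡geometric m F = ≡.trans (sumᴾ≡sum {m} (λ i → F ^ᴾ toℕ i)) (sum-cong-≗ {m} (λ i → ^ᴾ≡^ F (toℕ i)))

  q^-cong : ∀ {x y} d → x ≈ y → x q^ d ≋ᴾ y q^ d
  q^-cong zero    x≈y = ∷-cong x≈y ≋-refl
  q^-cong (suc d) x≈y = ∷-cong K.refl (q^-cong d x≈y)

  q^-* : ∀ x y d e → x q^ d *ᴾ y q^ e ≋ᴾ (x *ᴷ y) q^ (d + e)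
  q^-* x y (suc d) e = ≋-trans (0∷-* (x q^ d) (y q^ e)) (∷-cong K.refl (q^-* x y d e))
  q^-* x y zero    e = ≋-trans (≋-trans (+.∙-congˡ 0∷[]) (+-identityʳ _)) (scale-q^ e)
    where
    scale-q^ : ∀ e → scale x (y q^ e) ≋ᴾ (x *ᴷ y) q^ e
    scale-q^ zero    = ≋-refl
    scale-q^ (suc e) = ∷-cong (K.zeroʳ x) (scale-q^ e)

  q^-^ : ∀ x d m → (x q^ d) ^ m ≋ᴾ (x ^ᴷ m) q^ (m * d)
  q^-^ x d zero    = ≋-refl
  q^-^ x d (suc m) = ≋-trans (*-congˡ (x q^ d) (q^-^ x d m)) (q^-* x (x ^ᴷ m) d (m * d))

  -- The operation { }_{qᵖ} and the factors that commute with it.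

  module Filter (p : ℕ) where

    keepFrom-cong : ∀ j {F H} → F ≋ᴾ H → keepFrom p j F ≋ᴾ keepFrom p j H
    keepFrom-cong j {F} {H} F≋H .coeff-≈ d = go j F H (F≋H .coeff-≈) d
      where
      if-cong : ∀ b {x y} → x ≈ y → (if b then x else 0#) ≈ (if b then y else 0#)
      if-cong true  x≈y = x≈y
      if-cong false _   = K.refl

      vanish : ∀ j F → F ≈ᴾ [] → keepFrom p j F ≈ᴾ []
      vanish j []      F≈0 d       = K.refl
      vanish j (x ∷ F) F≈0 zero    with does (p ∣? j)
      ... | true  = F≈0 zero
      ... | false = K.refl
      vanish j (x ∷ F) F≈0 (suc d) = vanish (suc j) F (λ e → F≈0 (suc e)) d

      go : ∀ j F H → F ≈ᴾ H → keepFrom p j F ≈ᴾ keepFrom p j H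
      go j []      H       F≈H d       = K.sym (vanish j H (λ e → K.sym (F≈H e)) d)
      go j (x ∷ F) []      F≈H d       = vanish j (x ∷ F) F≈H d
      go j (x ∷ F) (y ∷ H) F≈H zero    = if-cong (does (p ∣? j)) (F≈H zero)
      go j (x ∷ F) (y ∷ H) F≈H (suc d) = go (suc j) F H (λ e → F≈H (suc e)) d

    keepFrom-+ : ∀ j F H → keepFrom p j (F +ᴾ H) ≋ᴾ keepFrom p j F +ᴾ keepFrom p j H
    keepFrom-+ j []      H       = ≋-refl
    keepFrom-+ j (x ∷ F) []      = ≋-refl
    keepFrom-+ j (x ∷ F) (y ∷ H) with does (p ∣? j)
    ... | true  = ∷-cong K.refl (keepFrom-+ (suc j) F H)
    ... | false = ∷-cong (K.sym (K.+-identityˡ 0#)) (keepFrom-+ (suc j) F H)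

    keepFrom-scale : ∀ j x F → keepFrom p j (scale x F) ≋ᴾ scale x (keepFrom p j F)
    keepFrom-scale j x []      = ≋-refl
    keepFrom-scale j x (y ∷ F) with does (p ∣? j)
    ... | true  = ∷-cong K.refl (keepFrom-scale (suc j) x F)
    ... | false = ∷-cong (K.sym (K.zeroʳ x)) (keepFrom-scale (suc j) x F)

    keepFrom-0∷ : ∀ j F → keepFrom p j (0# ∷ F) ≋ᴾ 0# ∷ keepFrom p (suc j) F
    keepFrom-0∷ j F with does (p ∣? j)
    ... | true  = ≋-refl
    ... | false = ≋-refl

    keepFrom-q^ : ∀ j x d → keepFrom p j (x q^ d) ≋ᴾ (if does (p ∣? (j + d)) then x q^ d else [])
    keepFrom-q^ j x (suc d) = begin
      keepFrom p j (0# ∷ (x q^ d))                                ≈⟨ keepFrom-0∷ j (x q^ d) ⟩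
      0# ∷ keepFrom p (suc j) (x q^ d)                            ≈⟨ ∷-cong K.refl (keepFrom-q^ (suc j) x d) ⟩
      0# ∷ (if does (p ∣? (suc j + d)) then x q^ d else [])       ≈⟨ push (does (p ∣? (suc j + d))) ⟩
      (if does (p ∣? (suc j + d)) then x q^ suc d else [])        ≡⟨ ≡.cong (λ e → if does (p ∣? e) then x q^ suc d else []) (ℕ.+-suc j d) ⟨
      (if does (p ∣? (j + suc d)) then x q^ suc d else [])        ∎
      where
      push : ∀ b → 0# ∷ (if b then x q^ d else []) ≋ᴾ (if b then x q^ suc d else [])
      push true  = ≋-refl
      push false = 0∷[]
    keepFrom-q^ j x zero rewrite ℕ.+-identityʳ j with does (p ∣? j)
    ... | true  = ≋-refl
    ... | false = 0∷[]

    -- Multiplying by a monomial moves every degree by d. Carrying a starting degree in `keepFrom`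
    -- makes this expressible.
    keepFrom-q^-* : ∀ j x d H → keepFrom p j (x q^ d *ᴾ H) ≋ᴾ x q^ d *ᴾ keepFrom p (j + d) H
    keepFrom-q^-* j x (suc d) H = begin
      keepFrom p j ((0# ∷ (x q^ d)) *ᴾ H)            ≈⟨ keepFrom-cong j (0∷-* (x q^ d) H) ⟩
      keepFrom p j (0# ∷ (x q^ d *ᴾ H))              ≈⟨ keepFrom-0∷ j (x q^ d *ᴾ H) ⟩
      0# ∷ keepFrom p (suc j) (x q^ d *ᴾ H)          ≈⟨ ∷-cong K.refl (keepFrom-q^-* (suc j) x d H) ⟩
      0# ∷ (x q^ d *ᴾ keepFrom p (suc j + d) H)      ≡⟨ ≡.cong (λ e → 0# ∷ (x q^ d *ᴾ keepFrom p e H)) (ℕ.+-suc j d) ⟨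
      0# ∷ (x q^ d *ᴾ keepFrom p (j + suc d) H)      ≈⟨ 0∷-* (x q^ d) _ ⟨
      x q^ suc d *ᴾ keepFrom p (j + suc d) H         ∎
    keepFrom-q^-* j x zero H rewrite ℕ.+-identityʳ j = begin
      keepFrom p j ((x ∷ []) *ᴾ H)     ≈⟨ keepFrom-cong j (const-* H) ⟩
      keepFrom p j (scale x H)         ≈⟨ keepFrom-scale j x H ⟩
      scale x (keepFrom p j H)         ≈⟨ const-* (keepFrom p j H) ⟨
      (x ∷ []) *ᴾ keepFrom p j H       ∎
      where
      const-* : ∀ H → (x ∷ []) *ᴾ H ≋ᴾ scale x H
      const-* H = ≋-trans (+.∙-congˡ 0∷[]) (+-identityʳ _)

    -- Divisibility by p does not notice a shift by p. Hence a monomial of degree p passes through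
    -- the filter.
    keepFrom-periodic : ∀ j H → keepFrom p (p + j) H ≡ keepFrom p j H
    keepFrom-periodic j []      = ≡.refl
    keepFrom-periodic j (x ∷ H) = ≡.cong₂ (λ b F → (if b then x else 0#) ∷ F)
      (does-⇔ (mk⇔ (λ p∣p+j → ∣m+n∣m⇒∣n p∣p+j ∣-refl) (∣m∣n⇒∣m+n ∣-refl)) (p ∣? (p + j)) (p ∣? j))
      (≡.trans (≡.cong (λ i → keepFrom p i H) (≡.sym (ℕ.+-suc p j))) (keepFrom-periodic (suc j) H))

    -- Being a polynomial in qᵖ, expressed by its effect on products instead of by vanishing
    -- coefficients. Closure under sums and products is then immediate.
    Transparent : Poly → Set (a ⊔ ℓ)
    Transparent G = ∀ H → ⟨ G *ᴾ H ⟩q^ p ≋ᴾ G *ᴾ ⟨ H ⟩q^ p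

    transparent-resp : ∀ {F G} → F ≋ᴾ G → Transparent F → Transparent G
    transparent-resp {F} {G} F≋G tF H = begin
      ⟨ G *ᴾ H ⟩q^ p   ≈⟨ keepFrom-cong 0 (*-cong F≋G ≋-refl) ⟨
      ⟨ F *ᴾ H ⟩q^ p   ≈⟨ tF H ⟩
      F *ᴾ ⟨ H ⟩q^ p   ≈⟨ *-cong F≋G ≋-refl ⟩
      G *ᴾ ⟨ H ⟩q^ p   ∎

    transparent-1 : Transparent (1# ∷ [])
    transparent-1 = keepFrom-q^-* 0 1# 0

    transparent-+ : ∀ {F G} → Transparent F → Transparent G → Transparent (F +ᴾ G)
    transparent-+ {F} {G} tF tG H = begin
      ⟨ (F +ᴾ G) *ᴾ H ⟩q^ p                 ≈⟨ keepFrom-cong 0 (*-distribʳ H F G) ⟩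
      ⟨ F *ᴾ H +ᴾ G *ᴾ H ⟩q^ p              ≈⟨ keepFrom-+ 0 (F *ᴾ H) (G *ᴾ H) ⟩
      ⟨ F *ᴾ H ⟩q^ p +ᴾ ⟨ G *ᴾ H ⟩q^ p      ≈⟨ +-cong (tF H) (tG H) ⟩
      F *ᴾ ⟨ H ⟩q^ p +ᴾ G *ᴾ ⟨ H ⟩q^ p      ≈⟨ *-distribʳ (⟨ H ⟩q^ p) F G ⟨
      (F +ᴾ G) *ᴾ ⟨ H ⟩q^ p                 ∎

    transparent-* : ∀ {F G} → Transparent F → Transparent G → Transparent (F *ᴾ G)
    transparent-* {F} {G} tF tG H = begin
      ⟨ F *ᴾ G *ᴾ H ⟩q^ p       ≈⟨ keepFrom-cong 0 (*-assoc F G H) ⟩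
      ⟨ F *ᴾ (G *ᴾ H) ⟩q^ p     ≈⟨ tF (G *ᴾ H) ⟩
      F *ᴾ ⟨ G *ᴾ H ⟩q^ p       ≈⟨ *-congˡ F (tG H) ⟩
      F *ᴾ (G *ᴾ ⟨ H ⟩q^ p)     ≈⟨ *-assoc F G _ ⟨
      F *ᴾ G *ᴾ ⟨ H ⟩q^ p       ∎

    transparent-^ : ∀ {F} m → Transparent F → Transparent (F ^ m)
    transparent-^ zero    tF = transparent-1
    transparent-^ {F} (suc m) tF = transparent-* {F} tF (transparent-^ m tF)

    transparent-sum : ∀ m {F : Fin m → Poly} → (∀ i → Transparent (F i)) → Transparent (sum F)
    transparent-sum zero    tF H = ≋-refl
    transparent-sum (suc m) {F} tF = transparent-+ {F zero} (tF zero) (transparent-sum m (λ i → tF (suc i)))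

    transparent-product : ∀ m {F : Fin m → Poly} → (∀ i → Transparent (F i)) → Transparent (product F)
    transparent-product zero    tF = transparent-1
    transparent-product (suc m) {F} tF = transparent-* {F zero} (tF zero) (transparent-product m (λ i → tF (suc i)))

    transparent-q^p : ∀ x → Transparent (x q^ p)
    transparent-q^p x H = ≋-trans (keepFrom-q^-* 0 x p H)
      (*-congˡ (x q^ p) (+.reflexive (≡.trans (≡.cong (λ j → keepFrom p j H) (≡.sym (ℕ.+-identityʳ p))) (keepFrom-periodic 0 H))))

    transparent-geometric : ∀ x m → Transparent (geometric ((x q^ 1) ^ p) m)
    transparent-geometric x m = transparent-sum m (λ i → transparent-^ (toℕ i)
      (transparent-resp (≋-sym (≋-trans (q^-^ x 1 p) (+.reflexive (≡.cong ((x ^ᴷ p) q^_) (ℕ.*-identityʳ p)))))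
        (transparent-q^p (x ^ᴷ p))))

-- Enumeration of cosets

module _ {a ℓ b ℓ′} (A : CommutativeSemiring a ℓ) (S : Setoid b ℓ′) where

  private
    module A = CommutativeSemiring A
    module S = Setoid S
  open ListSum A
  open Membership S using () renaming (_∈_ to _∈ˢ_)

  private
    ∈-─ : ∀ {v x ys} → v ∈ˢ ys → (p : x ∈ˢ ys) → v S.≈ x ⊎ v ∈ˢ (ys ─ p)
    ∈-─ (here v≈y) (here x≈y) = inj₁ (S.trans v≈y (S.sym x≈y))
    ∈-─ (here v≈y) (there p)  = inj₂ (here v≈y)
    ∈-─ (there q)  (here x≈y) = inj₂ q
    ∈-─ (there q)  (there p)  with ∈-─ q p
    ... | inj₁ v≈x = inj₁ v≈x
    ... | inj₂ v∈  = inj₂ (there v∈)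

    ─-∈ : ∀ {v x ys} (p : x ∈ˢ ys) → v ∈ˢ (ys ─ p) → v ∈ˢ ys
    ─-∈ (here _)  v∈         = there v∈
    ─-∈ (there p) (here v≈y) = here v≈y
    ─-∈ (there p) (there v∈) = there (─-∈ p v∈)

    unique-─ : ∀ {x ys} (p : x ∈ˢ ys) → Unique S ys → Unique S (ys ─ p)
    unique-─ (here _)  (_ ∷ ys!) = ys!
    unique-─ (there p) (y∉ ∷ ys!) = All.─⁺ p y∉ ∷ unique-─ p ys!

    ∉-unique : ∀ {y ys v} → All (λ z → ¬ y S.≈ z) ys → v ∈ˢ ys → ¬ v S.≈ y
    ∉-unique (y≉z ∷ _) (here v≈z) v≈y = y≉z (S.trans (S.sym v≈y) v≈z)
    ∉-unique (_ ∷ y∉)  (there v∈) v≈y = ∉-unique y∉ v∈ v≈y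

    ─-∌ : ∀ {v x ys} → Unique S ys → (p : x ∈ˢ ys) → v ∈ˢ (ys ─ p) → ¬ v S.≈ x
    ─-∌ (y∉ ∷ ys!) (here x≈y) v∈         v≈x = ∉-unique y∉ v∈ (S.trans v≈x x≈y)
    ─-∌ (y∉ ∷ ys!) (there p)  (here v≈y) v≈x = ∉-unique y∉ p (S.trans (S.sym v≈x) v≈y)
    ─-∌ (y∉ ∷ ys!) (there p)  (there v∈) v≈x = ─-∌ ys! p v∈ v≈x

  module _ (w : S.Carrier → A.Carrier) (w-cong : ∀ {x y} → x S.≈ y → w x A.≈ w y) where

    private
      ∑-─ : ∀ {x ys} (p : x ∈ˢ ys) → ∑ ys w A.≈ w x A.+ ∑ (ys ─ p) w
      ∑-─ (here x≈y) = A.+-congʳ (w-cong (S.sym x≈y))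
      ∑-─ {x} {y ∷ ys} (there p) = begin
        w y A.+ ∑ ys w                    ≈⟨ A.+-congˡ (∑-─ p) ⟩
        w y A.+ (w x A.+ ∑ (ys ─ p) w)    ≈⟨ x∙yz≈y∙xz _ _ _ ⟩
        w x A.+ (w y A.+ ∑ (ys ─ p) w)    ∎
        where
        open import Relation.Binary.Reasoning.Setoid A.setoid
        open import Algebra.Properties.CommutativeSemigroup A.+-commutativeSemigroup using (x∙yz≈y∙xz)

    -- The head of xs is deleted from ys at the place where its class occurs. Absence of repetitions
    -- in both lists preserves mutual inclusion of the remainders, so no permutation has to be
    -- constructed.
    ∑-unique : ∀ xs ys → Unique S xs → Unique S ys →
      (∀ v → v ∈ˢ xs → v ∈ˢ ys) → (∀ v → v ∈ˢ ys → v ∈ˢ xs) → ∑ xs w A.≈ ∑ ys w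
    ∑-unique []       []       _ _ _ _     = A.refl
    ∑-unique []       (y ∷ ys) _ _ _ ys⊆xs with ys⊆xs y (here S.refl)
    ... | ()
    ∑-unique (x ∷ xs) ys (x∉ ∷ xs!) ys! xs⊆ys ys⊆xs =
      A.trans (A.+-congˡ (∑-unique xs (ys ─ p) xs! (unique-─ p ys!) ⊆ ⊇)) (A.sym (∑-─ p))
      where
      p = xs⊆ys x (here S.refl)
      ⊆ : ∀ v → v ∈ˢ xs → v ∈ˢ (ys ─ p)
      ⊆ v v∈xs with ∈-─ (xs⊆ys v (there v∈xs)) p
      ... | inj₁ v≈x = contradiction v≈x (∉-unique x∉ v∈xs)
      ... | inj₂ v∈  = v∈
      ⊇ : ∀ v → v ∈ˢ (ys ─ p) → v ∈ˢ xs
      ⊇ v v∈ with ys⊆xs v (─-∈ p v∈)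
      ... | here v≈x   = contradiction v≈x (─-∌ ys! p v∈)
      ... | there v∈xs = v∈xs

    ∑-enumeration : ∀ {xs ys} → IsEnumeration S xs → Unique S xs → IsEnumeration S ys → Unique S ys →
                    ∑ xs w A.≈ ∑ ys w
    ∑-enumeration {xs} {ys} xs-all xs! ys-all ys! =
      ∑-unique xs ys xs! ys! (λ v _ → ys-all v) (λ v _ → xs-all v)

-- Every coloured permutation arises exactly once by appending letters.

module Enumeration where

  open ≡ hiding ([_])

  module _ {r n : ℕ} where

    extend-cong : ∀ x t {g h : ColouredPerm r n} → g ≋ h → extend x t g ≋ extend x t h
    extend-cong x t {g} {h} g≋h = colours ⨾ perms
      where
      colours : ∀ i → colour (extend x t g) i ≡ colour (extend x t h) i
      colours i with view i
      ... | ‵fromℕ     = trans (colour-extend-last x t g) (sym (colour-extend-last x t h))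
      ... | ‵inject₁ i = trans (colour-extend-inject₁ x t g i)
                           (trans (colour-≡ g≋h i) (sym (colour-extend-inject₁ x t h i)))
      perms : perm (extend x t g) Perm.≈ perm (extend x t h)
      perms i with view i
      ... | ‵fromℕ     = trans (perm-extend-last x t g) (sym (perm-extend-last x t h))
      ... | ‵inject₁ i = trans (perm-extend-inject₁ x t g i)
                           (trans (cong (punchIn (opposite t)) (perm-≈ g≋h i)) (sym (perm-extend-inject₁ x t h i)))

    extend-injective : ∀ {x t x′ t′} {g h : ColouredPerm r n} → extend x t g ≋ extend x′ t′ h →
                       (x ≡ x′ × t ≡ t′) × g ≋ h
    extend-injective {x} {t} {x′} {t′} {g} {h} e = (x≡x′ , t≡t′) , (colours ⨾ perms)
      where
      x≡x′ = trans (sym (colour-extend-last x t g)) (trans (colour-≡ e (fromℕ n)) (colour-extend-last x′ t′ h))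
      t≡t′ = opposite-injective
        (trans (sym (perm-extend-last x t g)) (trans (perm-≈ e (fromℕ n)) (perm-extend-last x′ t′ h)))
      colours : ∀ i → colour g i ≡ colour h i
      colours i = trans (sym (colour-extend-inject₁ x t g i))
        (trans (colour-≡ e (inject₁ i)) (colour-extend-inject₁ x′ t′ h i))
      perms : perm g Perm.≈ perm h
      perms i = Fin.punchIn-injective (opposite t) _ _
        (trans (sym (perm-extend-inject₁ x t g i)) (trans (perm-≈ e (inject₁ i))
          (trans (perm-extend-inject₁ x′ t′ h i) (cong (λ u → punchIn (opposite u) (perm h ⟨$⟩ʳ i)) (sym t≡t′)))))

    truncate : ColouredPerm r (suc n) → ColouredPerm r n
    truncate g = removeAt (colour g) (fromℕ n) ⨾ Perm.remove (fromℕ n) (perm g)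

    extend-truncate : ∀ g → g ≋ extend (colour g (fromℕ n)) (opposite (perm g ⟨$⟩ʳ fromℕ n)) (truncate g)
    extend-truncate g = colours ⨾ perms
      where
      x = colour g (fromℕ n)
      t = opposite (perm g ⟨$⟩ʳ fromℕ n)
      colours : ∀ i → colour g i ≡ colour (extend x t (truncate g)) i
      colours i with view i
      ... | ‵fromℕ     = sym (colour-extend-last x t (truncate g))
      ... | ‵inject₁ i = trans (cong (colour g) (sym (punchIn-fromℕ i))) (sym (colour-extend-inject₁ x t (truncate g) i))
      perms : perm g Perm.≈ perm (extend x t (truncate g))
      perms i = trans (sym (Perm.insert-remove (fromℕ n) (perm g) i))
        (cong (λ v → Perm.insert (fromℕ n) v (Perm.remove (fromℕ n) (perm g)) ⟨$⟩ʳ i)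
          (sym (Fin.opposite-involutive (perm g ⟨$⟩ʳ fromℕ n))))

  module _ {r : ℕ} .{{_ : NonZero r}} where

    private
      module Γ n = Group (colouredPermGroup r n)

    mutual
      all-complete : ∀ {n} (g : ColouredPerm r n) → ∃ λ g′ → g′ ∈ all n × g ≋ g′
      all-complete {zero}  g = _ , here refl , (λ ()) ⨾ (λ ())
      all-complete {suc n} g = allEndingIn-complete id g (colour g (fromℕ n)) refl

      allEndingIn-complete : ∀ {M n} (f : Fin M → Fin r) (g : ColouredPerm r (suc n)) m →
        f m ≡ colour g (fromℕ n) → ∃ λ g′ → g′ ∈ allEndingIn f n × g ≋ g′
      allEndingIn-complete {n = n} f g m fm≡ with all-complete (truncate g)
      ... | h , h∈ , e = extend (f m) t h
        , ∈-cartesianProductWith⁺ (uncurry (extend ∘ f)) (∈-cartesianProduct⁺ (∈-allFin m) (∈-allFin t)) h∈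
        , subst (λ x → g ≋ extend x t h) (sym fm≡)
            (Γ.trans (suc n) {g} {extend (colour g (fromℕ n)) t (truncate g)} (extend-truncate g) (extend-cong _ t e))
        where t = opposite (perm g ⟨$⟩ʳ fromℕ n)

    -- The relation is left open so that one argument serves both equality in G(r,n) and equality of
    -- cosets.
    allEndingIn-unique : ∀ {n M ℓ} (_~_ : Rel (ColouredPerm r (suc n)) ℓ) → IsEquivalence _~_ → (f : Fin M → Fin r) →
      (∀ {m t m′ t′ g h} → extend (f m) t g ~ extend (f m′) t′ h → (m ≡ m′ × t ≡ t′) × g ≋ h) →
      Unique (Γ.setoid n) (all n) → AllPairs (λ g h → ¬ g ~ h) (allEndingIn f n)
    allEndingIn-unique {n} {M} _~_ ~-equivalence f injective =
      cartesianProductWith⁺ (setoid (Fin M × Fin (suc n))) (Γ.setoid n) (record { isEquivalence = ~-equivalence })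
        (uncurry (extend ∘ f)) (λ e → let (m≡ , t≡) , g≋h = injective e in cong₂ _,_ m≡ t≡ , g≋h)
        (Unique.cartesianProduct⁺ (Unique.allFin⁺ M) (Unique.allFin⁺ (suc n)))

    all-unique : ∀ n → Unique (Γ.setoid n) (all n)
    all-unique zero    = [] ∷ []
    all-unique (suc n) = allEndingIn-unique _≋_ (Γ.isEquivalence (suc n)) id extend-injective (all-unique n)

-- Behaviour of the statistics on cosets of the cyclic group C_s.

module Cosets where

  open ≡ hiding ([_])

  sum-% : ∀ r .{{_ : NonZero r}} {n} (f : Fin n → ℕ) → ℕΣ.sum (λ i → f i % r) % r ≡ ℕΣ.sum f % r
  sum-% r {zero}  f = refl
  sum-% r {suc n} f = begin
    (f zero % r + ℕΣ.sum (λ i → f (suc i) % r)) % r        ≡⟨ %-absorbˡ (f zero) _ ⟩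
    (f zero + ℕΣ.sum (λ i → f (suc i) % r)) % r            ≡⟨ %-absorbʳ (f zero) _ ⟨
    (f zero + ℕΣ.sum (λ i → f (suc i) % r) % r) % r        ≡⟨ cong (λ x → (f zero + x) % r) (sum-% r (f ∘ suc)) ⟩
    (f zero + ℕΣ.sum (f ∘ suc) % r) % r                    ≡⟨ %-absorbʳ (f zero) _ ⟩
    (f zero + ℕΣ.sum (f ∘ suc)) % r                        ∎
    where open ≡-Reasoning

  sum-cong-% : ∀ r .{{_ : NonZero r}} {n} {f g : Fin n → ℕ} → (∀ i → f i % r ≡ g i % r) → ℕΣ.sum f % r ≡ ℕΣ.sum g % r
  sum-cong-% r {f = f} {g} f≡g =
    trans (sym (sum-% r f)) (trans (cong (_% r) (ℕΣ.sum-cong-≗ f≡g)) (sum-% r g))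

  *-cong-% : ∀ r .{{_ : NonZero r}} k {a b} → a % r ≡ b % r → (k * a) % r ≡ (k * b) % r
  *-cong-% r k {a} {b} a≡b = begin
    (k * a) % r                ≡⟨ %-distribˡ-* k a r ⟩
    ((k % r) * (a % r)) % r    ≡⟨ cong (λ x → ((k % r) * x) % r) a≡b ⟩
    ((k % r) * (b % r)) % r    ≡⟨ %-distribˡ-* k b r ⟨
    (k * b) % r                ∎
    where open ≡-Reasoning

  ∣-resp-% : ∀ {p r a b} .{{_ : NonZero r}} → p ∣ r → a % r ≡ b % r → p ∣ a → p ∣ b
  ∣-resp-% {p} p∣r a≡b p∣a = ∣n∣m%n⇒∣m p∣r (subst (p ∣_) a≡b (%-presˡ-∣ p∣a p∣r))

  module _ {r : ℕ} .{{_ : NonZero r}} where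

    -- Elements of C_s add one constant to all colours, so this makes the drops constant on cosets.
    difference-translate : ∀ a {x y x′ y′ : Fin r} → toℕ x′ ≡ (toℕ x + a) % r → toℕ y′ ≡ (toℕ y + a) % r →
                           difference x′ y′ ≡ difference x y
    difference-translate a {x} {y} {x′} {y′} x′≡ y′≡ = difference-unique {x = x′} {y′} (difference<r x y) (begin
      toℕ x′                                  ≡⟨ x′≡ ⟩
      (toℕ x + a) % r                         ≡⟨ cong (λ z → (z + a) % r) (difference-+ x y) ⟨
      ((d + toℕ y) % r + a) % r               ≡⟨ %-absorbˡ (d + toℕ y) a ⟩
      (d + toℕ y + a) % r                     ≡⟨ cong (_% r) (ℕ.+-assoc d (toℕ y) a) ⟩
      (d + (toℕ y + a)) % r                   ≡⟨ %-absorbʳ d (toℕ y + a) ⟨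
      (d + (toℕ y + a) % r) % r               ≡⟨ cong (λ z → (d + z) % r) y′≡ ⟨
      (d + toℕ y′) % r                        ∎)
      where
      open ≡-Reasoning
      d = difference x y

    difference-self : ∀ (x : Fin r) → difference x x ≡ 0
    difference-self x = difference-unique {x = x} {x} (ℕ.≤-<-trans z≤n (Fin.toℕ<n x)) (sym (m<n⇒m%n≡m (Fin.toℕ<n x)))

    difference≡0 : ∀ {x y : Fin r} → difference x y ≡ 0 → x ≡ y
    difference≡0 {x} {y} eq = Fin.toℕ-injective (begin
      toℕ x                          ≡⟨ difference-+ x y ⟨
      (difference x y + toℕ y) % r   ≡⟨ cong (λ d → (d + toℕ y) % r) eq ⟩
      toℕ y % r                      ≡⟨ m<n⇒m%n≡m (Fin.toℕ<n y) ⟩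
      toℕ y                          ∎)
      where open ≡-Reasoning

  module Coset (r s : ℕ) .{{_ : NonZero r}} .{{_ : NonZero s}} (s∣r : s ∣ r) where

    M : ℕ
    M = r / s

    instance
      M≢0 : NonZero M
      M≢0 = /-nonZero s∣r

    M∣r : M ∣ r
    M∣r = m/n∣m s∣r

    M≤r : M ≤ r
    M≤r = m/n≤m r s

    s*M≡r : s * M ≡ r
    s*M≡r = m*[n/m]≡n s∣r

    module _ {n : ℕ} where

      private
        module Γ = Group (colouredPermGroup r n)
        _≈ᶜ_ = _∼_ r s n
        gen^ = generator^_ r s n

      colour-generator^-∙ : ∀ j h i → toℕ (colour (gen^ j ∙ h) i) ≡ (toℕ (colour h i) + j * M) % r
      colour-generator^-∙ j h i = begin
        toℕ ((toℕ (colour h i) + toℕ (colour (gen^ j) (perm h ⟨$⟩ʳ i))) mod r)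
          ≡⟨ toℕ-mod (toℕ (colour h i) + toℕ (colour (gen^ j) (perm h ⟨$⟩ʳ i))) ⟩
        (toℕ (colour h i) + toℕ (colour (gen^ j) (perm h ⟨$⟩ʳ i))) % r
          ≡⟨ cong (λ x → (toℕ (colour h i) + toℕ x) % r) (colour-generator^ r s n j (perm h ⟨$⟩ʳ i)) ⟩
        (toℕ (colour h i) + toℕ ((j * M) mod r)) % r
          ≡⟨ cong (λ x → (toℕ (colour h i) + x) % r) (toℕ-mod (j * M)) ⟩
        (toℕ (colour h i) + (j * M) % r) % r
          ≡⟨ %-absorbʳ (toℕ (colour h i)) (j * M) ⟩
        (toℕ (colour h i) + j * M) % r ∎
        where open ≡-Reasoning

      ∼-colour : ∀ {g h} ((j , e) : g ≈ᶜ h) i → toℕ (colour g i) ≡ (toℕ (colour h i) + j * M) % r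
      ∼-colour {h = h} (j , e) i = trans (cong toℕ (colour-≡ e i)) (colour-generator^-∙ j h i)

      ∼-perm : ∀ {g h} → g ≈ᶜ h → perm g Perm.≈ perm h
      ∼-perm {h = h} (j , e) i = trans (perm-≈ e i) (perm-generator^ r s n j (perm h ⟨$⟩ʳ i))

      ∼-c : ∀ {g h} ((j , e) : g ≈ᶜ h) → c g % r ≡ (c h + n * (j * M)) % r
      ∼-c {g} {h} g∼h@(j , _) = begin
        ℕΣ.sum (λ i → toℕ (colour g i)) % r                    ≡⟨ cong (_% r) (ℕΣ.sum-cong-≗ (∼-colour {g} {h} g∼h)) ⟩
        ℕΣ.sum (λ i → (toℕ (colour h i) + j * M) % r) % r      ≡⟨ sum-% r (λ i → toℕ (colour h i) + j * M) ⟩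
        ℕΣ.sum (λ i → toℕ (colour h i) + j * M) % r            ≡⟨ cong (_% r) (ℕΣ.∑-distrib-+ (λ i → toℕ (colour h i)) (λ _ → j * M)) ⟩
        (c h + ℕΣ.sum {n} (λ _ → j * M)) % r                   ≡⟨ cong (λ x → (c h + x) % r) (sum-const n (j * M)) ⟩
        (c h + n * (j * M)) % r                                ∎
        where open ≡-Reasoning

      -- Another representative changes k·c by k·n·j·(r/s). Since s ∣ kn, this is a multiple of
      -- s·(r/s) = r.
      ∼-k*c : ∀ {k g h} → s ∣ k * n → g ≈ᶜ h → (k * c g) % r ≡ (k * c h) % r
      ∼-k*c {k} {g} {h} s∣kn g∼h@(j , _) = begin
        (k * c g) % r                       ≡⟨ *-cong-% r k (∼-c {g} {h} g∼h) ⟩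
        (k * (c h + n * (j * M))) % r       ≡⟨ cong (_% r) (ℕ.*-distribˡ-+ k (c h) _) ⟩
        (k * c h + k * (n * (j * M))) % r   ≡⟨ %-remove-+ʳ (k * c h) r∣ ⟩
        (k * c h) % r                       ∎
        where
        open ≡-Reasoning
        r∣ : r ∣ k * (n * (j * M))
        r∣ = subst₂ _∣_ s*M≡r (trans (cong (k * n *_) (ℕ.*-comm M j)) (ℕ.*-assoc k n (j * M)))
          (∣-trans (*-monoˡ-∣ M s∣kn) (subst (k * n * M ∣_) (ℕ.*-assoc (k * n) M j) (∣m⇒∣m*n j ∣-refl)))

    module _ {n : ℕ} where

      private
        _≈ᶜ_ = _∼_ r s (suc n)
        gen^ = generator^_ r s (suc n)

      ∼-fmaj : ∀ {g h} → g ≈ᶜ h → ℕΣ.sum (λ-part s s∣r g) ≡ ℕΣ.sum (λ-part s s∣r h)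
      ∼-fmaj {g} {h} g∼h@(j , _) = begin
        ℕΣ.sum (λ-part s s∣r g)
          ≡⟨ fmaj-weight s s∣r g ⟩
        weight g + suc n * (toℕ (colour g (fromℕ n)) % M)
          ≡⟨ cong₂ (λ a b → a + suc n * b) (ℕΣ.sum-cong-≗ λ i → cong (suc (toℕ i) *_) (drop-≡ i)) residue ⟩
        weight h + suc n * (toℕ (colour h (fromℕ n)) % M)
          ≡⟨ fmaj-weight s s∣r h ⟨
        ℕΣ.sum (λ-part s s∣r h) ∎
        where
        open ≡-Reasoning
        col = ∼-colour {g = g} {h} g∼h
        π   = ∼-perm {g = g} {h} g∼h

        δ : ∀ i → difference (colour g (inject₁ i)) (colour g (suc i)) ≡ difference (colour h (inject₁ i)) (colour h (suc i))
        δ i = difference-translate (j * M) (col (inject₁ i)) (col (suc i))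

        drop-≡ : ∀ i → drop g i ≡ drop h i
        drop-≡ i = cong₂ (λ a b → r * a + b)
          -- Only differences of colours are known to agree, so equality of neighbouring colours is
          -- read as a vanishing difference.
          (indicator-⇔ (mk⇔
            (λ (p , q) → difference≡0 (trans (sym (δ i)) (trans (cong (λ x → difference x (colour g (suc i))) p) (difference-self (colour g (suc i)))))
                       , subst₂ Fin._<_ (π (suc i)) (π (inject₁ i)) q)
            (λ (p , q) → difference≡0 (trans (δ i) (trans (cong (λ x → difference x (colour h (suc i))) p) (difference-self (colour h (suc i)))))
                       , subst₂ Fin._<_ (sym (π (suc i))) (sym (π (inject₁ i))) q))
            (HDes? g i) (HDes? h i))
          (δ i)

        residue : toℕ (colour g (fromℕ n)) % M ≡ toℕ (colour h (fromℕ n)) % M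
        residue = begin
          toℕ (colour g (fromℕ n)) % M                     ≡⟨ cong (_% M) (col (fromℕ n)) ⟩
          (toℕ (colour h (fromℕ n)) + j * M) % r % M       ≡⟨ m∣n⇒o%n%m≡o%m M r _ M∣r ⟩
          (toℕ (colour h (fromℕ n)) + j * M) % M           ≡⟨ [m+kn]%n≡m%n (toℕ (colour h (fromℕ n))) j M ⟩
          toℕ (colour h (fromℕ n)) % M                     ∎

      representative : ∀ g → ∃ λ h → h ≈ᶜ g × toℕ (colour h (fromℕ n)) < M
      -- The quotient t counts the multiples of M to be removed from the last colour. Modulo r =
      -- s·M, removing t of them means adding s - t.
      representative g = gen^ (s ∸ t) ∙ g , (s ∸ t , Γ.refl) , subst (_< M) (sym last-colour) (m%n<n x M)
        where
        open ≡-Reasoning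
        module Γ = Group (colouredPermGroup r (suc n))
        x = toℕ (colour g (fromℕ n))
        t = x / M
        t≤s : t ≤ s
        t≤s = ℕ.<⇒≤ (m<n*o⇒m/o<n {n = s} (subst (x <_) (sym s*M≡r) (Fin.toℕ<n (colour g (fromℕ n)))))
        last-colour : toℕ (colour (gen^ (s ∸ t) ∙ g) (fromℕ n)) ≡ x % M
        last-colour = begin
          toℕ (colour (gen^ (s ∸ t) ∙ g) (fromℕ n))     ≡⟨ colour-generator^-∙ (s ∸ t) g (fromℕ n) ⟩
          (x + (s ∸ t) * M) % r                         ≡⟨ cong (λ z → (z + (s ∸ t) * M) % r) (m≡m%n+[m/n]*n x M) ⟩
          (x % M + t * M + (s ∸ t) * M) % r             ≡⟨ cong (_% r) (ℕ.+-assoc (x % M) _ _) ⟩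
          (x % M + (t * M + (s ∸ t) * M)) % r           ≡⟨ cong (λ z → (x % M + z) % r) (ℕ.*-distribʳ-+ M t (s ∸ t)) ⟨
          (x % M + (t + (s ∸ t)) * M) % r               ≡⟨ cong (λ z → (x % M + z * M) % r) (ℕ.m+[n∸m]≡n t≤s) ⟩
          (x % M + s * M) % r                           ≡⟨ cong (λ z → (x % M + z) % r) s*M≡r ⟩
          (x % M + r) % r                               ≡⟨ [m+n]%n≡m%n (x % M) r ⟩
          x % M % r                                     ≡⟨ m<n⇒m%n≡m (ℕ.<-≤-trans (m%n<n x M) M≤r) ⟩
          x % M                                         ∎

      -- Elements of a coset have last colours congruent modulo M, hence equal when both are below
      -- M. The common shift of all colours is then 0 modulo r.
      ∼⇒≋ : ∀ {g h} → g ≈ᶜ h → toℕ (colour g (fromℕ n)) < M → toℕ (colour h (fromℕ n)) < M → g ≋ h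
      ∼⇒≋ {g} {h} g∼h@(j , _) x<M y<M = colours ⨾ ∼-perm {g = g} {h} g∼h
        where
        open ≡-Reasoning
        col = ∼-colour {g = g} {h} g∼h
        y = colour h (fromℕ n)
        x≡y : colour g (fromℕ n) ≡ y
        x≡y = Fin.toℕ-injective (begin
          toℕ (colour g (fromℕ n))          ≡⟨ m<n⇒m%n≡m x<M ⟨
          toℕ (colour g (fromℕ n)) % M      ≡⟨ cong (_% M) (col (fromℕ n)) ⟩
          (toℕ y + j * M) % r % M           ≡⟨ m∣n⇒o%n%m≡o%m M r _ M∣r ⟩
          (toℕ y + j * M) % M               ≡⟨ [m+kn]%n≡m%n (toℕ y) j M ⟩
          toℕ y % M                         ≡⟨ m<n⇒m%n≡m y<M ⟩
          toℕ y                             ∎)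
        shift≡0 : (j * M) % r ≡ 0
        shift≡0 = trans (sym (difference-unique {x = y} {y} (m%n<n (j * M) r) (begin
          toℕ y                             ≡⟨ cong toℕ x≡y ⟨
          toℕ (colour g (fromℕ n))          ≡⟨ col (fromℕ n) ⟩
          (toℕ y + j * M) % r               ≡⟨ cong (_% r) (ℕ.+-comm (toℕ y) (j * M)) ⟩
          (j * M + toℕ y) % r               ≡⟨ %-absorbˡ (j * M) (toℕ y) ⟨
          ((j * M) % r + toℕ y) % r         ∎))) (difference-self y)
        colours : ∀ i → colour g i ≡ colour h i
        colours i = Fin.toℕ-injective (begin
          toℕ (colour g i)                         ≡⟨ col i ⟩
          (toℕ (colour h i) + j * M) % r           ≡⟨ %-absorbʳ (toℕ (colour h i)) (j * M) ⟨
          (toℕ (colour h i) + (j * M) % r) % r     ≡⟨ cong (λ z → (toℕ (colour h i) + z) % r) shift≡0 ⟩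
          (toℕ (colour h i) + 0) % r               ≡⟨ cong (_% r) (ℕ.+-identityʳ _) ⟩
          toℕ (colour h i) % r                     ≡⟨ m<n⇒m%n≡m (Fin.toℕ<n (colour h i)) ⟩
          toℕ (colour h i)                         ∎)

      -- Going down from the last position, the residues added to k telescope to differences of
      -- colours, so k lifts the colours once it does so at the end. The bound on the last colour
      -- ensures this; otherwise a common multiple of M would be missing.
      k-part-% : ∀ {n} (col : Fin (suc n) → Fin r) → toℕ (col (fromℕ n)) < M → ∀ i → k-part s s∣r col i % r ≡ toℕ (col i)
      k-part-% {zero}  col x<M zero    = trans (cong (_% r) (m<n⇒m%n≡m x<M)) (m<n⇒m%n≡m (Fin.toℕ<n (col zero)))
      k-part-% {suc n} col x<M zero    = begin
        (k-part s s∣r (col ∘ suc) zero + d) % r         ≡⟨ %-absorbˡ (k-part s s∣r (col ∘ suc) zero) d ⟨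
        (k-part s s∣r (col ∘ suc) zero % r + d) % r     ≡⟨ cong (λ z → (z + d) % r) (k-part-% (col ∘ suc) x<M zero) ⟩
        (toℕ (col (suc zero)) + d) % r                  ≡⟨ cong (_% r) (ℕ.+-comm (toℕ (col (suc zero))) d) ⟩
        (d + toℕ (col (suc zero))) % r                  ≡⟨ difference-+ (col zero) (col (suc zero)) ⟩
        toℕ (col zero)                                  ∎
        where
        open ≡-Reasoning
        d = difference (col zero) (col (suc zero))
      k-part-% {suc n} col x<M (suc i) = k-part-% (col ∘ suc) x<M i

      fmaj≡c-% : ∀ (g : ColouredPerm r (suc n)) → toℕ (colour g (fromℕ n)) < M → ℕΣ.sum (λ-part s s∣r g) % r ≡ c g % r
      fmaj≡c-% g x<M = sum-cong-% r λ i → begin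
        (r * h-part g i + k-part s s∣r (colour g) i) % r   ≡⟨ %-remove-+ˡ (k-part s s∣r (colour g) i) (∣m⇒∣m*n (h-part g i) ∣-refl) ⟩
        k-part s s∣r (colour g) i % r                      ≡⟨ k-part-% (colour g) x<M i ⟩
        toℕ (colour g i)                                   ≡⟨ m<n⇒m%n≡m (Fin.toℕ<n (colour g i)) ⟨
        toℕ (colour g i) % r                               ∎
        where open ≡-Reasoning

open Enumeration
open Cosets

-- Passing from lists in G(r,n) to lists in G(r,p,n).

module _ (r p s n : ℕ) .{{_ : NonZero r}} .{{_ : NonZero s}} where

  module _ {a ℓ} (A : CommutativeSemiring a ℓ) where

    open CommutativeSemiring A using (Carrier; _≈_; 0#; refl; sym; trans; +-congˡ; +-identityˡ)
    open ListSum A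

    ∑-restrict : (w : ColouredPerm r n → Carrier) (gs : List (ColouredPerm r n)) →
      ∑ (restrict r p s n gs) (w ∘ element) ≈ ∑ gs (λ g → if does (p ∣? c g) then w g else 0#)
    ∑-restrict w []       = refl
    ∑-restrict w (g ∷ gs) with p ∣? c g
    ... | yes _ = +-congˡ (∑-restrict w gs)
    ... | no  _ = trans (∑-restrict w gs) (sym (+-identityˡ _))

  restrict-allPairs : ∀ {ℓ} {_~_ : Rel (ColouredPerm r n) ℓ} {gs} → AllPairs _~_ gs →
    AllPairs (λ g h → element g ~ element h) (restrict r p s n gs)
  restrict-allPairs [] = []
  restrict-allPairs {_~_ = _~_} {g ∷ gs} (g~ ∷ gs~) with p ∣? c g
  ... | yes _ = restrict-all g~ ∷ restrict-allPairs gs~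
    where
    restrict-all : ∀ {gs} → All (g ~_) gs → All (λ h → g ~ element h) (restrict r p s n gs)
    restrict-all [] = []
    restrict-all {h ∷ _} (g~h ∷ g~) with p ∣? c h
    ... | yes _ = g~h ∷ restrict-all g~
    ... | no  _ = restrict-all g~
  ... | no  _ = restrict-allPairs gs~

-- A transversal of the cosets of C_s in G(r,p,n).

module Representatives (r p s n : ℕ) .{{_ : NonZero r}} .{{_ : NonZero s}}
  (p∣r : p ∣ r) (s∣r : s ∣ r) (ps∣rn : p * s ∣ r * suc n) where

  open Coset r s s∣r
  private module Γ = Group (colouredPermGroup r (suc n))

  lastColour : Fin M → Fin r
  lastColour m = inject≤ m M≤r

  cosetRepresentatives : List (G r p (suc n))
  cosetRepresentatives = restrict r p s (suc n) (allEndingIn lastColour n)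

  -- The inclusion of C_s in G(r,p,n): up to multiples of r, the colour sum of the generator is M
  -- times the number of letters.
  p∣M*n : p ∣ M * suc n
  p∣M*n = *-cancelʳ-∣ s (subst (p * s ∣_) eq ps∣rn)
    where
    eq : r * suc n ≡ M * suc n * s
    eq = ≡.trans (cong (_* suc n) (≡.trans (≡.sym s*M≡r) (ℕ.*-comm s M)))
      (≡.trans (ℕ.*-assoc M s (suc n)) (≡.trans (cong (M *_) (ℕ.*-comm s (suc n))) (≡.sym (ℕ.*-assoc M (suc n) s))))

  -- The representative with small last colour is constructed in G(r,n); this keeps it in G(r,p,n).
  ∼-∣c : ∀ {g h} → _∼_ r s (suc n) g h → p ∣ c h → p ∣ c g
  ∼-∣c {g} {h} g∼h@(j , _) p∣ch = ∣-resp-% p∣r (≡.sym (∼-c {g = g} {h} g∼h)) (∣m∣n⇒∣m+n p∣ch p∣shift)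
    where
    p∣shift : p ∣ suc n * (j * M)
    p∣shift = subst (p ∣_) (≡.trans (cong (_* j) (ℕ.*-comm M (suc n)))
      (≡.trans (ℕ.*-assoc (suc n) M j) (cong (suc n *_) (ℕ.*-comm M j)))) (∣m⇒∣m*n j p∣M*n)

  toℕ-lastColour : ∀ m t (g : ColouredPerm r n) → toℕ (colour (extend (lastColour m) t g) (fromℕ n)) ≡ toℕ m
  toℕ-lastColour m t g = ≡.trans (cong toℕ (colour-extend-last (lastColour m) t g)) (Fin.toℕ-inject≤ m M≤r)

  cosetRepresentatives-complete : IsEnumeration (quotient r p s (suc n)) cosetRepresentatives
  cosetRepresentatives-complete g with representative (element g)
  ... | h , h∼g , x<M with allEndingIn-complete lastColour h (fromℕ< x<M)
        (Fin.toℕ-injective (≡.trans (Fin.toℕ-inject≤ _ M≤r) (Fin.toℕ-fromℕ< x<M)))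
  ... | h′ , h′∈ , h≋h′ = Any.map (λ { ≡.refl → g∼h′ }) (restrict-∈ r p s (suc n) p∣ch′ h′∈)
    where
    g∼h′ : _∼_ r s (suc n) (element g) h′
    g∼h′ = ∼-trans r s (suc n) {element g} {h} {h′} (∼-sym r s (suc n) {h} {element g} h∼g)
      (0 , Γ.trans h≋h′ (Γ.sym (Γ.identityˡ h′)))
    p∣ch′ : p ∣ c h′
    p∣ch′ = ∼-∣c {h′} {element g} (∼-sym r s (suc n) {element g} {h′} g∼h′) (p∣c g)

  cosetRepresentatives-unique : Unique (quotient r p s (suc n)) cosetRepresentatives
  cosetRepresentatives-unique = restrict-allPairs r p s (suc n) {_~_ = λ g h → ¬ _∼_ r s (suc n) g h}
    (allEndingIn-unique (_∼_ r s (suc n)) ∼-equivalence lastColour injective (all-unique n))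
    where
    ∼-equivalence : IsEquivalence (_∼_ r s (suc n))
    ∼-equivalence = record
      { refl  = λ {g} → ∼-refl r s (suc n) {g}
      ; sym   = λ {g} {h} → ∼-sym r s (suc n) {g} {h}
      ; trans = λ {g} {h} {k} → ∼-trans r s (suc n) {g} {h} {k}
      }
    injective : ∀ {m t m′ t′ g h} → _∼_ r s (suc n) (extend (lastColour m) t g) (extend (lastColour m′) t′ h) →
                (m ≡ m′ × t ≡ t′) × g ≋ h
    injective {m} {t} {m′} {t′} {g} {h} e =
      let (m≡ , t≡) , g≋h = extend-injective (∼⇒≋ {g = extend (lastColour m) t g} {extend (lastColour m′) t′ h} e
            (subst (_< M) (≡.sym (toℕ-lastColour m t g)) (Fin.toℕ<n m))
            (subst (_< M) (≡.sym (toℕ-lastColour m′ t′ h)) (Fin.toℕ<n m′)))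
      in (Fin.inject≤-injective M≤r M≤r m m′ m≡ , t≡) , g≋h

-- The sum over the quotient as a filtered product, and its factorisation.

module Enumerator {a ℓ} (K : CommutativeRing a ℓ) (r p s n : ℕ)
  .{{_ : NonZero r}} .{{_ : NonZero p}} .{{_ : NonZero s}}
  (p∣r : p ∣ r) (s∣r : s ∣ r) (ps∣rn : p * s ∣ r * suc n)
  (ε : CommutativeRing.Carrier K) (ε² : CommutativeRing._≈_ K (CommutativeRing._*_ K ε ε) (CommutativeRing.1# K))
  (ζ : CommutativeRing.Carrier K) (ζ^r≈1 : CommutativeRing._≈_ K (OverRing._^ᴷ_ K ζ r) (CommutativeRing.1# K))
  (k : ℕ) (s∣kn : s ∣ k * suc n) where

  open OverRing K
  open PolynomialSemiring K
  open Filter p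
  open Coset r s s∣r
  open Representatives r p s n p∣r s∣r ps∣rn
  private
    module K = CommutativeRing K
    module Kˣ = Exp K.commutativeSemiring
    module Pˣ = Exp commutativeSemiring
    module P = CommutativeSemiring commutativeSemiring
    module PΠ = MonoidSum P.*-commutativeMonoid
  open PΠ using () renaming (sum to product)
  open Pˣ using (_^_)
  open SemiringSum P.semiring using (sum; sum-cong-≋)
  open ListSum commutativeSemiring
  open GeometricSum commutativeSemiring
  open RootOfUnity K.commutativeSemiring using (^-cong-%)
  open WeightedCount commutativeSemiring r
  open import Relation.Binary.Reasoning.Setoid P.setoid

  e y : Poly
  e = ε q^ 0
  y = (ζ ^ᴷ k) q^ 1

  e² : e *ᴾ e ≋ᴾ 1# ∷ []
  e² = P.trans (q^-* ε ε 0 0) (q^-cong 0 ε²)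

  fmajᵣ : ColouredPerm r (suc n) → ℕ
  fmajᵣ g = ℕΣ.sum (λ-part s s∣r g)

  term : ColouredPerm r (suc n) → Poly
  term g = (ε ^ᴷ inv (perm g) *ᴷ ζ ^ᴷ (k * c g)) q^ fmajᵣ g

  term-cong : ∀ {g h} → _∼_ r s (suc n) g h → term g ≋ᴾ term h
  term-cong {g} {h} g∼h = P.trans
    (q^-cong (fmajᵣ g) (K.*-cong (K.reflexive (cong (ε ^ᴷ_) (inv-cong {σ = perm g} {perm h} (∼-perm {g = g} {h} g∼h))))
                                 (^-cong-% ζ^r≈1 (∼-k*c {k = k} {g} {h} s∣kn g∼h))))
    (P.reflexive (cong ((ε ^ᴷ inv (perm h) *ᴷ ζ ^ᴷ (k * c h)) q^_) (∼-fmaj {g = g} {h} g∼h)))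

  module _ (m : Fin M) (t : Fin (suc n)) (g : ColouredPerm r n) where

    private
      g′ = extend (lastColour m) t g
      F  = fmajᵣ g′
      last<M : toℕ (colour g′ (fromℕ n)) < M
      last<M = subst (_< M) (≡.sym (toℕ-lastColour m t g)) (Fin.toℕ<n m)

    fmaj-extend : F ≡ weight g′ + suc n * toℕ m
    fmaj-extend = ≡.trans (fmaj-weight s s∣r g′)
      (cong (λ x → weight g′ + suc n * x) (≡.trans (m<n⇒m%n≡m last<M) (toℕ-lastColour m t g)))

    term-extend : term g′ ≋ᴾ signedWeight e y e² g′ *ᴾ y ^ (suc n * toℕ m)
    term-extend = P.sym (begin
      e ^ i *ᴾ y ^ weight g′ *ᴾ y ^ (suc n * toℕ m)
        ≈⟨ P.*-assoc (e ^ i) (y ^ weight g′) _ ⟩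
      e ^ i *ᴾ (y ^ weight g′ *ᴾ y ^ (suc n * toℕ m))
        ≈⟨ P.*-congˡ {e ^ i} (Pˣ.^-homo-* y (weight g′) (suc n * toℕ m)) ⟨
      e ^ i *ᴾ y ^ (weight g′ + suc n * toℕ m)
        ≡⟨ cong (λ f → e ^ i *ᴾ y ^ f) fmaj-extend ⟨
      e ^ i *ᴾ y ^ F
        ≈⟨ P.*-cong (q^-^ ε 0 i) (q^-^ (ζ ^ᴷ k) 1 F) ⟩
      (ε ^ᴷ i) q^ (i * 0) *ᴾ ((ζ ^ᴷ k) ^ᴷ F) q^ (F * 1)
        ≡⟨ cong₂ (λ d d′ → (ε ^ᴷ i) q^ d *ᴾ ((ζ ^ᴷ k) ^ᴷ F) q^ d′) (ℕ.*-zeroʳ i) (ℕ.*-identityʳ F) ⟩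
      (ε ^ᴷ i) q^ 0 *ᴾ ((ζ ^ᴷ k) ^ᴷ F) q^ F
        ≈⟨ q^-* (ε ^ᴷ i) ((ζ ^ᴷ k) ^ᴷ F) 0 F ⟩
      (ε ^ᴷ i *ᴷ (ζ ^ᴷ k) ^ᴷ F) q^ F
        -- The exponents k·fmaj and k·c of ζ agree modulo r for this representative.
        ≈⟨ q^-cong F (K.*-congˡ (K.trans (Kˣ.^-assocʳ ζ k F) (^-cong-% ζ^r≈1 (*-cong-% r k (fmaj≡c-% g′ last<M))))) ⟩
      term g′ ∎)
      where i = inv (perm g′)

    -- The condition on colours becomes one on degrees, and the filter, being additive, can then be
    -- moved outside all the sums.
    filtered-term : (if does (p ∣? c g′) then term g′ else []) ≋ᴾ
                    ⟨ signedWeight e y e² g′ *ᴾ y ^ (suc n * toℕ m) ⟩q^ p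
    filtered-term = begin
      (if does (p ∣? c g′) then term g′ else [])
        ≡⟨ cong (λ b → if b then term g′ else []) (does-⇔ (mk⇔ (∣-resp-% p∣r (≡.sym F≡c)) (∣-resp-% p∣r F≡c)) (p ∣? c g′) (p ∣? F)) ⟩
      (if does (p ∣? F) then term g′ else [])
        ≈⟨ keepFrom-q^ 0 _ F ⟨
      ⟨ term g′ ⟩q^ p
        ≈⟨ keepFrom-cong 0 term-extend ⟩
      ⟨ signedWeight e y e² g′ *ᴾ y ^ (suc n * toℕ m) ⟩q^ p ∎
      where F≡c = fmaj≡c-% g′ last<M

  ⟨⟩-∑ : ∀ {b} {B : Set b} (xs : List B) f → ⟨ ∑ xs f ⟩q^ p ≋ᴾ ∑ xs (λ x → ⟨ f x ⟩q^ p)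
  ⟨⟩-∑ []       f = P.refl
  ⟨⟩-∑ (x ∷ xs) f = P.trans (keepFrom-+ 0 (f x) (∑ xs f)) (P.+-congˡ {⟨ f x ⟩q^ p} (⟨⟩-∑ xs f))

  ⟨⟩-sum : ∀ {m} (f : Fin m → Poly) → ⟨ sum f ⟩q^ p ≋ᴾ sum (λ i → ⟨ f i ⟩q^ p)
  ⟨⟩-sum {zero}  f = P.refl
  ⟨⟩-sum {suc m} f = P.trans (keepFrom-+ 0 (f zero) (sum (f ∘ suc))) (P.+-congˡ {⟨ f zero ⟩q^ p} (⟨⟩-sum (f ∘ suc)))

  sumOver-quotient : (gs : List (G r p (suc n))) → IsEnumeration (quotient r p s (suc n)) gs → Unique (quotient r p s (suc n)) gs →
    sumOver gs (term ∘ element) ≋ᴾ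
    ⟨ product (λ (i : Fin n) → factor e y e² (toℕ i)) *ᴾ geometric (signedVariable e y e² n) (suc n * M) ⟩q^ p
  sumOver-quotient gs gs-all gs! = begin
    sumOver gs (term ∘ element)
      ≈⟨ ∑-enumeration commutativeSemiring (quotient r p s (suc n)) (term ∘ element)
           (λ {g} {h} → term-cong {element g} {element h}) gs-all gs! cosetRepresentatives-complete cosetRepresentatives-unique ⟩
    ∑ cosetRepresentatives (term ∘ element)
      ≈⟨ ∑-restrict r p s (suc n) commutativeSemiring term (allEndingIn lastColour n) ⟩
    ∑ (allEndingIn lastColour n) (λ g → if does (p ∣? c g) then term g else [])
      ≈⟨ ∑-allEndingIn lastColour n (λ g → if does (p ∣? c g) then term g else []) ⟩
    sum (λ m → sum (λ t → ∑ (all n) (λ g → if does (p ∣? c (extend (lastColour m) t g)) then term (extend (lastColour m) t g) else [])))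
      ≈⟨ sum-cong-≋ (λ m → sum-cong-≋ (λ t → P.trans (∑-cong (all n) (filtered-term m t)) (P.sym (⟨⟩-∑ (all n) (W m t))))) ⟩
    sum (λ m → sum (λ t → ⟨ ∑ (all n) (W m t) ⟩q^ p))
      ≈⟨ sum-cong-≋ (λ m → ⟨⟩-sum (λ t → ∑ (all n) (W m t))) ⟨
    sum (λ m → ⟨ sum (λ t → ∑ (all n) (W m t)) ⟩q^ p)
      ≈⟨ ⟨⟩-sum (λ m → sum (λ t → ∑ (all n) (W m t))) ⟨
    ⟨ sum (λ m → sum (λ t → ∑ (all n) (W m t))) ⟩q^ p
      ≈⟨ keepFrom-cong 0 (sum-allEndingIn e y e² lastColour n) ⟩
    _ ∎
    where
    W : Fin M → Fin (suc n) → ColouredPerm r n → Poly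
    W m t g = signedWeight e y e² (extend (lastColour m) t g) *ᴾ y ^ (suc n * toℕ m)

  variableᴾ : ℕ → Poly
  variableᴾ i = (ε ^ᴷ i *ᴷ ζ ^ᴷ k) q^ 1

  signedVariable≋ : ∀ i → signedVariable e y e² i ≋ᴾ variableᴾ i
  signedVariable≋ i = begin
    e ^ i *ᴾ y                            ≈⟨ P.*-congʳ {y} (q^-^ ε 0 i) ⟩
    (ε ^ᴷ i) q^ (i * 0) *ᴾ y               ≡⟨ cong (λ d → (ε ^ᴷ i) q^ d *ᴾ y) (ℕ.*-zeroʳ i) ⟩
    (ε ^ᴷ i) q^ 0 *ᴾ y                     ≈⟨ q^-* (ε ^ᴷ i) (ζ ^ᴷ k) 0 1 ⟩
    variableᴾ i                            ∎

  geometric-split : ∀ i m → geometric (signedVariable e y e² i) (m * p) ≋ᴾ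
                            geometric (variableᴾ i ^ p) m *ᴾ geometric (variableᴾ i) p
  geometric-split i m = begin
    geometric (signedVariable e y e² i) (m * p)     ≈⟨ geometric-cong (m * p) (signedVariable≋ i) ⟩
    geometric (variableᴾ i) (m * p)                 ≈⟨ geometric-* (variableᴾ i) m p ⟩
    geometric (variableᴾ i) p *ᴾ geometric (variableᴾ i ^ p) m  ≈⟨ P.*-comm (geometric (variableᴾ i) p) _ ⟩
    geometric (variableᴾ i ^ p) m *ᴾ geometric (variableᴾ i) p  ∎

  variableᴾ-periodic : ∀ i → variableᴾ (suc (suc i)) ≋ᴾ variableᴾ i
  variableᴾ-periodic i = q^-cong 1 (K.*-congʳ (K.trans (K.sym (K.*-assoc ε ε _)) (K.trans (K.*-congʳ ε²) (K.*-identityˡ _))))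

  geometric-periodic : ∀ i → geometric (variableᴾ (suc (suc i))) p ≋ᴾ geometric (variableᴾ i) p
  geometric-periodic i = geometric-cong p (variableᴾ-periodic i)

  open CommutativeSemigroupProperties P.*-commutativeSemigroup using (interchange; x∙yz≈y∙xz)

  product-alternating : ∀ N → product (λ (i : Fin N) → geometric (variableᴾ (toℕ i)) p) ≋ᴾ
    (geometric (variableᴾ 0) p) ^ ⌈ N /2⌉ *ᴾ (geometric (variableᴾ 1) p) ^ ⌊ N /2⌋
  product-alternating 0 = P.sym (P.*-identityˡ _)
  product-alternating 1 = P.sym (P.*-identityʳ _)
  product-alternating (suc (suc N)) = begin
    A *ᴾ (B *ᴾ product (λ (i : Fin N) → geometric (variableᴾ (suc (suc (toℕ i)))) p))
      ≈⟨ P.*-congˡ {A} (P.*-congˡ {B} (PΠ.sum-cong-≋ {N} (λ i → geometric-periodic (toℕ i)))) ⟩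
    A *ᴾ (B *ᴾ product (λ (i : Fin N) → geometric (variableᴾ (toℕ i)) p))
      ≈⟨ P.*-congˡ {A} (P.*-congˡ {B} (product-alternating N)) ⟩
    A *ᴾ (B *ᴾ (A ^ ⌈ N /2⌉ *ᴾ B ^ ⌊ N /2⌋))
      ≈⟨ P.*-congˡ {A} (x∙yz≈y∙xz B (A ^ ⌈ N /2⌉) (B ^ ⌊ N /2⌋)) ⟩
    A *ᴾ (A ^ ⌈ N /2⌉ *ᴾ (B *ᴾ B ^ ⌊ N /2⌋))
      ≈⟨ P.*-assoc A (A ^ ⌈ N /2⌉) _ ⟨
    A ^ suc ⌈ N /2⌉ *ᴾ B ^ suc ⌊ N /2⌋ ∎
    where
    A = geometric (variableᴾ 0) p
    B = geometric (variableᴾ 1) p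

  private instance
    ps≢0 : NonZero (p * s)
    ps≢0 = ℕ.m*n≢0 p s

  -- The length of the last bracket is a multiple of p because ps divides rn, so [p] splits off from
  -- it as from the others.
  [n*M]≡ : suc n * M ≡ (suc n * r) / (p * s) * p
  [n*M]≡ = ℕ.*-cancelʳ-≡ (suc n * M) _ s (≡.trans (ℕ.*-assoc (suc n) M s)
    (≡.trans (cong (suc n *_) (≡.trans (ℕ.*-comm M s) s*M≡r))
      (≡.sym (≡.trans (ℕ.*-assoc ((suc n * r) / (p * s)) p s) (m/n*n≡m (subst (p * s ∣_) (ℕ.*-comm r (suc n)) ps∣rn))))))

  quotients : Poly
  quotients = product (λ (i : Fin n) → geometric (variableᴾ (toℕ i) ^ p) ((suc (toℕ i) * r) / p))
    *ᴾ geometric (variableᴾ n ^ p) ((suc n * r) / (p * s))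

  residual : Poly
  residual = geometric ((ζ ^ᴷ k) q^ 1) p ^ (suc n ∸ ⌊ suc n /2⌋) *ᴾ geometric ((ε *ᴷ ζ ^ᴷ k) q^ 1) p ^ ⌊ suc n /2⌋

  quotients-transparent : Transparent quotients
  quotients-transparent =
    transparent-* {product (λ (i : Fin n) → A (toℕ i) ((suc (toℕ i) * r) / p))} {A n ((suc n * r) / (p * s))}
      (transparent-product n (λ i → transparent-geometric (ε ^ᴷ toℕ i *ᴷ ζ ^ᴷ k) ((suc (toℕ i) * r) / p)))
      (transparent-geometric (ε ^ᴷ n *ᴷ ζ ^ᴷ k) ((suc n * r) / (p * s)))
    where
    A : ℕ → ℕ → Poly
    A i = geometric (variableᴾ i ^ p)

  product-factorisation : product (λ (i : Fin n) → factor e y e² (toℕ i)) *ᴾ geometric (signedVariable e y e² n) (suc n * M) ≋ᴾ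
                          quotients *ᴾ residual
  product-factorisation = begin
    product (λ (i : Fin n) → factor e y e² (toℕ i)) *ᴾ geometric (signedVariable e y e² n) (suc n * M)
      ≈⟨ P.*-cong (PΠ.sum-cong-≋ {n} split-factor)
           (P.trans (P.reflexive (cong (geometric (signedVariable e y e² n)) [n*M]≡)) (geometric-split n ((suc n * r) / (p * s)))) ⟩
    product (λ (i : Fin n) → A (toℕ i) *ᴾ B (toℕ i)) *ᴾ (Aₙ *ᴾ B n)
      ≈⟨ P.*-congʳ {Aₙ *ᴾ B n} (PΠ.∑-distrib-+ {n} (λ i → A (toℕ i)) (λ i → B (toℕ i))) ⟩
    product (λ (i : Fin n) → A (toℕ i)) *ᴾ product (λ (i : Fin n) → B (toℕ i)) *ᴾ (Aₙ *ᴾ B n)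
      -- Gathers the brackets in the p-th powers, which pass through the filter, apart from the
      -- brackets [p], which remain inside.
      ≈⟨ interchange (product (λ (i : Fin n) → A (toℕ i))) _ Aₙ _ ⟩
    quotients *ᴾ (product (λ (i : Fin n) → B (toℕ i)) *ᴾ B n)
      ≈⟨ P.*-congˡ {quotients} (P.trans (P.reflexive (cong₂ _*ᴾ_
           (PΠ.sum-cong-≗ {n} (λ i → cong B (≡.sym (Fin.toℕ-inject₁ i)))) (cong B (≡.sym (Fin.toℕ-fromℕ n)))))
           (P.sym (PΠ.sum-init-last (λ (i : Fin (suc n)) → B (toℕ i))))) ⟩
    quotients *ᴾ product (λ (i : Fin (suc n)) → B (toℕ i))
      ≈⟨ P.*-congˡ {quotients} (product-alternating (suc n)) ⟩
    quotients *ᴾ (B 0 ^ ⌈ suc n /2⌉ *ᴾ B 1 ^ ⌊ suc n /2⌋)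
      ≈⟨ P.*-congˡ {quotients} (P.*-cong
           (P.trans (Pˣ.^-congˡ ⌈ suc n /2⌉ (geometric-cong p (q^-cong 1 (K.*-identityˡ _))))
                    (P.reflexive (cong (geometric y p ^_) ⌈n/2⌉≡)))
           (Pˣ.^-congˡ ⌊ suc n /2⌋ (geometric-cong p (q^-cong 1 (K.*-congʳ (K.*-identityʳ ε)))))) ⟩
    quotients *ᴾ residual ∎
    where
    A B : ℕ → Poly
    A i = geometric (variableᴾ i ^ p) ((suc i * r) / p)
    B i = geometric (variableᴾ i) p
    Aₙ = geometric (variableᴾ n ^ p) ((suc n * r) / (p * s))

    split-factor : ∀ (i : Fin n) → factor e y e² (toℕ i) ≋ᴾ A (toℕ i) *ᴾ B (toℕ i)
    split-factor i = P.trans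
      (P.reflexive (cong (geometric (signedVariable e y e² (toℕ i)))
        (≡.sym (m/n*n≡m (∣n⇒∣m*n (suc (toℕ i)) p∣r)))))
      (geometric-split (toℕ i) ((suc (toℕ i) * r) / p))

    ⌈n/2⌉≡ : ⌈ suc n /2⌉ ≡ suc n ∸ ⌊ suc n /2⌋
    ⌈n/2⌉≡ = ≡.sym (≡.trans (cong (_∸ ⌊ suc n /2⌋) (≡.sym (ℕ.⌊n/2⌋+⌈n/2⌉≡n (suc n)))) (ℕ.m+n∸m≡n ⌊ suc n /2⌋ ⌈ suc n /2⌉))

  sumOver-factorisation : (gs : List (G r p (suc n))) → IsEnumeration (quotient r p s (suc n)) gs → Unique (quotient r p s (suc n)) gs →
    sumOver gs (term ∘ element) ≋ᴾ quotients *ᴾ ⟨ residual ⟩q^ p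
  sumOver-factorisation gs gs-all gs! = begin
    sumOver gs (term ∘ element)    ≈⟨ sumOver-quotient gs gs-all gs! ⟩
    _                              ≈⟨ keepFrom-cong 0 product-factorisation ⟩
    ⟨ quotients *ᴾ residual ⟩q^ p
      ≈⟨ quotients-transparent residual ⟩
    quotients *ᴾ ⟨ residual ⟩q^ p  ∎

  []at-^≡ : ∀ m F → [ m ]at (F ^ᴾ p) ≡ geometric (F ^ p) m
  []at-^≡ m F = ≡.trans ([]at≡geometric m (F ^ᴾ p)) (cong (λ H → geometric H m) (^ᴾ≡^ F p))

  [p]at-^≡ : ∀ F m → ([ p ]at F) ^ᴾ m ≡ geometric F p ^ m
  [p]at-^≡ F m = ≡.trans (^ᴾ≡^ ([ p ]at F) m) (cong (_^ m) ([]at≡geometric p F))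

  quotientsᴾ≡ :
    productᴾ (λ (i : Fin n) → [ (suc (toℕ i) * r) / p ]at (variableᴾ (toℕ i) ^ᴾ p))
      *ᴾ [ (suc n * r) / (p * s) ]at (variableᴾ n ^ᴾ p)
    ≡ quotients
  quotientsᴾ≡ = cong₂ _*ᴾ_
    (≡.trans (productᴾ≡product (λ (i : Fin n) → [ (suc (toℕ i) * r) / p ]at (variableᴾ (toℕ i) ^ᴾ p)))
      (PΠ.sum-cong-≗ {n} (λ i → []at-^≡ ((suc (toℕ i) * r) / p) (variableᴾ (toℕ i)))))
    ([]at-^≡ ((suc n * r) / (p * s)) (variableᴾ n))

  residualᴾ≡ :
    ([ p ]at ((ζ ^ᴷ k) q^ 1)) ^ᴾ (suc n ∸ ⌊ suc n /2⌋) *ᴾ ([ p ]at ((ε *ᴷ ζ ^ᴷ k) q^ 1)) ^ᴾ ⌊ suc n /2⌋ ≡ residual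
  residualᴾ≡ = cong₂ _*ᴾ_ ([p]at-^≡ _ (suc n ∸ ⌊ suc n /2⌋)) ([p]at-^≡ _ ⌊ suc n /2⌋)

unit-square : ∀ {a ℓ} (K : CommutativeRing a ℓ) → let open OverRing K in
  ∀ {ε} → ε ≈ 1# ⊎ ε ≈ - 1# → ε *ᴷ ε ≈ 1#
unit-square K (inj₁ ε≈1)  = trans (*-cong ε≈1 ε≈1) (*-identityˡ 1#)
  where open CommutativeRing K
unit-square K (inj₂ ε≈-1) = trans (*-cong ε≈-1 ε≈-1) (trans (-1*x≈-x (- 1#)) (-‿involutive 1#))
  where
  open CommutativeRing K
  open RingProperties ring

theorem4p1 :
  ∀ {a ℓ} (K : CommutativeRing a ℓ) →
  let open OverRing K in
  (r p s n-1 : ℕ) .{{_ : NonZero r}} .{{_ : NonZero p}} .{{_ : NonZero s}} →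
  let n = suc n-1
      m = ⌊ n /2⌋ in
  p ∣ r → (s∣r : s ∣ r) → p * s ∣ r * n →
  (ε : Carrier) → ε ≈ 1# ⊎ ε ≈ - 1# →
  (ζ : Carrier) → PrimitiveRoot r ζ →
  (k : ℕ) → k < r / p → s ∣ k * n →
  (gs : List (G r p n)) → IsEnumeration (quotient r p s n) gs → Unique (quotient r p s n) gs →
  sumOver gs (λ g → χ ε k ζ g q^ fmaj s s∣r g)
    ≈ᴾ
  productᴾ (λ (i : Fin n-1) → [ (suc (toℕ i) * r) / p ]at (((ε ^ᴷ toℕ i *ᴷ ζ ^ᴷ k) q^ 1) ^ᴾ p))
    *ᴾ [ _/_ (n * r) (p * s) {{m*n≢0 p s}} ]at (((ε ^ᴷ n-1 *ᴷ ζ ^ᴷ k) q^ 1) ^ᴾ p)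
    *ᴾ ⟨ ([ p ]at ((ζ ^ᴷ k) q^ 1)) ^ᴾ (n ∸ m) *ᴾ ([ p ]at ((ε *ᴷ ζ ^ᴷ k) q^ 1)) ^ᴾ m ⟩q^ p
theorem4p1 K r p s n-1 p∣r s∣r ps∣rn ε ε≈±1 ζ (ζ^r≈1 , _) k _ s∣kn gs gs-all gs! =
  coeff-≈ (subst (sumOver gs (term ∘ element) ≋ᴾ_)
    (cong₂ (λ Q H → Q *ᴾ ⟨ H ⟩q^ p) (≡.sym quotientsᴾ≡) (≡.sym residualᴾ≡))
    (sumOver-factorisation gs gs-all gs!))
  where
  open Enumerator K r p s n-1 p∣r s∣r ps∣rn ε (unit-square K ε≈±1) ζ ζ^r≈1 k s∣kn
  open OverRing K
  open PolynomialSemiring K using (_≋ᴾ_; coeff-≈)
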